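{- Let $a$ be a positive integer such that $a$ is even, or $a$ has a regular prime divisor, or $2\le a\le 1500$. Then the equation $a\,T_k(m)=(2m+1)^k$ has no solutions in positive integers $(m,k)$ with $m>1$.
   Context: For positive integers $k,m$, $T_k(m):=\sum_{j=1}^{m}(2j-1)^k$ is the sum of the $k$th powers of the first $m$ odd positive integers. Bernoulli numbers $B_j$ are defined by $\frac{z}{e^z-1}=\sum_{j\ge0}B_j\frac{z^j}{j!}$; write $B_j=U_j/V_j$ in lowest terms with $V_j>0$. An odd prime $p$ is irregular if $p\mid U_r$ for some even $r\le p-3$; otherwise an odd prime is called regular. -}

module Defs where

open import Data.Nat as ℕ using (ℕ; zero; suc; _+_; _*_; _^_; _∸_; _≤_; _<_)
open import Data.Nat.Combinatorics using (_C_)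
open import Data.Nat.Divisibility using (_∣_)
open import Data.Nat.Primality using (Prime)
open import Data.Integer as ℤ using (ℤ; +_)
open import Data.Rational as ℚ using (ℚ; 0ℚ; 1ℚ; _/_)
open import Data.List using (List; []; _∷_; _∷ʳ_; foldr; zip; upTo; length)
open import Data.List using (lookup)
open import Data.Maybe using (Maybe; just; nothing)
open import Data.Product using (_×_; ∃)
open import Relation.Nullary using (¬_)

T : ℕ → ℕ → ℕ
T k zero    = 0
T k (suc m) = T k m + (2 * m + 1) ^ k

-- Bernoulli numbers (convention B₁ = -1/2, from z/(e^z - 1)) via the
-- standard recurrence  Σ_{j=0}^{n} C(n+1,j) B_j = 0  for n ≥ 1, B₀ = 1:
--   B_n = -(1/(n+1)) Σ_{j<n} C(n+1,j) B_j.
private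
  nextB : ℕ → List ℚ → ℚ
  nextB n bs = ℚ.- ((+ 1 / suc n) ℚ.* s)
    where
    go : ℕ → List ℚ → ℚ
    go j []       = 0ℚ
    go j (b ∷ bs) = ((+ (suc n C j)) / 1) ℚ.* b ℚ.+ go (suc j) bs
    s = go 0 bs

  bernList : ℕ → List ℚ
  bernList zero    = []
  bernList (suc n) = let bs = bernList n in bs ∷ʳ (if0 n bs)
    where
    if0 : ℕ → List ℚ → ℚ
    if0 zero    _  = 1ℚ
    if0 (suc k) bs = nextB (suc k) bs

  lastOr : List ℚ → ℚ
  lastOr []           = 0ℚ
  lastOr (x ∷ [])     = x
  lastOr (_ ∷ y ∷ ys) = lastOr (y ∷ ys)

B : ℕ → ℚ
B n = lastOr (bernList (suc n))

-- U_n : numerator of B_n in lowest terms (ℚ is normalised; denominator > 0)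
U : ℕ → ℤ
U n = ℚ.↥ (B n)

RegularPrime : ℕ → Set
RegularPrime p = Prime p × ¬ (2 ∣ p) ×
  (∀ r → 2 ∣ r → r ≤ p ∸ 3 → ¬ (p ∣ ℤ.∣ U r ∣))

{-# OPTIONS --safe #-}

-- Put n = 2 m + 1.  If k is odd, then m divides T k m, hence n ^ k, and m = 1.
--
-- Let k be even and let p be an odd prime with p ^ e exactly dividing n, e ≥ 1,
-- and p ^ s exactly dividing k.  Since a ≤ (5 / 3) ^ k, the equation makes T k m
-- divisible by p ^ (e + s + 1).  Reflecting j to n - j gives
-- T k m ≡ 2 ^ (k - 1) S k n modulo that power, where S k n = Σ_{j < n} j ^ k.
-- Hence p - 1 does not divide k, as S k n would otherwise be divisible only by
-- p ^ (e - 1); and by Voronoi's congruence k can be replaced by its residue r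
-- modulo p - 1: p ^ (e + 1) divides S r n.  The numbers S i n / n and S i p / p
-- satisfy modulo p the recurrence of the Bernoulli numbers, so p divides U r,
-- and p ^ 2 divides S r p.  If p is a regular divisor of a, this is absurd.
--
-- For odd a ≤ 1500 let p be the least prime factor of a.  The r ≤ p - 3 for
-- which p ^ 2 divides T r ((p - 1) / 2), equivalently S r p, are computed; k is
-- congruent to one of them modulo p - 1.  The remaining residue classes of k are
-- removed by further primes q: the class of t modulo q - 1 contains no k if
-- T t ((q - 1) / 2) is nonzero modulo q ^ 2, which rules out q ∣ n, and if
-- a T t x ≡ (2 x + 1) ^ t modulo q has no solution with 2 x + 1 prime to q.
module Submission where

-- For `m = 1` every `a = 3 ^ k` is a solution, so congruences on `k` alone cannot suffice; with `k`
-- even, `1 < m` enters through the bound `a ≤ (5 / 3) ^ k`. That bound pays for one factor `p`.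
-- Voronoi's congruence makes `c ^ k S k n` and `S k n` differ by `n k Φ`, where `Φ` modulo `p`
-- depends only on `k` modulo `p - 1`. The product `n k` contains exactly `p ^ (e + s)`, so
-- divisibility by `p ^ (e + s + 1)` is what forces `Φ` to vanish modulo `p`. Power sums thus take
-- over the roles of von Staudt-Clausen and Kummer's congruence; Bernoulli numbers appear only to
-- meet the definition of a regular prime. In the code `n` contains `p ^ suc e`, and the exponent
-- `e + s + 1` reads `2 + (s + e)`. The cases of small odd `a` are evaluated by the type checker.
-- Candidates `r` are found from `T r` modulo `p ^ 2`, with many such values packed as the digits of
-- one large number, so that a few operations on large integers replace many small ones. If the
-- least prime factor of `a` admits no `r`, the list of residues is empty and the sieve succeeds at
-- once; one check therefore serves regular and irregular primes.

-- Integer congruences, finite sums and Hasse derivatives of powers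

module Congruence where

  open import Data.Nat as ℕ using (ℕ; zero; suc)
  import Data.Nat.Properties as ℕ
  open import Data.Integer using (ℤ; +_; _+_; _*_; -_; _-_; _^_; 0ℤ; 1ℤ)
  open import Data.Integer.Properties hiding (_≟_; _≤?_)
  open import Data.Integer.Tactic.RingSolver using (solve-∀)
  open import Data.Product using (∃; _,_)
  open import Relation.Binary.Bundles using (Setoid)
  open import Relation.Binary.PropositionalEquality
  import Relation.Binary.Reasoning.Setoid as SetoidReasoning

  infix 4 _≈_[_]

  -- The quotient is kept as data, so that each closure property is a polynomial identity for the
  -- ring solver and moduli can be products whose factors are cancelled later.
  record _≈_[_] (x y N : ℤ) : Set where
    constructor by
    field
      quotient : ℤ
      equality : x ≡ y + quotient * N

  module _ {N : ℤ} where

    ≈-reflexive : ∀ {x y} → x ≡ y → x ≈ y [ N ]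
    ≈-reflexive {x} refl = by 0ℤ (lemma x N)
      where
      lemma : ∀ x N → x ≡ x + 0ℤ * N
      lemma = solve-∀

    ≈-refl : ∀ {x} → x ≈ x [ N ]
    ≈-refl = ≈-reflexive refl

    ≈-sym : ∀ {x y} → x ≈ y [ N ] → y ≈ x [ N ]
    ≈-sym {y = y} (by q refl) = by (- q) (lemma y q N)
      where
      lemma : ∀ y q N → y ≡ y + q * N + - q * N
      lemma = solve-∀

    ≈-trans : ∀ {x y z} → x ≈ y [ N ] → y ≈ z [ N ] → x ≈ z [ N ]
    ≈-trans {z = z} (by q refl) (by r refl) = by (q + r) (lemma z q r N)
      where
      lemma : ∀ z q r N → z + r * N + q * N ≡ z + (q + r) * N
      lemma = solve-∀

    +-cong-≈ : ∀ {x y u v} → x ≈ y [ N ] → u ≈ v [ N ] → x + u ≈ y + v [ N ]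
    +-cong-≈ {y = y} {v = v} (by q refl) (by r refl) = by (q + r) (lemma y v q r N)
      where
      lemma : ∀ y v q r N → y + q * N + (v + r * N) ≡ y + v + (q + r) * N
      lemma = solve-∀

    *-cong-≈ : ∀ {x y u v} → x ≈ y [ N ] → u ≈ v [ N ] → x * u ≈ y * v [ N ]
    *-cong-≈ {y = y} {v = v} (by q refl) (by r refl) =
      by (q * v + y * r + q * r * N) (lemma y v q r N)
      where
      lemma : ∀ y v q r N → (y + q * N) * (v + r * N) ≡ y * v + (q * v + y * r + q * r * N) * N
      lemma = solve-∀

    +-congˡ-≈ : ∀ c {x y} → x ≈ y [ N ] → c + x ≈ c + y [ N ]
    +-congˡ-≈ c = +-cong-≈ (≈-refl {c})

    +-congʳ-≈ : ∀ c {x y} → x ≈ y [ N ] → x + c ≈ y + c [ N ]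
    +-congʳ-≈ c x≈y = +-cong-≈ x≈y (≈-refl {c})

    *-congˡ-≈ : ∀ c {x y} → x ≈ y [ N ] → c * x ≈ c * y [ N ]
    *-congˡ-≈ c = *-cong-≈ (≈-refl {c})

    *-congʳ-≈ : ∀ c {x y} → x ≈ y [ N ] → x * c ≈ y * c [ N ]
    *-congʳ-≈ c x≈y = *-cong-≈ x≈y (≈-refl {c})

    neg-cong-≈ : ∀ {x y} → x ≈ y [ N ] → - x ≈ - y [ N ]
    neg-cong-≈ {y = y} (by q refl) = by (- q) (lemma y q N)
      where
      lemma : ∀ y q N → - (y + q * N) ≡ - y + - q * N
      lemma = solve-∀

    ^-cong-≈ : ∀ {x y} k → x ≈ y [ N ] → x ^ k ≈ y ^ k [ N ]
    ^-cong-≈ zero    x≈y = ≈-refl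
    ^-cong-≈ (suc k) x≈y = *-cong-≈ x≈y (^-cong-≈ k x≈y)

  ≈-setoid : ℤ → Setoid _ _
  ≈-setoid N = record
    { _≈_           = _≈_[ N ]
    ; isEquivalence = record { refl = ≈-refl ; sym = ≈-sym ; trans = ≈-trans }
    }

  module ≈-Reasoning (N : ℤ) = SetoidReasoning (≈-setoid N)

  weaken-≈ : ∀ {x y} M N → x ≈ y [ M * N ] → x ≈ y [ N ]
  weaken-≈ {y = y} M N (by q eq) = by (q * M) (trans eq (cong (_+_ y) (sym (*-assoc q M N))))

  ^-distribʳ-* : ∀ k x y → (x * y) ^ k ≡ x ^ k * y ^ k
  ^-distribʳ-* zero    x y = refl
  ^-distribʳ-* (suc k) x y rewrite ^-distribʳ-* k x y = lemma x y (x ^ k) (y ^ k)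
    where
    lemma : ∀ x y u v → x * y * (u * v) ≡ x * u * (y * v)
    lemma = solve-∀

  pos-^ : ∀ m k → + (m ℕ.^ k) ≡ (+ m) ^ k
  pos-^ m zero    = refl
  pos-^ m (suc k) = trans (pos-* m (m ℕ.^ k)) (cong (+ m *_) (pos-^ m k))

  sum : ℕ → (ℕ → ℤ) → ℤ
  sum zero    f = 0ℤ
  sum (suc n) f = sum n f + f n

  sum-cong-≈ : ∀ {N} n {f g} → (∀ i → i ℕ.< n → f i ≈ g i [ N ]) → sum n f ≈ sum n g [ N ]
  sum-cong-≈ zero    f≈g = ≈-refl
  sum-cong-≈ (suc n) f≈g =
    +-cong-≈ (sum-cong-≈ n (λ i i<n → f≈g i (ℕ.m<n⇒m<1+n i<n))) (f≈g n (ℕ.n<1+n n))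

  sum-cong : ∀ n {f g} → (∀ i → i ℕ.< n → f i ≡ g i) → sum n f ≡ sum n g
  sum-cong zero    f≡g = refl
  sum-cong (suc n) f≡g =
    cong₂ _+_ (sum-cong n (λ i i<n → f≡g i (ℕ.m<n⇒m<1+n i<n))) (f≡g n (ℕ.n<1+n n))

  sum-+ : ∀ n f g → sum n (λ i → f i + g i) ≡ sum n f + sum n g
  sum-+ zero    f g = refl
  sum-+ (suc n) f g rewrite sum-+ n f g = lemma (sum n f) (sum n g) (f n) (g n)
    where
    lemma : ∀ a b c d → a + b + (c + d) ≡ a + c + (b + d)
    lemma = solve-∀

  sum-*ˡ : ∀ n c f → sum n (λ i → c * f i) ≡ c * sum n f
  sum-*ˡ zero    c f = sym (*-zeroʳ c)
  sum-*ˡ (suc n) c f rewrite sum-*ˡ n c f = sym (*-distribˡ-+ c (sum n f) (f n))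

  sum-++ : ∀ m n f → sum (m ℕ.+ n) f ≡ sum m f + sum n (λ i → f (m ℕ.+ i))
  sum-++ m zero    f rewrite ℕ.+-identityʳ m = sym (+-identityʳ _)
  sum-++ m (suc n) f rewrite ℕ.+-suc m n | sum-++ m n f = +-assoc (sum m f) _ _

  sum-head : ∀ n f → sum (suc n) f ≡ f 0 + sum n (λ i → f (suc i))
  sum-head n f = trans (sum-++ 1 n f) (cong (_+ sum n (λ i → f (suc i))) (+-identityˡ (f 0)))

  sum-reverse : ∀ n f → sum n f ≡ sum n (λ i → f (n ℕ.∸ suc i))
  sum-reverse zero    f = refl
  sum-reverse (suc n) f = begin
    sum n f + f n                                   ≡⟨ cong (_+ f n) (sum-reverse n f) ⟩
    sum n (λ i → f (n ℕ.∸ suc i)) + f n             ≡⟨ +-comm _ (f n) ⟩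
    f n + sum n (λ i → f (n ℕ.∸ suc i))             ≡⟨ sum-head n _ ⟨
    sum (suc n) (λ i → f (n ℕ.∸ i))                 ∎
    where open ≡-Reasoning

  sum-const : ∀ n c → sum n (λ _ → c) ≡ + n * c
  sum-const zero    c = refl
  sum-const (suc n) c rewrite sum-const n c = lemma (+ n) c
    where
    lemma : ∀ n c → n * c + c ≡ (1ℤ + n) * c
    lemma = solve-∀

  sum-blocks : ∀ t n f → sum (t ℕ.* n) f ≡ sum t (λ u → sum n (λ v → f (u ℕ.* n ℕ.+ v)))
  sum-blocks zero    n f = refl
  sum-blocks (suc t) n f = begin
    sum (n ℕ.+ t ℕ.* n) f                                  ≡⟨ cong (λ m → sum m f) (ℕ.+-comm n (t ℕ.* n)) ⟩
    sum (t ℕ.* n ℕ.+ n) f                                  ≡⟨ sum-++ (t ℕ.* n) n f ⟩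
    sum (t ℕ.* n) f + sum n (λ v → f (t ℕ.* n ℕ.+ v))
      ≡⟨ cong (_+ sum n (λ v → f (t ℕ.* n ℕ.+ v))) (sum-blocks t n f) ⟩
    sum t (λ u → sum n (λ v → f (u ℕ.* n ℕ.+ v))) + sum n (λ v → f (t ℕ.* n ℕ.+ v)) ∎
    where open ≡-Reasoning

  sum-swap : ∀ m n (f : ℕ → ℕ → ℤ) → sum m (λ i → sum n (f i)) ≡ sum n (λ j → sum m (λ i → f i j))
  sum-swap zero    n f = sym (trans (sum-const n 0ℤ) (*-zeroʳ (+ n)))
  sum-swap (suc m) n f rewrite sum-swap m n f = sym (sum-+ n _ (f m))

  -- The first two Hasse derivatives of x ^ k.
  ∂ ∂₂ : ℕ → ℤ → ℤ
  ∂ zero    x = 0ℤ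
  ∂ (suc k) x = x * ∂ k x + x ^ k
  ∂₂ zero    x = 0ℤ
  ∂₂ (suc k) x = x * ∂₂ k x + ∂ k x

  -- The quadratic term is kept apart from the remainder: for a `p`-th power it gains a factor `p`
  -- from `∂₂ p`, which the square of the increment alone may lack.
  taylor : ∀ k x v → ∃ λ z → (x + v) ^ k ≡ x ^ k + v * ∂ k x + v * v * ∂₂ k x + v * v * v * z
  taylor zero    x v = 0ℤ , lemma v
    where
    lemma : ∀ v → 1ℤ ≡ 1ℤ + v * 0ℤ + v * v * 0ℤ + v * v * v * 0ℤ
    lemma = solve-∀
  taylor (suc k) x v with taylor k x v
  ... | z , eq rewrite eq = ∂₂ k x + (x + v) * z , lemma x v (x ^ k) (∂ k x) (∂₂ k x) z
    where
    lemma : ∀ x v a b c z → (x + v) * (a + v * b + v * v * c + v * v * v * z)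
            ≡ x * a + v * (x * b + a) + v * v * (x * c + b) + v * v * v * (c + (x + v) * z)
    lemma = solve-∀

  ∂-suc : ∀ k x → ∂ (suc k) x ≡ + suc k * x ^ k
  ∂-suc zero    x = lemma x
    where
    lemma : ∀ x → x * 0ℤ + 1ℤ ≡ 1ℤ * 1ℤ
    lemma = solve-∀
  ∂-suc (suc k) x rewrite ∂-suc k x = lemma x (+ suc k) (x ^ k)
    where
    lemma : ∀ x k y → x * (k * y) + x * y ≡ (1ℤ + k) * (x * y)
    lemma = solve-∀

  ∂-multiple : ∀ k x → ∃ λ w → ∂ k x ≡ + k * w
  ∂-multiple zero    x = 0ℤ , refl
  ∂-multiple (suc k) x = x ^ k , ∂-suc k x

  ∂-+ : ∀ m n x → ∂ (m ℕ.+ n) x ≡ ∂ m x * x ^ n + x ^ m * ∂ n x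
  ∂-+ zero    n x = lemma (x ^ n) (∂ n x)
    where
    lemma : ∀ a b → b ≡ 0ℤ * a + 1ℤ * b
    lemma = solve-∀
  ∂-+ (suc m) n x rewrite ∂-+ m n x | ^-distribˡ-+-* x m n = lemma x (∂ m x) (∂ n x) (x ^ m) (x ^ n)
    where
    lemma : ∀ x a b c d → x * (a * d + c * b) + c * d ≡ (x * a + c) * d + x * c * b
    lemma = solve-∀

  -- Chain rule for the `m`-th power of `x ^ n`.
  ∂-* : ∀ m n x → ∂ (m ℕ.* n) x ≡ ∂ m (x ^ n) * ∂ n x
  ∂-* zero    n x = refl
  ∂-* (suc m) n x
    rewrite ∂-+ n (m ℕ.* n) x | ∂-* m n x | ℕ.*-comm m n | sym (^-*-assoc x n m) =
    lemma (x ^ n) (∂ n x) (∂ m (x ^ n)) ((x ^ n) ^ m)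
    where
    lemma : ∀ x a b c → a * c + x * (b * a) ≡ (x * b + c) * a
    lemma = solve-∀

  -- The binomial coefficient of `n + 1` over 2, built additively to avoid halving.
  triangle : ℕ → ℕ
  triangle zero    = zero
  triangle (suc n) = triangle n ℕ.+ suc n

  ∂₂-suc : ∀ k x → ∂₂ (suc (suc k)) x ≡ + triangle (suc k) * x ^ k
  ∂₂-suc zero    x = lemma x
    where
    lemma : ∀ x → x * (x * 0ℤ + 0ℤ) + (x * 0ℤ + 1ℤ) ≡ 1ℤ * 1ℤ
    lemma = solve-∀
  ∂₂-suc (suc k) x rewrite ∂₂-suc k x | ∂-suc (suc k) x =
    lemma x (+ triangle (suc k)) (+ suc (suc k)) (x ^ k)
    where
    lemma : ∀ x t k y → x * (t * y) + k * (x * y) ≡ (t + k) * (x * y)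
    lemma = solve-∀

-- First-order expansion of powers modulo prime powers

module Linearization where

  open Congruence
  open import Data.Nat as ℕ using (ℕ; zero; suc)
  import Data.Nat.Properties as ℕ
  import Data.Nat.Divisibility as ℕ
  open import Data.Nat.Primality
  open import Data.Integer using (ℤ; +_; _+_; _*_; _^_; 0ℤ; 1ℤ)
  open import Data.Integer.Properties hiding (_≟_; _≤?_)
  open import Data.Integer.Tactic.RingSolver using (solve-∀)
  import Data.Nat.Tactic.RingSolver as ℕSolver
  open import Data.Product using (∃; _,_; proj₁; proj₂)
  open import Data.Sum using (inj₁; inj₂)
  open import Relation.Nullary
  open import Relation.Binary.PropositionalEquality

  2*triangle : ∀ n → 2 ℕ.* triangle n ≡ n ℕ.* suc n
  2*triangle zero    = refl
  2*triangle (suc n) rewrite ℕ.*-distribˡ-+ 2 (triangle n) (suc n) | 2*triangle n = lemma n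
    where
    lemma : ∀ n → n ℕ.* suc n ℕ.+ 2 ℕ.* suc n ≡ suc n ℕ.* suc (suc n)
    lemma = ℕSolver.solve-∀

  module OddPrime {p : ℕ} (p-prime : Prime p) (p-odd : ¬ 2 ℕ.∣ p) where

    P : ℤ
    P = + p

    p∤2 : ¬ p ℕ.∣ 2
    p∤2 p∣2 with irreducible[2] p∣2
    ... | inj₁ refl = ¬prime[1] p-prime
    ... | inj₂ refl = p-odd ℕ.∣-refl

    -- Oddness of `p` enters here: `p (p - 1) / 2` keeps its factor `p`. The fact serves both as the
    -- divisibility of the second binomial coefficient and as that of the sum of all residues.
    ∣triangle : ∀ {j} → p ≡ suc j → p ℕ.∣ triangle j
    ∣triangle {j} p≡ with euclidsLemma 2 (triangle j) p-prime
                            (subst (p ℕ.∣_) (sym (2*triangle j)) (ℕ.∣n⇒∣m*n j (ℕ.∣-reflexive p≡)))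
    ... | inj₁ p∣2 = contradiction p∣2 p∤2
    ... | inj₂ p∣t = p∣t

    ∂₂-multiple : ∀ x → ∃ λ w → ∂₂ p x ≡ P * w
    ∂₂-multiple x = go p refl
      where
      go : ∀ m → p ≡ m → ∃ λ w → ∂₂ m x ≡ P * w
      go 0 p≡0 = 0ℤ , sym (*-zeroʳ P)
      go 1 p≡1 = contradiction (subst Prime p≡1 p-prime) ¬prime[1]
      go (suc (suc j)) p≡ with ∣triangle p≡
      ... | ℕ.divides q eq = + q * x ^ j , (begin
        ∂₂ (suc (suc j)) x           ≡⟨ ∂₂-suc j x ⟩
        + triangle (suc j) * x ^ j   ≡⟨ cong (λ z → + z * x ^ j) eq ⟩
        + (q ℕ.* p) * x ^ j          ≡⟨ cong (_* x ^ j) (pos-* q p) ⟩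
        + q * P * x ^ j              ≡⟨ lemma (+ q) P (x ^ j) ⟩
        P * (+ q * x ^ j)            ∎)
        where
        open ≡-Reasoning
        lemma : ∀ a b c → a * b * c ≡ b * (a * c)
        lemma = solve-∀

    -- The modulus carries the factor p ^ s of the exponent because raising to
    -- the p-th power gains one factor p.
    linearize : ∀ N s l x y →
      (x + P * N * y) ^ (p ℕ.^ s ℕ.* l)
        ≈ x ^ (p ℕ.^ s ℕ.* l) + P * N * y * ∂ (p ℕ.^ s ℕ.* l) x [ P * (P ^ s * (P * N)) ]
    linearize N zero l x y rewrite ℕ.*-identityˡ l with taylor l x (P * N * y)
    ... | z , eq = by (N * (y * y * ∂₂ l x + P * N * y * y * y * z))
      (trans eq (lemma P N y (x ^ l) (∂ l x) (∂₂ l x) z))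
      where
      lemma : ∀ P N y a b c z →
        a + P * N * y * b + P * N * y * (P * N * y) * c + P * N * y * (P * N * y) * (P * N * y) * z
        ≡ a + P * N * y * b + N * (y * y * c + P * N * y * y * y * z) * (P * (1ℤ * (P * N)))
      lemma = solve-∀
    linearize N (suc s) l x y = subst
      (λ k → (x + P * N * y) ^ k ≈ x ^ k + P * N * y * ∂ k x [ P * (P ^ suc s * (P * N)) ])
      (sym (ℕ.*-assoc p (p ℕ.^ s) l)) goal
      where
      k = p ℕ.^ s ℕ.* l
      ih = linearize N s l x y
      z = _≈_[_].quotient ih
      w = + l * proj₁ (∂-multiple k x)
      B = x ^ k
      -- By the induction hypothesis the inner power is `B + P * u * c`: the linear term contains
      -- `P ^ s` through `∂ k x`, and the error term has one factor `P` more.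
      u = P ^ s * N
      c = y * w + z * P
      w₁ = proj₁ (∂-multiple p B)
      w₂ = proj₁ (∂₂-multiple B)
      t = proj₁ (taylor p B (P * u * c))

      ∂k : ∂ k x ≡ P ^ s * w
      ∂k = begin
        ∂ k x                                                    ≡⟨ proj₂ (∂-multiple k x) ⟩
        + (p ℕ.^ s ℕ.* l) * proj₁ (∂-multiple k x)
          ≡⟨ cong (_* proj₁ (∂-multiple k x)) (pos-* (p ℕ.^ s) l) ⟩
        + (p ℕ.^ s) * + l * proj₁ (∂-multiple k x)               ≡⟨ *-assoc (+ (p ℕ.^ s)) (+ l) _ ⟩
        + (p ℕ.^ s) * w                                          ≡⟨ cong (_* w) (pos-^ p s) ⟩
        P ^ s * w                                                ∎
        where open ≡-Reasoning

      step : (x + P * N * y) ^ k ≡ B + P * u * c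
      step = begin
        (x + P * N * y) ^ k                                      ≡⟨ _≈_[_].equality ih ⟩
        B + P * N * y * ∂ k x + z * (P * (P ^ s * (P * N)))
          ≡⟨ cong (λ d → B + P * N * y * d + z * (P * (P ^ s * (P * N)))) ∂k ⟩
        B + P * N * y * (P ^ s * w) + z * (P * (P ^ s * (P * N))) ≡⟨ lemma B P N y (P ^ s) w z ⟩
        B + P * u * c                                            ∎
        where
        open ≡-Reasoning
        lemma : ∀ B P N y Ps w z → B + P * N * y * (Ps * w) + z * (P * (Ps * (P * N)))
          ≡ B + P * (Ps * N) * (y * w + z * P)
        lemma = solve-∀

      goal : (x + P * N * y) ^ (p ℕ.* k)
        ≈ x ^ (p ℕ.* k) + P * N * y * ∂ (p ℕ.* k) x [ P * (P * P ^ s * (P * N)) ]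
      -- The three parts of the quotient: the old error gains `P` from `∂ p B`, the quadratic term
      -- gains `P` from `∂₂ p B`, and the cubic term already contains `P` three times.
      goal = by (z * w₁ + u * c * c * w₂ + u * u * c * c * c * t) (begin
        (x + P * N * y) ^ (p ℕ.* k)            ≡⟨ cong ((x + P * N * y) ^_) (ℕ.*-comm p k) ⟩
        (x + P * N * y) ^ (k ℕ.* p)            ≡⟨ ^-*-assoc (x + P * N * y) k p ⟨
        ((x + P * N * y) ^ k) ^ p              ≡⟨ cong (_^ p) step ⟩
        (B + P * u * c) ^ p                    ≡⟨ proj₂ (taylor p B (P * u * c)) ⟩
        B ^ p + P * u * c * ∂ p B + P * u * c * (P * u * c) * ∂₂ p B + P * u * c * (P * u * c) *
          (P * u * c) * t
          ≡⟨ cong₂ (λ a b → B ^ p + P * u * c * a + P * u * c * (P * u * c) * b + P * u * c *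
            (P * u * c) * (P * u * c) * t)
               (proj₂ (∂-multiple p B)) (proj₂ (∂₂-multiple B)) ⟩
        B ^ p + P * u * c * (P * w₁) + P * u * c * (P * u * c) * (P * w₂) + P * u * c * (P * u * c)
          * (P * u * c) * t
          ≡⟨ lemma (B ^ p) P (P ^ s) N y w z w₁ (u * c * c * w₂) (u * u * c * c * c * t)
              (lemma₂ P (P ^ s) N c w₂) (lemma₃ P (P ^ s) N c t) ⟩
        B ^ p + P * N * y * (P * w₁ * (P ^ s * w)) + Q * (P * (P * P ^ s * (P * N)))
          ≡⟨ cong₂ (λ a b → B ^ p + P * N * y * (a * b) + Q * (P * (P * P ^ s * (P * N))))
            (proj₂ (∂-multiple p B)) ∂k ⟨
        B ^ p + P * N * y * (∂ p B * ∂ k x) + Q * (P * (P * P ^ s * (P * N)))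
          ≡⟨ cong₂ (λ a b → a + P * N * y * b + Q * (P * (P * P ^ s * (P * N))))
               (trans (^-*-assoc x k p) (cong (x ^_) (ℕ.*-comm k p))) (sym (∂-* p k x)) ⟩
        x ^ (p ℕ.* k) + P * N * y * ∂ (p ℕ.* k) x + Q * (P * (P * P ^ s * (P * N))) ∎)
        where
        open ≡-Reasoning
        Q = z * w₁ + u * c * c * w₂ + u * u * c * c * c * t
        lemma₂ : ∀ P Ps N c w → P * (Ps * N) * c * (P * (Ps * N) * c) * (P * w)
          ≡ Ps * N * c * c * w * (P * (P * Ps * (P * N)))
        lemma₂ = solve-∀
        lemma₃ : ∀ P Ps N c t → P * (Ps * N) * c * (P * (Ps * N) * c) * (P * (Ps * N) * c) * t
          ≡ Ps * N * (Ps * N) * c * c * c * t * (P * (P * Ps * (P * N)))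
        lemma₃ = solve-∀
        lemma₁ : ∀ B P Ps N y w z w₁ → B + P * (Ps * N) * (y * w + z * P) * (P * w₁)
          ≡ B + P * N * y * (P * w₁ * (Ps * w)) + z * w₁ * (P * (P * Ps * (P * N)))
        lemma₁ = solve-∀
        lemma₄ : ∀ B y a b c M → B + y + a * M + b * M + c * M ≡ B + y + (a + b + c) * M
        lemma₄ = solve-∀
        lemma : ∀ B P Ps N y w z w₁ a b {A₂ A₃} → A₂ ≡ a * (P * (P * Ps * (P * N))) →
          A₃ ≡ b * (P * (P * Ps * (P * N))) →
          B + P * (Ps * N) * (y * w + z * P) * (P * w₁) + A₂ + A₃
          ≡ B + P * N * y * (P * w₁ * (Ps * w)) + (z * w₁ + a + b) * (P * (P * Ps * (P * N)))
        lemma B P Ps N y w z w₁ a b refl refl =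
          trans (cong (λ e → e + a * M + b * M) (lemma₁ B P Ps N y w z w₁))
                (lemma₄ B (P * N * y * (P * w₁ * (Ps * w))) (z * w₁) a b M)
          where M = P * (P * Ps * (P * N))

-- Power sums: reflection, Voronoi's congruence, recurrence

module PowerSums where

  open Congruence
  open import Defs using (T)
  open import Data.Nat as ℕ using (ℕ; zero; suc; NonZero)
  import Data.Nat.Properties as ℕ
  open import Data.Nat.Combinatorics using (_C_; nCk+nC[k+1]≡[n+1]C[k+1]; k>n⇒nCk≡0; nCn≡1)
  open import Data.Fin as Fin using (Fin; toℕ; fromℕ<)
  open import Data.Fin.Properties using (toℕ-injective; toℕ-fromℕ<; toℕ<n)
  open import Data.Fin.Permutation using (Permutation; permutation)
  open import Data.Integer using (ℤ; +_; -[1+_]; _+_; _*_; -_; _-_; _^_; 0ℤ; 1ℤ)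
  open import Data.Integer.DivMod using (_%ℕ_; _/ℕ_; n%ℕd<d; a≡a%ℕn+[a/ℕn]*n)
  open import Data.Integer.Properties hiding (_≟_; _≤?_)
  open import Data.Integer.Tactic.RingSolver using (solve-∀)
  open import Algebra.Properties.CommutativeMonoid.Sum +-0-commutativeMonoid
    using (sum-permute; sum-cong-≗) renaming (sum to Σ)
  open import Relation.Nullary
  open import Relation.Binary.PropositionalEquality

  S : ℕ → ℕ → ℤ
  S k n = sum n (λ j → (+ j) ^ k)

  -- A hypothesis on the modulus `W`, so that reflection and Voronoi's congruence are each proved
  -- once and then used both with the factor `p ^ s` of the exponent and without it.
  Linear : ℕ → ℕ → ℤ → Set
  Linear n k W = ∀ x y → (x + + n * y) ^ k ≈ x ^ k + + n * y * ∂ k x [ W ]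

  neg-^-even : ∀ h x → (- x) ^ (2 ℕ.* h) ≡ x ^ (2 ℕ.* h)
  neg-^-even h x = begin
    (- x) ^ (2 ℕ.* h)  ≡⟨ ^-*-assoc (- x) 2 h ⟨
    ((- x) ^ 2) ^ h    ≡⟨ cong (_^ h) (lemma x) ⟩
    (x ^ 2) ^ h        ≡⟨ ^-*-assoc x 2 h ⟩
    x ^ (2 ℕ.* h)      ∎
    where
    open ≡-Reasoning
    lemma : ∀ x → - x * (- x * 1ℤ) ≡ x * (x * 1ℤ)
    lemma = solve-∀

  T-sum : ∀ k m → + T k m ≡ sum m (λ i → (+ (2 ℕ.* i ℕ.+ 1)) ^ k)
  T-sum k zero    = refl
  T-sum k (suc m) = cong₂ _+_ (T-sum k m) (pos-^ (2 ℕ.* m ℕ.+ 1) k)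

  module _ {h m W} (lin : Linear (2 ℕ.* m ℕ.+ 1) (2 ℕ.* suc h) W) where

    private
      k k′ n : ℕ
      k  = 2 ℕ.* suc h
      k′ = ℕ.pred k
      n  = 2 ℕ.* m ℕ.+ 1

      reflect : ∀ x → (+ n - x) ^ k ≈ x ^ k - + n * (+ k * x ^ k′) [ W ]
      reflect x = begin
        (+ n - x) ^ k                          ≡⟨ cong (_^ k) (lemma₁ (+ n) x) ⟩
        (- x + + n * 1ℤ) ^ k                   ≈⟨ lin (- x) 1ℤ ⟩
        (- x) ^ k + + n * 1ℤ * ∂ k (- x)
          ≡⟨ cong₂ (λ a b → a + + n * 1ℤ * b) (neg-^-even (suc h) x) (∂-suc k′ (- x)) ⟩
        x ^ k + + n * 1ℤ * (+ k * (- x) ^ k′)  ≡⟨ cong (λ a → x ^ k + + n * 1ℤ * (+ k * a)) odd ⟩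
        x ^ k + + n * 1ℤ * (+ k * - (x ^ k′))  ≡⟨ lemma₂ (x ^ k) (+ n) (+ k) (x ^ k′) ⟩
        x ^ k - + n * (+ k * x ^ k′)           ∎
        where
        open ≈-Reasoning W
        lemma₁ : ∀ n x → n - x ≡ - x + n * 1ℤ
        lemma₁ = solve-∀
        lemma₂ : ∀ a n k b → a + n * 1ℤ * (k * - b) ≡ a - n * (k * b)
        lemma₂ = solve-∀
        odd : (- x) ^ k′ ≡ - (x ^ k′)
        odd rewrite ℕ.+-suc h (h ℕ.+ 0) = trans (cong (- x *_) (neg-^-even h x)) (sym (neg-distribˡ-* x _))

      Q R : ℤ
      Q = sum m (λ i → (+ suc i) ^ k)
      R = sum m (λ i → (+ suc i) ^ k′)

      reflected-sum : ∀ (f : ℕ → ℤ) → sum m (λ i → (+ n - f i) ^ k)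
        ≈ sum m (λ i → f i ^ k) - + n * (+ k * sum m (λ i → f i ^ k′)) [ W ]
      reflected-sum f = begin
        sum m (λ i → (+ n - f i) ^ k)
          ≈⟨ sum-cong-≈ m {λ i → (+ n - f i) ^ k} {λ i → f i ^ k - + n * (+ k * f i ^ k′)}
          (λ i _ → reflect (f i)) ⟩
        sum m (λ i → f i ^ k - + n * (+ k * f i ^ k′))
          ≡⟨ sum-cong m {λ i → f i ^ k - + n * (+ k * f i ^ k′)}
          {λ i → f i ^ k + - (+ n * + k) * f i ^ k′} (λ i _ → lemma (f i ^ k) (+ n) (+ k) (f i ^ k′)) ⟩
        sum m (λ i → f i ^ k + - (+ n * + k) * f i ^ k′)
          ≡⟨ sum-+ m (λ i → f i ^ k) (λ i → - (+ n * + k) * f i ^ k′) ⟩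
        sum m (λ i → f i ^ k) + sum m (λ i → - (+ n * + k) * f i ^ k′)
          ≡⟨ cong (_+_ (sum m (λ i → f i ^ k))) (sum-*ˡ m (- (+ n * + k)) (λ i → f i ^ k′)) ⟩
        sum m (λ i → f i ^ k) + - (+ n * + k) * sum m (λ i → f i ^ k′)
          ≡⟨ lemma (sum m (λ i → f i ^ k)) (+ n) (+ k) (sum m (λ i → f i ^ k′)) ⟨
        sum m (λ i → f i ^ k) - + n * (+ k * sum m (λ i → f i ^ k′))  ∎
        where
        open ≈-Reasoning W
        lemma : ∀ a n k b → a - n * (k * b) ≡ a + - (n * k) * b
        lemma = solve-∀

      S≈ : S k n ≈ + 2 * Q - + n * (+ k * R) [ W ]
      S≈ = begin
        S k n                                                   ≡⟨ cong (S k) (n≡ m) ⟩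
        S k (suc m ℕ.+ m)                                       ≡⟨ sum-++ (suc m) m (λ j → (+ j) ^ k) ⟩
        S k (suc m) + sum m (λ i → (+ (suc m ℕ.+ i)) ^ k)
          ≡⟨ cong₂ _+_ (trans (sum-head m (λ j → (+ j) ^ k)) (+-identityˡ Q))
          (trans (sum-reverse m (λ i → (+ (suc m ℕ.+ i)) ^ k))
          (sum-cong m λ i i<m → cong (_^ k) (index i i<m))) ⟩
        Q + sum m (λ i → (+ n - + suc i) ^ k)
          ≈⟨ +-congˡ-≈ Q (reflected-sum (λ i → + suc i)) ⟩
        Q + (Q - + n * (+ k * R))                               ≡⟨ lemma Q (+ n * (+ k * R)) ⟩
        + 2 * Q - + n * (+ k * R)                               ∎
        where
        open ≈-Reasoning W
        lemma : ∀ q r → q + (q - r) ≡ + 2 * q - r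
        lemma = solve-∀
        n≡ : ∀ m → 2 ℕ.* m ℕ.+ 1 ≡ suc m ℕ.+ m
        n≡ m rewrite ℕ.+-identityʳ m | ℕ.+-comm (m ℕ.+ m) 1 = refl
        index : ∀ i → i ℕ.< m → + (suc m ℕ.+ (m ℕ.∸ suc i)) ≡ + n - + suc i
        add-sub : ∀ a b → a ≡ a + b - b
        add-sub = solve-∀
        index i i<m = trans (add-sub (+ (suc m ℕ.+ (m ℕ.∸ suc i))) (+ suc i))
          (cong (λ z → + z - + suc i)
            (trans (ℕ.+-assoc (suc m) _ _) (trans (cong (suc m ℕ.+_) (ℕ.m∸n+n≡m i<m)) (sym (n≡ m)))))

      T≈ : + T k m ≈ (+ 2) ^ k * Q - + n * (+ k * ((+ 2) ^ k′ * R)) [ W ]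
      T≈ = begin
        + T k m                                             ≡⟨ T-sum k m ⟩
        sum m (λ i → (+ (2 ℕ.* i ℕ.+ 1)) ^ k)
          ≡⟨ trans (sum-reverse m (λ i → (+ (2 ℕ.* i ℕ.+ 1)) ^ k))
          (sum-cong m λ i i<m → cong (_^ k) (index i i<m)) ⟩
        sum m (λ i → (+ n - + 2 * + suc i) ^ k)             ≈⟨ reflected-sum (λ i → + 2 * + suc i) ⟩
        sum m (λ i → (+ 2 * + suc i) ^ k) - + n * (+ k * sum m (λ i → (+ 2 * + suc i) ^ k′))
          ≡⟨ cong₂ (λ a b → a - + n * (+ k * b)) (scaled k) (scaled k′) ⟩
        (+ 2) ^ k * Q - + n * (+ k * ((+ 2) ^ k′ * R))      ∎
        where
        open ≈-Reasoning W
        scaled : ∀ k → sum m (λ i → (+ 2 * + suc i) ^ k) ≡ (+ 2) ^ k * sum m (λ i → (+ suc i) ^ k)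
        scaled k = trans (sum-cong m (λ i _ → ^-distribʳ-* k (+ 2) (+ suc i)))
          (sum-*ˡ m ((+ 2) ^ k) (λ i → (+ suc i) ^ k))
        index : ∀ i → i ℕ.< m → + (2 ℕ.* (m ℕ.∸ suc i) ℕ.+ 1) ≡ + n - + 2 * + suc i
        regroup : ∀ a b → + 2 * a + 1ℤ ≡ + 2 * (a + b) + 1ℤ - + 2 * b
        regroup = solve-∀
        index i i<m = trans (cong (_+ 1ℤ) (pos-* 2 (m ℕ.∸ suc i)))
          (trans (regroup (+ (m ℕ.∸ suc i)) (+ suc i))
            (trans (cong (λ z → + 2 * + z + 1ℤ - + 2 * + suc i) (ℕ.m∸n+n≡m i<m))
              (cong (λ z → z + 1ℤ - + 2 * + suc i) (sym (pos-* 2 m)))))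

    -- With `1 ≤ i ≤ m`, the numbers below `n` are `i` and `n - i`, which gives `2 Q - n k R`; the
    -- odd ones are `n - 2 i`, which gives `2 ^ k Q - n k 2 ^ (k - 1) R`. The second expression is
    -- `2 ^ (k - 1)` times the first.
    T≈2^*S : + T k m ≈ (+ 2) ^ k′ * S k n [ W ]
    T≈2^*S = begin
      + T k m                                             ≈⟨ T≈ ⟩
      (+ 2) ^ k * Q - + n * (+ k * ((+ 2) ^ k′ * R))      ≡⟨ lemma ((+ 2) ^ k′) Q (+ n) (+ k) R ⟩
      (+ 2) ^ k′ * (+ 2 * Q - + n * (+ k * R))            ≈⟨ *-congˡ-≈ ((+ 2) ^ k′) S≈ ⟨
      (+ 2) ^ k′ * S k n                                  ∎
      where
      open ≈-Reasoning W
      lemma : ∀ a q n k r → + 2 * a * q - n * (k * (a * r)) ≡ a * (+ 2 * q - n * (k * r))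
      lemma = solve-∀

  module _ {n : ℕ} .{{_ : NonZero n}} where

    %ℕ-≈ : ∀ x → + (x %ℕ n) ≈ x [ + n ]
    %ℕ-≈ x = ≈-sym (by (x /ℕ n) (a≡a%ℕn+[a/ℕn]*n x n))

    residue-unique : ∀ {a b} → a ℕ.< n → b ℕ.< n → + a ≈ + b [ + n ] → a ≡ b
    residue-unique {a} {b} a<n b<n (by (+ zero)  eq) = +-injective (trans eq (+-identityʳ (+ b)))
    residue-unique {a} {b} a<n b<n (by (+ suc q) eq) = contradiction a<n (ℕ.≤⇒≯ (begin
      n                        ≤⟨ ℕ.m≤m+n n (q ℕ.* n) ⟩
      suc q ℕ.* n              ≤⟨ ℕ.m≤n+m (suc q ℕ.* n) b ⟩
      b ℕ.+ suc q ℕ.* n        ≡⟨ +-injective (trans eq (cong (_+_ (+ b)) (sym (pos-* (suc q) n)))) ⟨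
      a                        ∎))
      where open ℕ.≤-Reasoning
    residue-unique {a} {b} a<n b<n (by -[1+ q ] eq) = contradiction b<n (ℕ.≤⇒≯ (begin
      n                        ≤⟨ ℕ.m≤m+n n (q ℕ.* n) ⟩
      suc q ℕ.* n              ≤⟨ ℕ.m≤n+m (suc q ℕ.* n) a ⟩
      a ℕ.+ suc q ℕ.* n        ≡⟨ +-injective
        (trans (cong (_+_ (+ a)) (pos-* (suc q) n))
        (trans (cong (_+ + suc q * + n) eq) (lemma (+ b) (+ suc q) (+ n)))) ⟩
      b                        ∎))
      where
      open ℕ.≤-Reasoning
      lemma : ∀ b q n → b + - q * n + q * n ≡ b
      lemma = solve-∀

    -- Passage to sums over `Fin`, for which invariance under permutations is available.
    sum-Fin : ∀ m f → sum m f ≡ Σ {m} (λ i → f (toℕ i))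
    sum-Fin zero    f = refl
    sum-Fin (suc m) f = trans (sum-head m f) (cong (_+_ (f 0)) (sum-Fin m (λ i → f (suc i))))

    private
      scale : ℤ → Fin n → Fin n
      scale c i = fromℕ< (n%ℕd<d (c * + toℕ i) n)

      scale-inverse : ∀ {c d} → c * d ≈ 1ℤ [ + n ] → ∀ i → scale c (scale d i) ≡ i
      scale-inverse {c} {d} cd≈1 i = toℕ-injective
        (trans (toℕ-fromℕ< _) (residue-unique (n%ℕd<d (c * + toℕ (scale d i)) n) (toℕ<n i) (begin
          + ((c * + toℕ (scale d i)) %ℕ n)   ≈⟨ %ℕ-≈ (c * + toℕ (scale d i)) ⟩
          c * + toℕ (scale d i)              ≡⟨ cong (λ z → c * + z) (toℕ-fromℕ< _) ⟩
          c * + ((d * + toℕ i) %ℕ n)         ≈⟨ *-congˡ-≈ c (%ℕ-≈ (d * + toℕ i)) ⟩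
          c * (d * + toℕ i)                  ≡⟨ *-assoc c d (+ toℕ i) ⟨
          c * d * + toℕ i                    ≈⟨ *-congʳ-≈ (+ toℕ i) cd≈1 ⟩
          1ℤ * + toℕ i                       ≡⟨ *-identityˡ (+ toℕ i) ⟩
          + toℕ i                            ∎)))
        where open ≈-Reasoning (+ n)

    sum-scale : ∀ {c d} → c * d ≈ 1ℤ [ + n ] → ∀ g → sum n (λ j → g ((c * + j) %ℕ n)) ≡ sum n g
    sum-scale {c} {d} cd≈1 g = begin
      sum n (λ j → g ((c * + j) %ℕ n))       ≡⟨ sum-Fin n (λ j → g ((c * + j) %ℕ n)) ⟩
      Σ {n} (λ i → g ((c * + toℕ i) %ℕ n))
        ≡⟨ sum-cong-≗ {n} (λ i → cong g (sym (toℕ-fromℕ< (n%ℕd<d (c * + toℕ i) n)))) ⟩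
      Σ {n} (λ i → g (toℕ (scale c i)))      ≡⟨ sum-permute (λ i → g (toℕ i)) π ⟨
      Σ {n} (λ i → g (toℕ i))                ≡⟨ sum-Fin n g ⟨
      sum n g                                ∎
      where
      open ≡-Reasoning
      π : Permutation n n
      π = permutation (scale c) (scale d) (scale-inverse {c} {d} cd≈1)
            (scale-inverse {d} {c} (≈-trans (≈-reflexive (*-comm d c)) cd≈1))

    -- The sum in Voronoi's congruence: floor of `c j / n` times the `k`-th power of the residue of
    -- `c j`. The exponent `k` occurs only in that power, so Fermat's theorem applies to it
    -- termwise.
    Φ : ℤ → ℕ → ℤ
    Φ c k = sum n (λ j → ((c * + j) /ℕ n) * (+ ((c * + j) %ℕ n)) ^ k)

    -- Multiplication by a unit c permutes the residues modulo n; comparing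
    -- c j with its residue to first order is Voronoi's congruence.
    voronoi : ∀ {k W c d} → c * d ≈ 1ℤ [ + n ] → Linear n (suc k) W →
      c ^ suc k * S (suc k) n ≈ S (suc k) n + + n * (+ suc k * Φ c k) [ W ]
    voronoi {k} {W} {c} {d} cd≈1 lin = begin
      c ^ suc k * S (suc k) n                              ≡⟨ sum-*ˡ n (c ^ suc k) (λ j → (+ j) ^ suc k) ⟨
      sum n (λ j → c ^ suc k * (+ j) ^ suc k)
        ≡⟨ sum-cong n (λ j _ → sym (^-distribʳ-* (suc k) c (+ j))) ⟩
      sum n (λ j → (c * + j) ^ suc k)
        ≈⟨ sum-cong-≈ n {λ j → (c * + j) ^ suc k}
        {λ j → r j ^ suc k + + n * + suc k * (q j * r j ^ k)} (λ j _ → expand (c * + j)) ⟩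
      sum n (λ j → r j ^ suc k + + n * + suc k * (q j * r j ^ k))
        ≡⟨ sum-+ n (λ j → r j ^ suc k) (λ j → + n * + suc k * (q j * r j ^ k)) ⟩
      sum n (λ j → r j ^ suc k) + sum n (λ j → + n * + suc k * (q j * r j ^ k))
        ≡⟨ cong₂ _+_ (sum-scale {c} {d} cd≈1 (λ j → (+ j) ^ suc k))
          (trans (sum-*ˡ n (+ n * + suc k) (λ j → q j * r j ^ k)) (*-assoc (+ n) (+ suc k) (Φ c k))) ⟩
      S (suc k) n + + n * (+ suc k * Φ c k)                ∎
      where
      open ≈-Reasoning W
      q r : ℕ → ℤ
      q j = (c * + j) /ℕ n
      r j = + ((c * + j) %ℕ n)
      expand : ∀ x → x ^ suc k ≈ (+ (x %ℕ n)) ^ suc k + + n * + suc k * (x /ℕ n * (+ (x %ℕ n)) ^ k) [ W ]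
      expand x = begin
        x ^ suc k                                       ≡⟨ cong (_^ suc k)
          (trans (a≡a%ℕn+[a/ℕn]*n x n) (cong (_+_ (+ (x %ℕ n))) (*-comm (x /ℕ n) (+ n)))) ⟩
        (+ (x %ℕ n) + + n * (x /ℕ n)) ^ suc k           ≈⟨ lin (+ (x %ℕ n)) (x /ℕ n) ⟩
        (+ (x %ℕ n)) ^ suc k + + n * (x /ℕ n) * ∂ (suc k) (+ (x %ℕ n))
          ≡⟨ cong (λ z → (+ (x %ℕ n)) ^ suc k + + n * (x /ℕ n) * z) (∂-suc k (+ (x %ℕ n))) ⟩
        (+ (x %ℕ n)) ^ suc k + + n * (x /ℕ n) * (+ suc k * (+ (x %ℕ n)) ^ k)
          ≡⟨ lemma ((+ (x %ℕ n)) ^ suc k) (+ n) (x /ℕ n) (+ suc k) ((+ (x %ℕ n)) ^ k) ⟩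
        (+ (x %ℕ n)) ^ suc k + + n * + suc k * (x /ℕ n * (+ (x %ℕ n)) ^ k) ∎
        where
        lemma : ∀ a n q k b → a + n * q * (k * b) ≡ a + n * k * (q * b)
        lemma = solve-∀

  binomial : ∀ n x → (x + 1ℤ) ^ n ≡ sum (suc n) (λ i → + (n C i) * x ^ i)
  binomial zero    x = refl
  binomial (suc n) x = begin
    (x + 1ℤ) * (x + 1ℤ) ^ n                             ≡⟨ cong (_*_ (x + 1ℤ)) (binomial n x) ⟩
    (x + 1ℤ) * s                                        ≡⟨ lemma₁ x s ⟩
    s + x * s                                           ≡⟨ cong₂ _+_ pad
      (sym (sum-*ˡ (suc n) x (λ i → + (n C i) * x ^ i))) ⟩
    1ℤ + sum (suc n) (λ i → + (n C suc i) * x ^ suc i) + sum (suc n) (λ i → x * (+ (n C i) * x ^ i))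
      ≡⟨ +-assoc 1ℤ (sum (suc n) (λ i → + (n C suc i) * x ^ suc i))
      (sum (suc n) (λ i → x * (+ (n C i) * x ^ i))) ⟩
    1ℤ + (sum (suc n) (λ i → + (n C suc i) * x ^ suc i) + sum (suc n) (λ i → x * (+ (n C i) * x ^ i)))
      ≡⟨ cong (_+_ 1ℤ) (sym (sum-+ (suc n) (λ i → + (n C suc i) * x ^ suc i)
        (λ i → x * (+ (n C i) * x ^ i)))) ⟩
    1ℤ + sum (suc n) (λ i → + (n C suc i) * x ^ suc i + x * (+ (n C i) * x ^ i))
      ≡⟨ cong (_+_ 1ℤ) (sum-cong (suc n)
        (λ i _ → trans (lemma₂ (+ (n C suc i)) (+ (n C i)) x (x ^ i))
        (cong (λ z → + z * x ^ suc i) (nCk+nC[k+1]≡[n+1]C[k+1] n i)))) ⟩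
    1ℤ + sum (suc n) (λ i → + (suc n C suc i) * x ^ suc i)
      ≡⟨ sum-head (suc n) (λ i → + (suc n C i) * x ^ i) ⟨
    sum (suc (suc n)) (λ i → + (suc n C i) * x ^ i)     ∎
    where
    open ≡-Reasoning
    s = sum (suc n) (λ i → + (n C i) * x ^ i)
    lemma₁ : ∀ x s → (x + 1ℤ) * s ≡ s + x * s
    lemma₁ = solve-∀
    lemma₂ : ∀ a b x y → a * (x * y) + x * (b * y) ≡ (b + a) * (x * y)
    lemma₂ = solve-∀
    pad : s ≡ 1ℤ + sum (suc n) (λ i → + (n C suc i) * x ^ suc i)
    pad = begin
      s                                              ≡⟨ sum-head n (λ i → + (n C i) * x ^ i) ⟩
      1ℤ + s′                                        ≡⟨ cong (_+_ 1ℤ) (+-identityʳ s′) ⟨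
      1ℤ + (s′ + 0ℤ)                                 ≡⟨ cong (λ z → 1ℤ + (s′ + + z * x ^ suc n))
        (k>n⇒nCk≡0 (ℕ.n<1+n n)) ⟨
      1ℤ + (s′ + + (n C suc n) * x ^ suc n)          ∎
      where s′ = sum n (λ i → + (n C suc i) * x ^ suc i)

  -- Summing the binomial expansion of `(j + 1) ^ suc r - j ^ suc r` over `j < n` telescopes.
  power-sum-recurrence : ∀ r n → sum (suc r) (λ i → + (suc r C i) * S i n) ≡ (+ n) ^ suc r
  power-sum-recurrence r n = begin
    sum (suc r) (λ i → + (suc r C i) * S i n)
      ≡⟨ sum-cong (suc r) (λ i _ → sym (sum-*ˡ n (+ (suc r C i)) (λ j → (+ j) ^ i))) ⟩
    sum (suc r) (λ i → sum n (λ j → + (suc r C i) * (+ j) ^ i))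
      ≡⟨ sum-swap (suc r) n (λ i j → + (suc r C i) * (+ j) ^ i) ⟩
    sum n (λ j → sum (suc r) (λ i → + (suc r C i) * (+ j) ^ i))        ≡⟨ telescope n ⟩
    (+ n) ^ suc r                                                      ∎
    where
    open ≡-Reasoning
    lemma : ∀ a s → a + s ≡ s + 1ℤ * a
    lemma = solve-∀
    telescope : ∀ n → sum n (λ j → sum (suc r) (λ i → + (suc r C i) * (+ j) ^ i)) ≡ (+ n) ^ suc r
    telescope zero    = refl
    telescope (suc n) = begin
      sum n (λ j → sum (suc r) (λ i → + (suc r C i) * (+ j) ^ i)) + s ≡⟨ cong (_+ s) (telescope n) ⟩
      (+ n) ^ suc r + s                                               ≡⟨ lemma ((+ n) ^ suc r) s ⟩
      s + 1ℤ * (+ n) ^ suc r                                          ≡⟨ cong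
        (λ z → s + + z * (+ n) ^ suc r) (nCn≡1 (suc r)) ⟨
      s + + (suc r C suc r) * (+ n) ^ suc r                           ≡⟨ binomial (suc r) (+ n) ⟨
      (+ n + 1ℤ) ^ suc r                                              ≡⟨ cong (λ z → (+ z) ^ suc r)
        (ℕ.+-comm n 1) ⟩
      (+ suc n) ^ suc r                                               ∎
      where s = sum (suc r) (λ i → + (suc r C i) * (+ n) ^ i)

-- Cancellation and Fermat's theorem modulo a prime

module PrimeModulus where

  open Congruence
  open PowerSums
  open import Data.Nat as ℕ using (ℕ; zero; suc; z≤n; s≤s; NonZero; _!)
  import Data.Nat.Properties as ℕ
  import Data.Nat.Divisibility as ℕ
  open import Data.Nat.DivMod using (m/n*n≡m)
  open import Data.Nat.Combinatorics using (_C_; nCk≡n!/k![n-k]!; nCn≡1; nC1≡n; nCk≡nC[n∸k]; k![n∸k]!∣n!)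
  open import Data.Nat.Coprimality using (Coprime; coprime-divisor)
  open import Data.Nat.Induction using (<-rec)
  open import Data.Nat.Primality
  open import Data.Integer using (ℤ; +_; _+_; _*_; -_; _-_; _^_; 0ℤ; 1ℤ; ∣_∣)
  open import Data.Integer.DivMod using (_%ℕ_)
  open import Data.Integer.Properties hiding (_≟_; _≤?_)
  import Data.Integer.Divisibility.Signed as Signed
  open import Data.Integer.Tactic.RingSolver using (solve-∀)
  open import Data.Product using (_,_)
  open import Data.Sum using (inj₁; inj₂)
  open import Relation.Nullary
  open import Relation.Binary.PropositionalEquality

  ≈0⇒∣ : ∀ {N x} → x ≈ 0ℤ [ + N ] → N ℕ.∣ ∣ x ∣
  ≈0⇒∣ {N} {x} (by q eq) = ℕ.divides ∣ q ∣
    (trans (cong ∣_∣ (trans eq (+-identityˡ (q * + N)))) (abs-* q (+ N)))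

  ∣⇒≈0 : ∀ {N x} → N ℕ.∣ ∣ x ∣ → x ≈ 0ℤ [ + N ]
  ∣⇒≈0 {N} {x} N∣x with Signed.∣ᵤ⇒∣ {+ N} {x} N∣x
  ... | Signed.divides q eq = by q (trans eq (sym (+-identityˡ (q * + N))))

  difference-≈ : ∀ {N x y} → x ≈ y [ N ] → x - y ≈ 0ℤ [ N ]
  difference-≈ {N} {x} {y} (by q refl) = by q (lemma y q N)
    where
    lemma : ∀ y q N → y + q * N - y ≡ 0ℤ + q * N
    lemma = solve-∀

  cancel-modulus : ∀ c .{{_ : NonZero c}} {x N} → + c * x ≈ 0ℤ [ + c * N ] → x ≈ 0ℤ [ N ]
  cancel-modulus c@(suc _) {x} {N} (by q eq) =
    by q (*-cancelˡ-≡ (+ c) x (0ℤ + q * N) (trans eq (lemma (+ c) q N)))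
    where
    lemma : ∀ c q N → 0ℤ + q * (c * N) ≡ c * (0ℤ + q * N)
    lemma = solve-∀

  scale-modulus : ∀ c {x y N} → x ≈ y [ N ] → c * x ≈ c * y [ c * N ]
  scale-modulus c {x} {y} {N} (by q refl) = by q (lemma c y q N)
    where
    lemma : ∀ c y q N → c * (y + q * N) ≡ c * y + q * (c * N)
    lemma = solve-∀

  coprime-* : ∀ {a b n} → Coprime a n → Coprime b n → Coprime (a ℕ.* b) n
  coprime-* {a} {b} {n} a⊥n b⊥n {d} (d∣ab , d∣n) =
    b⊥n (coprime-divisor {d} {a} (λ (i∣d , i∣a) → a⊥n (i∣a , ℕ.∣-trans i∣d d∣n)) d∣ab , d∣n)

  module _ {p : ℕ} (p-prime : Prime p) where

    private
      P : ℤ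
      P = + p

      instance
        p≢0 : NonZero p
        p≢0 = prime⇒nonZero p-prime

    prime⇒coprime-∤ : ∀ {n} → ¬ p ℕ.∣ n → Coprime p n
    prime⇒coprime-∤ p∤n (i∣p , i∣n) with prime⇒irreducible p-prime i∣p
    ... | inj₁ i≡1 = i≡1
    ... | inj₂ refl = contradiction i∣n p∤n

    coprime-^ : ∀ e {n} → ¬ p ℕ.∣ n → Coprime (p ℕ.^ e) n
    coprime-^ zero    p∤n (i∣1 , _) = ℕ.∣1⇒≡1 i∣1
    coprime-^ (suc e) p∤n = coprime-* {p} (prime⇒coprime-∤ p∤n) (coprime-^ e p∤n)

    cancel : ∀ e {c x} → ¬ p ℕ.∣ ∣ c ∣ → c * x ≈ 0ℤ [ P ^ e ] → x ≈ 0ℤ [ P ^ e ]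
    cancel e {c} {x} p∤c cx≈0 rewrite sym (pos-^ p e) =
      ∣⇒≈0 (coprime-divisor (coprime-^ e p∤c)
        (subst (p ℕ.^ e ℕ.∣_) (abs-* c x) (≈0⇒∣ {p ℕ.^ e} {c * x} cx≈0)))

    ∤1 : ¬ p ℕ.∣ 1
    ∤1 p∣1 = ¬prime[1] (subst Prime (ℕ.∣1⇒≡1 p∣1) p-prime)

    1≉0 : ¬ 1ℤ ≈ 0ℤ [ P ]
    1≉0 1≈0 = ∤1 (≈0⇒∣ {p} {1ℤ} 1≈0)

    ∤! : ∀ {k} → k ℕ.< p → ¬ p ℕ.∣ k !
    ∤! {zero}  k<p p∣1 = ∤1 p∣1
    ∤! {suc k} k<p p∣k! with euclidsLemma (suc k) (k !) p-prime p∣k!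
    ... | inj₁ p∣k  = ℕ.<⇒≱ k<p (ℕ.∣⇒≤ p∣k)
    ... | inj₂ p∣k! = ∤! (ℕ.<-trans (ℕ.n<1+n k) k<p) p∣k!

    ∣pCk : ∀ {k} → 0 ℕ.< k → k ℕ.< p → p ℕ.∣ p C k
    ∣pCk {k} 0<k k<p with euclidsLemma (p C k) (k ! ℕ.* (p ℕ.∸ k) !) p-prime (subst (p ℕ.∣_) p!≡ p∣p!)
      where
      instance
        denominator≢0 : NonZero (k ! ℕ.* (p ℕ.∸ k) !)
        denominator≢0 = ℕ.m*n≢0 (k !) ((p ℕ.∸ k) !) {{k ℕ.!≢0}} {{(p ℕ.∸ k) ℕ.!≢0}}
      p!≡ : p ! ≡ (p C k) ℕ.* (k ! ℕ.* (p ℕ.∸ k) !)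
      p!≡ = sym (trans (cong (ℕ._* (k ! ℕ.* (p ℕ.∸ k) !)) (nCk≡n!/k![n-k]! (ℕ.<⇒≤ k<p)))
                       (m/n*n≡m (k![n∸k]!∣n! (ℕ.<⇒≤ k<p))))
      p∣p! : p ℕ.∣ p !
      p∣p! = go p refl
        where
        go : ∀ q → p ≡ q → p ℕ.∣ q !
        go zero    p≡0 = contradiction (subst Prime p≡0 p-prime) ¬prime[0]
        go (suc q) p≡ = ℕ.∣m⇒∣m*n (q !) (ℕ.∣-reflexive p≡)
    ... | inj₁ p∣C = p∣C
    ... | inj₂ p∣k!* with euclidsLemma (k !) ((p ℕ.∸ k) !) p-prime p∣k!*
    ...   | inj₁ p∣k!  = contradiction p∣k! (∤! k<p)
    ...   | inj₂ p∣k!′ = contradiction p∣k!′ (∤! (ℕ.∸-monoʳ-< 0<k (ℕ.<⇒≤ k<p)))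

    private
      fermat-ℕ : ∀ m → (+ m) ^ p ≈ + m [ P ]
      fermat-ℕ zero    = ≈-reflexive (0^ p refl)
        where
        0^ : ∀ q → p ≡ q → 0ℤ ^ q ≡ 0ℤ
        0^ zero    p≡0 = contradiction (subst Prime p≡0 p-prime) ¬prime[0]
        0^ (suc q) _   = refl
      fermat-ℕ (suc m) = begin
        (+ suc m) ^ p                                ≡⟨ cong (λ z → (+ z) ^ p) (ℕ.+-comm 1 m) ⟩
        (+ m + 1ℤ) ^ p                               ≡⟨ binomial p (+ m) ⟩
        sum p (λ i → + (p C i) * (+ m) ^ i) + + (p C p) * (+ m) ^ p
          ≈⟨ +-cong-≈ (inner p refl)
            (≈-reflexive (trans (cong (λ z → + z * (+ m) ^ p) (nCn≡1 p)) (*-identityˡ ((+ m) ^ p)))) ⟩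
        1ℤ + (+ m) ^ p                               ≈⟨ +-congˡ-≈ 1ℤ (fermat-ℕ m) ⟩
        + suc m                                      ∎
        where
        open ≈-Reasoning P
        inner : ∀ q → p ≡ q → sum q (λ i → + (p C i) * (+ m) ^ i) ≈ 1ℤ [ P ]
        inner zero    p≡0 = contradiction (subst Prime p≡0 p-prime) ¬prime[0]
        inner (suc q) p≡ = begin
          sum (suc q) (λ i → + (p C i) * (+ m) ^ i)
            ≡⟨ sum-head q (λ i → + (p C i) * (+ m) ^ i) ⟩
          1ℤ + sum q (λ i → + (p C suc i) * (+ m) ^ suc i)
            ≈⟨ +-congˡ-≈ 1ℤ (sum-cong-≈ q {λ i → + (p C suc i) * (+ m) ^ suc i} {λ _ → 0ℤ}
              (λ i i<q → *-congʳ-≈ ((+ m) ^ suc i) {+ (p C suc i)} {0ℤ}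
                 (∣⇒≈0 {p} (∣pCk (s≤s z≤n) (subst (suc i ℕ.<_) (sym p≡) (s≤s i<q)))))) ⟩
          1ℤ + sum q (λ _ → 0ℤ)                                     ≡⟨ cong (_+_ 1ℤ)
            (trans (sum-const q 0ℤ) (*-zeroʳ (+ q))) ⟩
          1ℤ                                                        ∎

    fermat : ∀ x → x ^ p ≈ x [ P ]
    fermat x = begin
      x ^ p                ≈⟨ ^-cong-≈ p (%ℕ-≈ {p} x) ⟨
      (+ (x %ℕ p)) ^ p     ≈⟨ fermat-ℕ (x %ℕ p) ⟩
      + (x %ℕ p)           ≈⟨ %ℕ-≈ {p} x ⟩
      x                    ∎
      where open ≈-Reasoning P

    -- Positive exponents make this hold for multiples of `p` as well, so it can be applied to every
    -- term of a power sum.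
    ^-period : ∀ {q} → p ≡ suc q → ∀ a b x → x ^ (suc a ℕ.+ b ℕ.* q) ≈ x ^ suc a [ P ]
    ^-period p≡ a zero    x = ≈-reflexive (cong (x ^_) (ℕ.+-identityʳ (suc a)))
    ^-period {q} p≡ a (suc b) x = begin
      x ^ (suc a ℕ.+ (q ℕ.+ b ℕ.* q))      ≡⟨ cong (x ^_) (exponent a b) ⟩
      x ^ (p ℕ.+ (a ℕ.+ b ℕ.* q))          ≡⟨ ^-distribˡ-+-* x p (a ℕ.+ b ℕ.* q) ⟩
      x ^ p * x ^ (a ℕ.+ b ℕ.* q)          ≈⟨ *-congʳ-≈ (x ^ (a ℕ.+ b ℕ.* q)) (fermat x) ⟩
      x ^ (suc a ℕ.+ b ℕ.* q)              ≈⟨ ^-period p≡ a b x ⟩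
      x ^ suc a                            ∎
      where
      open ≈-Reasoning P
      exponent : ∀ a b → suc a ℕ.+ (q ℕ.+ b ℕ.* q) ≡ p ℕ.+ (a ℕ.+ b ℕ.* q)
      exponent a b rewrite p≡ = cong suc
        (trans (sym (ℕ.+-assoc a q _)) (trans (cong (ℕ._+ b ℕ.* q) (ℕ.+-comm a q)) (ℕ.+-assoc q a _)))

    -- The last coefficient of the recurrence is `suc r`, prime to `p` because `suc r < p`; hence
    -- each `D r` is determined by the earlier ones.
    recurrence-vanishes : ∀ e (D : ℕ → ℤ) →
      (∀ r → suc r ℕ.< p → sum (suc r) (λ i → + (suc r C i) * D i) ≈ 0ℤ [ P ^ e ]) →
      ∀ r → suc r ℕ.< p → D r ≈ 0ℤ [ P ^ e ]
    recurrence-vanishes e D recurrence = <-rec _ step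
      where
      step : ∀ r → (∀ {i} → i ℕ.< r → suc i ℕ.< p → D i ≈ 0ℤ [ P ^ e ]) → suc r ℕ.< p → D r ≈ 0ℤ [ P ^ e ]
      step r rec r<p = cancel e {+ suc r} {D r} (λ p∣r → ℕ.<⇒≱ r<p (ℕ.∣⇒≤ p∣r)) (begin
        + suc r * D r                                       ≡⟨ cong (λ z → + z * D r) [1+r]Cr≡1+r ⟨
        + (suc r C r) * D r                                 ≡⟨ +-identityˡ (+ (suc r C r) * D r) ⟨
        0ℤ + + (suc r C r) * D r                            ≈⟨ +-congʳ-≈ (+ (suc r C r) * D r) lower ⟨
        sum (suc r) (λ i → + (suc r C i) * D i)             ≈⟨ recurrence r r<p ⟩
        0ℤ                                                  ∎)
        where
        open ≈-Reasoning (P ^ e)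
        [1+r]Cr≡1+r : suc r C r ≡ suc r
        [1+r]Cr≡1+r = trans (nCk≡nC[n∸k] (ℕ.n≤1+n r))
          (trans (cong (suc r C_) (ℕ.m+n∸n≡m 1 r)) (nC1≡n (suc r)))
        lower : sum r (λ i → + (suc r C i) * D i) ≈ 0ℤ [ P ^ e ]
        lower = begin
          sum r (λ i → + (suc r C i) * D i)
            ≈⟨ sum-cong-≈ r {λ i → + (suc r C i) * D i} {λ _ → 0ℤ}
            (λ i i<r → ≈-trans (*-congˡ-≈ (+ (suc r C i)) (rec i<r (ℕ.<-trans (s≤s i<r) r<p)))
            (≈-reflexive (*-zeroʳ (+ (suc r C i))))) ⟩
          sum r (λ _ → 0ℤ)                   ≡⟨ trans (sum-const r 0ℤ) (*-zeroʳ (+ r)) ⟩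
          0ℤ                                 ∎

-- Units modulo p and power sums with exponent divisible by p - 1

module Units where

  open Congruence
  open Linearization using (module OddPrime)
  open PowerSums
  open PrimeModulus
  open import Data.Nat as ℕ using (ℕ; zero; suc; z≤n; s≤s)
  import Data.Nat.Properties as ℕ
  import Data.Nat.Divisibility as ℕ
  open import Data.Nat.GCD using (module Bézout)
  open import Data.Nat.Coprimality as Coprimality using (Coprime; coprime-Bézout)
  open import Data.Nat.Primality
  open import Data.Integer using (ℤ; +_; _+_; _*_; -_; _-_; _^_; 0ℤ; 1ℤ; ∣_∣)
  open import Data.Integer.Properties hiding (_≟_; _≤?_)
  open import Data.Integer.Tactic.RingSolver using (solve-∀)
  open import Data.Product using (∃; _×_; _,_; proj₁; proj₂)
  open import Relation.Nullary
  open import Relation.Binary.PropositionalEquality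

  S-blocks : ∀ k t N → S k (t ℕ.* N) ≈ + t * S k N [ + N ]
  S-blocks k t N = begin
    S k (t ℕ.* N)                                              ≡⟨ sum-blocks t N (λ j → (+ j) ^ k) ⟩
    sum t (λ u → sum N (λ v → (+ (u ℕ.* N ℕ.+ v)) ^ k))
      ≈⟨ sum-cong-≈ t (λ u _ → sum-cong-≈ N (λ v _ → ^-cong-≈ k (by (+ u) (index u v)))) ⟩
    sum t (λ u → S k N)                                        ≡⟨ sum-const t (S k N) ⟩
    + t * S k N                                                ∎
    where
    open ≈-Reasoning (+ N)
    index : ∀ u v → + (u ℕ.* N ℕ.+ v) ≡ + v + + u * + N
    index u v = trans (cong (λ z → + z) (ℕ.+-comm (u ℕ.* N) v)) (cong (_+_ (+ v)) (pos-* u N))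

  invertible : ∀ {n c} → Coprime n c → ∃ λ d → + c * d ≈ 1ℤ [ + n ]
  invertible {n} {c} n⊥c with coprime-Bézout n⊥c
  ... | Bézout.+- x y eq = - + y , by (- + x) (lemma (+ c) (+ y) (+ x) (+ n) (begin
    1ℤ + + y * + c         ≡⟨ cong (_+_ 1ℤ) (pos-* y c) ⟨
    + (1 ℕ.+ y ℕ.* c)      ≡⟨ cong (λ z → + z) eq ⟩
    + (x ℕ.* n)            ≡⟨ pos-* x n ⟩
    + x * + n              ∎))
    where
    open ≡-Reasoning
    rearrange : ∀ c y → c * - y ≡ 1ℤ + - (1ℤ + y * c)
    rearrange = solve-∀
    lemma : ∀ c y x n → 1ℤ + y * c ≡ x * n → c * - y ≡ 1ℤ + - x * n
    lemma c y x n eq = trans (rearrange c y)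
      (trans (cong (λ z → 1ℤ + - z) eq) (cong (_+_ 1ℤ) (neg-distribˡ-* x n)))
  ... | Bézout.-+ x y eq = + y , by (+ x) (begin
    + c * + y              ≡⟨ *-comm (+ c) (+ y) ⟩
    + y * + c              ≡⟨ pos-* y c ⟨
    + (y ℕ.* c)            ≡⟨ cong (λ z → + z) eq ⟨
    + (1 ℕ.+ x ℕ.* n)      ≡⟨ cong (_+_ 1ℤ) (pos-* x n) ⟩
    1ℤ + + x * + n         ∎)
    where open ≡-Reasoning

  module Vanishing {q : ℕ} (p-prime : Prime (suc q)) (p-odd : ¬ 2 ℕ.∣ suc q) where

    open OddPrime p-prime p-odd using (linearize; ∣triangle)

    p : ℕ
    p = suc q

    P : ℤ
    P = + p

    S-p≈0 : ∀ r → suc r ℕ.< p → S r p ≈ 0ℤ [ P ]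
    S-p≈0 r r<p = subst (λ N → S r p ≈ 0ℤ [ N ]) (*-identityʳ P)
      (recurrence-vanishes p-prime 1 (λ i → S i p)
        (λ r _ → ≈-trans (≈-reflexive (power-sum-recurrence r p)) (by (P ^ r) (lemma P (P ^ r)))) r r<p)
      where
      lemma : ∀ P a → P * a ≡ 0ℤ + a * (P * 1ℤ)
      lemma = solve-∀

    q≉0 : ¬ + q ≈ 0ℤ [ P ]
    q≉0 q≈0 = 1≉0 p-prime (begin
      1ℤ              ≡⟨ +-identityʳ 1ℤ ⟨
      1ℤ + 0ℤ         ≈⟨ +-congˡ-≈ 1ℤ q≈0 ⟨
      1ℤ + + q        ≈⟨ by 1ℤ (lemma P) ⟩
      0ℤ              ∎)
      where
      open ≈-Reasoning P
      lemma : ∀ P → P ≡ 0ℤ + 1ℤ * P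
      lemma = solve-∀

    S-p≈q : ∀ {k} → (∀ c → 0 ℕ.< c → c ℕ.< p → (+ c) ^ suc k ≈ 1ℤ [ P ]) → S (suc k) p ≈ + q [ P ]
    S-p≈q {k} roots = begin
      S (suc k) p                              ≡⟨ trans (sum-head q (λ j → (+ j) ^ suc k))
        (+-identityˡ (sum q (λ i → (+ suc i) ^ suc k))) ⟩
      sum q (λ i → (+ suc i) ^ suc k)
        ≈⟨ sum-cong-≈ q (λ i i<q → roots (suc i) (s≤s z≤n) (s≤s i<q)) ⟩
      sum q (λ _ → 1ℤ)                         ≡⟨ trans (sum-const q 1ℤ) (*-identityʳ (+ q)) ⟩
      + q                                      ∎
      where open ≈-Reasoning P

    -- This takes the place of a primitive root: if every unit had `suc r`-th power 1, then
    -- `S (suc r) p` would be `p - 1` modulo `p`, whereas the recurrence makes it 0.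
    non-root : ∀ r → suc (suc r) ℕ.< p → ∃ λ c → (0 ℕ.< c) × (c ℕ.< p) × ¬ p ℕ.∣ ∣ (+ c) ^ suc r - 1ℤ ∣
    non-root r r<p with ℕ.anyUpTo? (λ c → (0 ℕ.<? c) ×-dec ¬? (p ℕ.∣? ∣ (+ c) ^ suc r - 1ℤ ∣)) p
    ... | yes (c , c<p , 0<c , ≢1) = c , 0<c , c<p , ≢1
    ... | no none = contradiction (≈-trans (≈-sym (S-p≈q {r} roots)) (S-p≈0 (suc r) r<p)) q≉0
      where
      lemma : ∀ x → x ≡ x - 1ℤ + 1ℤ
      lemma = solve-∀
      roots : ∀ c → 0 ℕ.< c → c ℕ.< p → (+ c) ^ suc r ≈ 1ℤ [ P ]
      roots c 0<c c<p = ≈-trans (≈-reflexive (lemma ((+ c) ^ suc r)))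
        (+-congʳ-≈ 1ℤ {(+ c) ^ suc r - 1ℤ} {0ℤ}
        (∣⇒≈0 {p} (decidable-stable (p ℕ.∣? ∣ (+ c) ^ suc r - 1ℤ ∣) (λ ∤ → none (c , c<p , 0<c , ∤)))))

    cancel₁ : ∀ {c x} → ¬ p ℕ.∣ ∣ c ∣ → c * x ≈ 0ℤ [ P ] → x ≈ 0ℤ [ P ]
    cancel₁ {c} {x} p∤c cx≈0 = subst (λ N → x ≈ 0ℤ [ N ]) (*-identityʳ P)
      (cancel p-prime 1 {c} {x} p∤c (subst (λ N → c * x ≈ 0ℤ [ N ]) (sym (*-identityʳ P)) cx≈0))

    unit-^ : ∀ b {x} → ¬ p ℕ.∣ ∣ x ∣ → x ^ (b ℕ.* q) ≈ 1ℤ [ P ]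
    unit-^ b {x} p∤x = begin
      x ^ (b ℕ.* q)                  ≡⟨ lemma₂ (x ^ (b ℕ.* q)) ⟩
      x ^ (b ℕ.* q) - 1ℤ + 1ℤ        ≈⟨ +-congʳ-≈ 1ℤ (cancel₁ {x} {x ^ (b ℕ.* q) - 1ℤ} p∤x
        (≈-trans (≈-reflexive (lemma₁ x (x ^ (b ℕ.* q)))) (difference-≈ (^-period p-prime refl 0 b x)))) ⟩
      1ℤ                             ∎
      where
      open ≈-Reasoning P
      lemma₁ : ∀ x y → x * (y - 1ℤ) ≡ x * y - x * 1ℤ
      lemma₁ = solve-∀
      lemma₂ : ∀ x → x ≡ x - 1ℤ + 1ℤ
      lemma₂ = solve-∀

    -- Cut the range into `p` blocks of length `N`. To first order block `u` exceeds block 0 by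
    -- `N u D`, and the sum of all `u < p` is divisible by `p`.
    S-p* : ∀ k N₀ (let N = p ℕ.* N₀) → S k (p ℕ.* N) ≈ P * S k N [ P * + N ]
    S-p* k N₀ = begin
      S k (p ℕ.* N)                                              ≡⟨ sum-blocks p N (λ j → (+ j) ^ k) ⟩
      sum p (λ u → sum N (λ v → (+ (u ℕ.* N ℕ.+ v)) ^ k))
        ≈⟨ sum-cong-≈ p (λ u _ → sum-cong-≈ N (λ v _ → expand u v)) ⟩
      sum p (λ u → sum N (λ v → (+ v) ^ k + + N * + u * ∂ k (+ v)))
        ≡⟨ sum-cong p (λ u _ → trans (sum-+ N (λ v → (+ v) ^ k) (λ v → + N * + u * ∂ k (+ v)))
        (cong (_+_ (S k N)) (trans (sum-*ˡ N (+ N * + u) (λ v → ∂ k (+ v))) (lemma₁ (+ N) (+ u) D)))) ⟩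
      sum p (λ u → S k N + + N * D * + u)
        ≡⟨ trans (sum-+ p (λ _ → S k N) (λ u → + N * D * + u))
        (cong₂ _+_ (sum-const p (S k N)) (sum-*ˡ p (+ N * D) (λ u → + u))) ⟩
      P * S k N + + N * D * sum p (λ u → + u)
        ≡⟨ cong (λ z → P * S k N + + N * D * z)
        (trans (sum-id q) (trans (cong (λ z → + z) (ℕ._∣_.equality (∣triangle refl))) (pos-* t p))) ⟩
      P * S k N + + N * D * (+ t * P)
        ≈⟨ by (D * + t) (lemma₂ (P * S k N) (+ N) D (+ t) P) ⟩
      P * S k N                                                  ∎
      where
      N = p ℕ.* N₀
      open ≈-Reasoning (P * + N)
      D = sum N (λ v → ∂ k (+ v))
      t = ℕ._∣_.quotient (∣triangle refl)
      lemma₁ : ∀ N u D → N * u * D ≡ N * D * u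
      lemma₁ = solve-∀
      lemma₂ : ∀ a N D t P → a + N * D * (t * P) ≡ a + D * t * (P * N)
      lemma₂ = solve-∀
      sum-id : ∀ m → sum (suc m) (λ u → + u) ≡ + triangle m
      sum-id zero    = refl
      sum-id (suc m) = cong (_+ + suc m) (sum-id m)
      index : ∀ u v → + (u ℕ.* N ℕ.+ v) ≡ + v + P * + N₀ * + u
      index u v = trans (cong (λ z → + z) (ℕ.+-comm (u ℕ.* N) v))
        (cong (_+_ (+ v)) (trans (pos-* u N) (trans (*-comm (+ u) (+ N)) (cong (_* + u) (pos-* p N₀)))))
      expand : ∀ u v → (+ (u ℕ.* N ℕ.+ v)) ^ k ≈ (+ v) ^ k + + N * + u * ∂ k (+ v) [ P * + N ]
      expand u v = subst₂ (λ a b → (+ (u ℕ.* N ℕ.+ v)) ^ k ≈ (+ v) ^ k + a * + u * ∂ k (+ v) [ b ])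
        (sym (pos-* p N₀)) (cong (_*_ P) (trans (*-identityˡ (P * + N₀)) (sym (pos-* p N₀))))
        (≈-trans (≈-reflexive (cong (_^ k) (index u v)))
          (subst (λ k → (+ v + P * + N₀ * + u) ^ k ≈ (+ v) ^ k + P * + N₀ * + u * ∂ k (+ v) [ P *
            (1ℤ * (P * + N₀)) ])
            (ℕ.*-identityˡ k) (linearize (+ N₀) 0 k (+ v) (+ u))))

    -- The von Staudt-Clausen case. At `p` itself Fermat's theorem leaves `p - 1` terms equal to 1;
    -- each further factor `p` of the argument comes out as a factor `p` of the sum by `S-p*`.
    S-prime-power≉0 : ∀ b f → ¬ S (suc b ℕ.* q) (p ℕ.^ suc f) ≈ 0ℤ [ P ^ suc f ]
    S-prime-power≉0 b zero S≈0 =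
      q≉0 (≈-trans (≈-sym S≈q) (subst₂ (λ m M → S (suc b ℕ.* q) m ≈ 0ℤ [ M ]) (ℕ.*-identityʳ p)
      (*-identityʳ P) S≈0))
      where
      k-suc : ∀ j → p ≡ suc j → ∃ λ k → suc b ℕ.* q ≡ suc k
      k-suc zero    p≡1 = contradiction (subst Prime p≡1 p-prime) ¬prime[1]
      k-suc (suc j) refl = _ , refl
      k = proj₁ (k-suc q refl)
      k≡ = proj₂ (k-suc q refl)
      roots : ∀ c → 0 ℕ.< c → c ℕ.< p → (+ c) ^ suc k ≈ 1ℤ [ P ]
      roots (suc c) 0<c c<p = subst (λ k → (+ suc c) ^ k ≈ 1ℤ [ P ]) k≡
        (unit-^ (suc b) {+ suc c} (λ p∣c → ℕ.<⇒≱ c<p (ℕ.∣⇒≤ p∣c)))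
      S≈q : S (suc b ℕ.* q) p ≈ + q [ P ]
      S≈q = subst (λ k → S k p ≈ + q [ P ]) (sym k≡) (S-p≈q {k} roots)
    S-prime-power≉0 b (suc f) S≈0 = S-prime-power≉0 b f (cancel-modulus p (≈-trans (≈-sym
      (subst (λ N → S k (p ℕ.* (p ℕ.^ suc f)) ≈ P * S k (p ℕ.^ suc f) [ P * N ]) (pos-^ p (suc f))
        (S-p* k (p ℕ.^ f)))) S≈0))
      where k = suc b ℕ.* q

    S-multiple≉0 : ∀ b f n′ → ¬ p ℕ.∣ n′ → ¬ S (suc b ℕ.* q) (n′ ℕ.* p ℕ.^ suc f) ≈ 0ℤ [ P ^ suc f ]
    S-multiple≉0 b f n′ p∤n′ S≈0 = S-prime-power≉0 b f (cancel p-prime (suc f) {+ n′} p∤n′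
      (≈-trans (≈-sym (subst (λ N → S k (n′ ℕ.* p ℕ.^ suc f) ≈ + n′ * S k (p ℕ.^ suc f) [ N ])
        (pos-^ p (suc f)) (S-blocks k n′ (p ℕ.^ suc f)))) S≈0))
      where k = suc b ℕ.* q

-- Kummer's congruence for power sums

module Kummer where

  open Congruence
  open Linearization using (module OddPrime)
  open PowerSums
  open PrimeModulus
  open Units
  open import Data.Nat as ℕ using (ℕ; zero; suc; NonZero)
  import Data.Nat.Properties as ℕ
  import Data.Nat.Divisibility as ℕ
  open import Data.Nat.Coprimality as Coprimality using (Coprime)
  open import Data.Nat.Primality
  open import Data.Integer using (ℤ; +_; _+_; _*_; -_; _-_; _^_; 0ℤ; 1ℤ; ∣_∣)
  open import Data.Integer.DivMod using (_%ℕ_; _/ℕ_)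
  open import Data.Integer.Properties hiding (_≟_; _≤?_)
  open import Data.Integer.Tactic.RingSolver using (solve-∀)
  open import Data.Nat.Combinatorics using (_C_)
  open import Data.Product using (∃; _×_; _,_; proj₁; proj₂)
  open import Data.Sum using (inj₁; inj₂)
  open import Relation.Nullary
  open import Relation.Binary.PropositionalEquality

  module _ {q : ℕ} (p-prime : Prime (suc q)) (p-odd : ¬ 2 ℕ.∣ suc q) where

    open OddPrime p-prime p-odd using (linearize)
    open Vanishing p-prime p-odd hiding (p; P)

    private
      p : ℕ
      p = suc q

      P : ℤ
      P = + p

    module _ (e n′ : ℕ) (p∤n′ : ¬ p ℕ.∣ n′) where

      private
        n : ℕ
        n = p ℕ.^ suc e ℕ.* n′

        instance
          n≢0 : NonZero n
          n≢0 = ℕ.m*n≢0 (p ℕ.^ suc e) n′ {{ℕ.m^n≢0 p (suc e)}}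
            {{ℕ.≢-nonZero (λ n′≡0 → p∤n′ (subst (p ℕ.∣_) (sym n′≡0) (p ℕ.∣0)))}}

      -- The modulus has one factor `p` more than `p ^ suc e` from `n` and `p ^ s` from the exponent
      -- together.
      linear : ∀ s l → Linear n (p ℕ.^ s ℕ.* l) (P ^ (2 ℕ.+ (s ℕ.+ e)))
      linear s l x y = weaken-≈ (+ n′) (P ^ (2 ℕ.+ (s ℕ.+ e))) (subst₂
        (λ n M → (x + n * y) ^ k ≈ x ^ k + n * y * ∂ k x [ M ]) (sym n≡) modulus
        (linearize (+ (p ℕ.^ e ℕ.* n′)) s l x y))
        where
        k = p ℕ.^ s ℕ.* l
        n≡ : + n ≡ P * + (p ℕ.^ e ℕ.* n′)
        n≡ = trans (cong (λ z → + z) (ℕ.*-assoc p (p ℕ.^ e) n′)) (pos-* p (p ℕ.^ e ℕ.* n′))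
        lemma : ∀ P a b n → P * (a * (P * (b * n))) ≡ n * (P * (P * (a * b)))
        lemma = solve-∀
        modulus : P * (P ^ s * (P * + (p ℕ.^ e ℕ.* n′))) ≡ + n′ * P ^ (2 ℕ.+ (s ℕ.+ e))
        modulus = trans (cong (λ z → P * (P ^ s * (P * z)))
          (trans (pos-* (p ℕ.^ e) n′) (cong (_* + n′) (pos-^ p e))))
          (trans (lemma P (P ^ s) (P ^ e) (+ n′))
            (cong (λ z → + n′ * (P * (P * z))) (sym (^-distribˡ-+-* P s e))))

      ∤-multiple : ∀ b {k} → k ≡ suc b ℕ.* q → ¬ S k n ≈ 0ℤ [ P ^ suc e ]
      ∤-multiple b refl S≈0 = S-multiple≉0 b e n′ p∤n′
        (subst (λ m → S (suc b ℕ.* q) m ≈ 0ℤ [ P ^ suc e ]) (ℕ.*-comm (p ℕ.^ suc e) n′) S≈0)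

      -- Voronoi's congruence permutes the residues modulo all of `n`, so a multiplier chosen modulo
      -- `p` must be lifted to a unit modulo `n`.
      unit : ∀ c₀ → ¬ p ℕ.∣ c₀ → ∃ λ c → ∃ λ d → (c * d ≈ 1ℤ [ + n ]) × (c ≈ + c₀ [ P ])
      unit c₀ p∤c₀ = + c , proj₁ inv , proj₂ inv , c≈c₀
        where
        -- Modulo `p` the power of `n′` is 1 by Fermat's theorem; a common divisor of `c` and `n′`
        -- divides `p`, and `p` does not divide `n′`.
        c = c₀ ℕ.* n′ ℕ.^ q ℕ.+ p
        c≈c₀ : + c ≈ + c₀ [ P ]
        c≈c₀ = begin
          + (c₀ ℕ.* n′ ℕ.^ q) + P         ≡⟨ cong (_+ P)
            (trans (pos-* c₀ (n′ ℕ.^ q)) (cong (_*_ (+ c₀)) (pos-^ n′ q))) ⟩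
          + c₀ * (+ n′) ^ q + P           ≈⟨ +-cong-≈
            (*-congˡ-≈ (+ c₀) {(+ n′) ^ q} {1ℤ}
            (subst (λ k → (+ n′) ^ k ≈ 1ℤ [ P ]) (ℕ.*-identityˡ q) (unit-^ 1 {+ n′} p∤n′)))
            (by 1ℤ (lemma P)) ⟩
          + c₀ * 1ℤ + 0ℤ                  ≡⟨ trans (+-identityʳ (+ c₀ * 1ℤ)) (*-identityʳ (+ c₀)) ⟩
          + c₀                            ∎
          where
          open ≈-Reasoning P
          lemma : ∀ P → P ≡ 0ℤ + 1ℤ * P
          lemma = solve-∀
        p∤c : ¬ p ℕ.∣ c
        p∤c p∣c = p∤c₀ (≈0⇒∣ {p} {+ c₀} (≈-trans (≈-sym c≈c₀) (∣⇒≈0 {p} {+ c} p∣c)))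
        n′⊥c : Coprime n′ c
        n′⊥c {i} (i∣n′ , i∣c) with prime⇒irreducible p-prime (ℕ.∣m+n∣m⇒∣n i∣c (ℕ.∣n⇒∣m*n c₀ (i∣n′^ q refl)))
          where
          i∣n′^ : ∀ j → q ≡ j → i ℕ.∣ n′ ℕ.^ j
          i∣n′^ zero    q≡0 = contradiction (subst (λ q → Prime (suc q)) q≡0 p-prime) ¬prime[1]
          i∣n′^ (suc j) _   = ℕ.∣m⇒∣m*n (n′ ℕ.^ j) i∣n′
        ... | inj₁ i≡1 = i≡1
        ... | inj₂ refl = contradiction i∣n′ p∤n′
        inv = invertible {n} {c} (coprime-* {p ℕ.^ suc e} {n′} (coprime-^ p-prime (suc e) p∤c) n′⊥c)

      -- Kummer's congruence in disguise: p-divisibility of S k n / (k n)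
      -- depends only on k modulo p - 1.
      reduce-exponent : ∀ s l k′ r′ b → suc k′ ≡ p ℕ.^ s ℕ.* l → ¬ p ℕ.∣ l →
        k′ ≡ suc r′ ℕ.+ b ℕ.* q → suc (suc (suc r′)) ℕ.< p →
        S (suc k′) n ≈ 0ℤ [ P ^ (2 ℕ.+ (s ℕ.+ e)) ] → S (suc (suc r′)) n ≈ 0ℤ [ P ^ (2 ℕ.+ e) ]
      reduce-exponent s l k′ r′ b k≡ p∤l k′≡ r<p S≈0 =
        cancel p-prime (2 ℕ.+ e) {c ^ r - 1ℤ} {S r n} c^r≢1 (begin
          (c ^ r - 1ℤ) * S r n                                 ≡⟨ lemma₁ (c ^ r) (S r n) ⟩
          c ^ r * S r n - S r n                                ≈⟨ +-congʳ-≈ (- S r n) v₂ ⟩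
          S r n + + n * (+ r * Φ {n} c (suc r′)) - S r n
            ≡⟨ lemma₂ (S r n) (+ n * (+ r * Φ {n} c (suc r′))) ⟩
          + n * (+ r * Φ {n} c (suc r′))
            ≡⟨ cong₂ (λ a b → a * (+ r * b))
            (trans (pos-* (p ℕ.^ suc e) n′) (cong (_* + n′) (pos-^ p (suc e))))
            (trans (_≈_[_].equality Φr≈0) (+-identityˡ (z * P))) ⟩
          P ^ suc e * + n′ * (+ r * (z * P))
            ≈⟨ by (+ n′ * + r * z) (lemma₃ P (P ^ suc e) (+ n′) (+ r) z) ⟩
          0ℤ                                                   ∎)
        where
        -- The multiplier is chosen so that `c ^ r - 1` is prime to `p` and can be cancelled in the
        -- final congruence.
        non-root-r = non-root (suc r′) r<p
        c₀ = proj₁ non-root-r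
        0<c₀ = proj₁ (proj₂ non-root-r)
        c₀<p = proj₁ (proj₂ (proj₂ non-root-r))
        c₀^r≢1 = proj₂ (proj₂ (proj₂ non-root-r))
        unit-c₀ = unit c₀ (λ p∣c₀ → ℕ.<⇒≱ c₀<p (ℕ.∣⇒≤ {{ℕ.>-nonZero 0<c₀}} p∣c₀))
        c = proj₁ unit-c₀
        d = proj₁ (proj₂ unit-c₀)
        cd≈1 = proj₁ (proj₂ (proj₂ unit-c₀))
        c≈c₀ = proj₂ (proj₂ (proj₂ unit-c₀))
        open ≈-Reasoning (P ^ (2 ℕ.+ e))
        r = suc (suc r′)
        k = suc k′
        W = P ^ (2 ℕ.+ (s ℕ.+ e))
        lemma₁ : ∀ a s → (a - 1ℤ) * s ≡ a * s - s
        lemma₁ = solve-∀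
        lemma₂ : ∀ a b → a + b - a ≡ b
        lemma₂ = solve-∀
        lemma₃ : ∀ P a n r z → a * n * (r * (z * P)) ≡ 0ℤ + n * r * z * (P * a)
        lemma₃ = solve-∀
        lemma₄ : ∀ a n s l f → a * n * (s * l * f) ≡ a * s * (n * l * f)
        lemma₄ = solve-∀

        v₁ : c ^ k * S k n ≈ S k n + + n * (+ k * Φ {n} c k′) [ W ]
        v₁ = voronoi {n} {k = k′} {c = c} {d = d} cd≈1 (subst (λ k → Linear n k W) (sym k≡) (linear s l))

        knΦ≈0 : + n * (+ k * Φ {n} c k′) ≈ 0ℤ [ W ]
        knΦ≈0 = ≈-trans (≈-reflexive (sym (+-identityˡ (+ n * (+ k * Φ {n} c k′)))))
          (≈-trans (+-congʳ-≈ (+ n * (+ k * Φ {n} c k′)) (≈-sym S≈0))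
            (≈-trans (≈-sym v₁) (≈-trans (*-congˡ-≈ (c ^ k) S≈0) (≈-reflexive (*-zeroʳ (c ^ k))))))

        factor : + n * (+ k * Φ {n} c k′) ≡ + (p ℕ.^ (suc e ℕ.+ s)) * (+ n′ * + l * Φ {n} c k′)
        factor = trans (cong₂ (λ a b → a * (b * Φ {n} c k′)) (pos-* (p ℕ.^ suc e) n′)
          (trans (cong (λ z → + z) k≡) (pos-* (p ℕ.^ s) l)))
          (trans (lemma₄ (+ (p ℕ.^ suc e)) (+ n′) (+ (p ℕ.^ s)) (+ l) (Φ {n} c k′))
            (cong (_* (+ n′ * + l * Φ {n} c k′))
              (trans (sym (pos-* (p ℕ.^ suc e) (p ℕ.^ s)))
              (cong (λ z → + z) (sym (ℕ.^-distribˡ-+-* p (suc e) s))))))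

        W≡ : W ≡ + (p ℕ.^ (suc e ℕ.+ s)) * P
        W≡ = trans (*-comm P (P ^ suc (s ℕ.+ e)))
          (cong (_* P) (trans (cong (λ i → P ^ suc i) (ℕ.+-comm s e)) (sym (pos-^ p (suc e ℕ.+ s)))))

        -- The product `n k` has `p`-part exactly `p ^ (suc e + s)`, so one factor `p` of the
        -- modulus survives the cancellation.
        Φk≈0 : Φ {n} c k′ ≈ 0ℤ [ P ]
        Φk≈0 = cancel₁ {+ l} {Φ {n} c k′} p∤l (cancel₁ {+ n′} {+ l * Φ {n} c k′} p∤n′
          (subst (λ x → x ≈ 0ℤ [ P ]) (*-assoc (+ n′) (+ l) (Φ {n} c k′))
            (cancel-modulus (p ℕ.^ (suc e ℕ.+ s)) {{ℕ.m^n≢0 p (suc e ℕ.+ s)}}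
              {+ n′ * + l * Φ {n} c k′} {P} (subst₂ (λ x M → x ≈ 0ℤ [ M ]) factor W≡ knΦ≈0))))

        -- The exponents `r - 1` and `k - 1` are both positive and agree modulo `p - 1`; positivity
        -- of the first is the reason for `r = suc (suc r′)`.
        Φr≈0 : Φ {n} c (suc r′) ≈ 0ℤ [ P ]
        Φr≈0 = ≈-trans (sum-cong-≈ n {λ j → (c * + j) /ℕ n * (+ ((c * + j) %ℕ n)) ^ suc r′}
          {λ j → (c * + j) /ℕ n * (+ ((c * + j) %ℕ n)) ^ k′}
          (λ j _ → *-congˡ-≈ ((c * + j) /ℕ n) (same (+ ((c * + j) %ℕ n))))) Φk≈0
          where
          same : ∀ x → x ^ suc r′ ≈ x ^ k′ [ P ]
          same x = subst (λ k → x ^ suc r′ ≈ x ^ k [ P ]) (sym k′≡) (≈-sym (^-period p-prime refl r′ b x))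
        z = _≈_[_].quotient Φr≈0

        v₂ : c ^ r * S r n ≈ S r n + + n * (+ r * Φ {n} c (suc r′)) [ P ^ (2 ℕ.+ e) ]
        v₂ = voronoi {n} {k = suc r′} {c = c} {d = d} cd≈1
          (subst (λ k → Linear n k (P ^ (2 ℕ.+ e))) (ℕ.*-identityˡ r) (linear 0 r))

        c^r≢1 : ¬ p ℕ.∣ ∣ c ^ r - 1ℤ ∣
        c^r≢1 p∣ = c₀^r≢1 (≈0⇒∣ {p} {(+ c₀) ^ r - 1ℤ}
          (≈-trans (+-congʳ-≈ (- 1ℤ) (^-cong-≈ r (≈-sym c≈c₀))) (∣⇒≈0 {p} {c ^ r - 1ℤ} p∣)))

      -- S i n / n and S i p / p satisfy the same recurrence modulo p.
      S-n⇒S-p : ∀ r → suc r ℕ.< p → S r n ≈ 0ℤ [ P ^ (2 ℕ.+ e) ] → S r p ≈ 0ℤ [ P ^ 2 ]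
      S-n⇒S-p r r<p Sn≈0 = cancel p-prime 2 {+ n′} {S r p} p∤n′
        (cancel-modulus (p ℕ.^ suc e) {{ℕ.m^n≢0 p (suc e)}} {+ n′ * S r p} {P ^ 2}
          (subst₂ (λ x M → x ≈ 0ℤ [ M ]) factor modulus Sp*n≈0))
        where
        W = P ^ (3 ℕ.+ e)
        -- The difference of `S i n / n` and `S i p / p`, cleared of denominators. Its recurrence
        -- has right-hand side `p n ^ (r + 1) - n p ^ (r + 1)`, which is 0 for `r = 0` and divisible
        -- by `p ^ (3 + e)` afterwards.
        D : ℕ → ℤ
        D i = P * S i n + - + n * S i p
        n≡ : + n ≡ P ^ suc e * + n′
        n≡ = trans (pos-* (p ℕ.^ suc e) n′) (cong (_* + n′) (pos-^ p (suc e)))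
        sums : ∀ r → sum (suc r) (λ i → + (suc r C i) * D i) ≡ P * (+ n) ^ suc r + - + n * P ^ suc r
        sums r = begin
          sum (suc r) (λ i → + (suc r C i) * D i)
            ≡⟨ sum-cong (suc r) (λ i _ → lemma (+ (suc r C i)) P (S i n) (- + n) (S i p)) ⟩
          sum (suc r) (λ i → P * (+ (suc r C i) * S i n) + - + n * (+ (suc r C i) * S i p))
            ≡⟨ sum-+ (suc r) (λ i → P * (+ (suc r C i) * S i n)) (λ i → - + n * (+ (suc r C i) * S i p)) ⟩
          sum (suc r) (λ i → P * (+ (suc r C i) * S i n)) + sum (suc r)
            (λ i → - + n * (+ (suc r C i) * S i p))
            ≡⟨ cong₂ _+_ (trans (sum-*ˡ (suc r) P (λ i → + (suc r C i) * S i n))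
              (cong (_*_ P) (power-sum-recurrence r n)))
                         (trans (sum-*ˡ (suc r) (- + n) (λ i → + (suc r C i) * S i p))
                           (cong (_*_ (- + n)) (power-sum-recurrence r p))) ⟩
          P * (+ n) ^ suc r + - + n * P ^ suc r ∎
          where
          open ≡-Reasoning
          lemma : ∀ c P a n b → c * (P * a + n * b) ≡ P * (c * a) + n * (c * b)
          lemma = solve-∀
        recurrence : ∀ r → suc r ℕ.< p → sum (suc r) (λ i → + (suc r C i) * D i) ≈ 0ℤ [ W ]
        recurrence zero    _ = ≈-reflexive (trans (sums 0) (lemma P (+ n)))
          where
          lemma : ∀ P n → P * (n * 1ℤ) + - n * (P * 1ℤ) ≡ 0ℤ
          lemma = solve-∀
        recurrence (suc r) _ = ≈-trans
          (≈-reflexive (trans (sums (suc r))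
          (cong (λ z → P * (z * (z * (+ n) ^ r)) + - z * P ^ suc (suc r)) n≡)))
          (by (P ^ e * + n′ * + n′ * (+ n) ^ r - + n′ * P ^ r) (lemma P (P ^ e) (+ n′) ((+ n) ^ r) (P ^ r)))
          where
          lemma : ∀ P a n′ b c → P * (P * a * n′ * (P * a * n′ * b)) + - (P * a * n′) * (P * (P * c))
            ≡ 0ℤ + (a * n′ * n′ * b - n′ * c) * (P * (P * (P * a)))
          lemma = solve-∀
        Sp*n≈0 : + n * S r p ≈ 0ℤ [ W ]
        Sp*n≈0 = begin
          + n * S r p                       ≡⟨ lemma (P * S r n) (+ n) (S r p) ⟩
          P * S r n + - 1ℤ * D r            ≈⟨ +-cong-≈ (scale-modulus P Sn≈0)
            (*-congˡ-≈ (- 1ℤ) {D r} {0ℤ} (recurrence-vanishes p-prime (3 ℕ.+ e) D recurrence r r<p)) ⟩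
          P * 0ℤ + - 1ℤ * 0ℤ                ≡⟨ cong (_+ - 1ℤ * 0ℤ) (*-zeroʳ P) ⟩
          0ℤ                                ∎
          where
          open ≈-Reasoning W
          lemma : ∀ a n s → n * s ≡ a + - 1ℤ * (a + - n * s)
          lemma = solve-∀
        factor : + n * S r p ≡ + (p ℕ.^ suc e) * (+ n′ * S r p)
        factor = trans (cong (_* S r p) (pos-* (p ℕ.^ suc e) n′)) (*-assoc (+ (p ℕ.^ suc e)) (+ n′) (S r p))
        modulus : W ≡ + (p ℕ.^ suc e) * P ^ 2
        modulus = trans (lemma P (P ^ e)) (cong (_* P ^ 2) (sym (pos-^ p (suc e))))
          where
          lemma : ∀ P a → P * (P * (P * a)) ≡ P * a * (P * (P * 1ℤ))
          lemma = solve-∀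

-- From a solution to an irregular pair

module Irregularity where

  open import Defs using (T)
  open Congruence
  open Linearization using (module OddPrime)
  open PowerSums
  open PrimeModulus
  open Kummer
  open import Data.Nat as ℕ using (ℕ; zero; suc; z≤n; s≤s; NonZero; >-nonZero; >-nonZero⁻¹; nonTrivial⇒n>1; _+_; _*_; _^_; _≤_; _<_; _%_; _/_)
  open import Data.Nat.Properties
  open import Data.Nat.Divisibility
  open import Data.Nat.DivMod
  open import Data.Nat.Induction using (<-rec)
  open import Data.Nat.Coprimality as Coprimality using (coprime-divisor)
  open import Data.Nat.Primality
  open import Data.Nat.Tactic.RingSolver using (solve-∀)
  import Data.Integer as ℤ
  open import Data.Product using (∃; ∃₂; _×_; _,_; proj₁; proj₂)
  open import Data.Sum using (inj₁; inj₂)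
  open import Relation.Nullary
  open import Relation.Binary.PropositionalEquality
  import Data.Integer.Properties as ℤ

  factor-out : ∀ {p} → 1 < p → ∀ n → .{{NonZero n}} → ∃₂ λ e n′ → n ≡ p ^ e * n′ × ¬ p ∣ n′
  factor-out {p} 1<p = <-rec _ step
    where
    instance
      p≢0 : NonZero p
      p≢0 = >-nonZero (<-trans (s≤s z≤n) 1<p)
    step : ∀ n → (∀ {m} → m < n → .{{NonZero m}} → ∃₂ λ e m′ → m ≡ p ^ e * m′ × ¬ p ∣ m′) →
      .{{NonZero n}} → ∃₂ λ e n′ → n ≡ p ^ e * n′ × ¬ p ∣ n′
    step n rec with p ∣? n
    ... | no p∤n = 0 , n , sym (*-identityˡ n) , p∤n
    ... | yes (divides m refl) with rec (m<m*n m p {{m≢0}} 1<p) {{m≢0}}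
      where
      m≢0 : NonZero m
      m≢0 = m*n≢0⇒m≢0 m
    ...   | e , m′ , m≡ , p∤m′ = suc e , m′ ,
      trans (*-comm m p) (trans (cong (p *_) m≡) (sym (*-assoc p (p ^ e) m′))) , p∤m′

  1+2n≤3^n : ∀ n → 1 + 2 * n ≤ 3 ^ n
  1+2n≤3^n zero    = ≤-refl
  1+2n≤3^n (suc n) = begin
    1 + 2 * suc n        ≤⟨ m≤m+n _ (4 * n) ⟩
    1 + 2 * suc n + 4 * n ≡⟨ lemma n ⟩
    3 * (1 + 2 * n)      ≤⟨ *-monoʳ-≤ 3 (1+2n≤3^n n) ⟩
    3 * 3 ^ n            ∎
    where
    open ≤-Reasoning
    lemma : ∀ n → 1 + 2 * suc n + 4 * n ≡ 3 * (1 + 2 * n)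
    lemma = solve-∀

  ^-distribʳ : ∀ k x y → (x * y) ^ k ≡ x ^ k * y ^ k
  ^-distribʳ zero    x y = refl
  ^-distribʳ (suc k) x y rewrite ^-distribʳ k x y = lemma x y (x ^ k) (y ^ k)
    where
    lemma : ∀ x y u v → x * y * (u * v) ≡ x * u * (y * v)
    lemma = solve-∀

  module Solution {a m k} (1<m : 1 < m) (solution : a * T k m ≡ (2 * m + 1) ^ k) where

    private
      n : ℕ
      n = 2 * m + 1

    -- The last summand (2 m - 1) ^ k of T k m alone bounds a by (5 / 3) ^ k.
    a*3^k≤5^k : a * 3 ^ k ≤ 5 ^ k
    a*3^k≤5^k = go m 1<m solution
      where
      go : ∀ m → 1 < m → a * T k m ≡ (2 * m + 1) ^ k → a * 3 ^ k ≤ 5 ^ k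
      go (suc zero) (s≤s ()) _
      go (suc (suc m)) _ eq = *-cancelʳ-≤ (a * 3 ^ k) (5 ^ k) (y ^ k) {{m^n≢0 y k {{y≢0}}}} (begin
        a * 3 ^ k * y ^ k                  ≡⟨ lemma₁ a (3 ^ k) (y ^ k) ⟩
        3 ^ k * (a * y ^ k)                ≤⟨ *-monoʳ-≤ (3 ^ k)
          (*-monoʳ-≤ a (m≤n+m (y ^ k) (T k (suc m)))) ⟩
        3 ^ k * (a * T k (suc (suc m)))    ≡⟨ cong (3 ^ k *_) eq ⟩
        3 ^ k * (2 * suc (suc m) + 1) ^ k  ≡⟨ ^-distribʳ k 3 (2 * suc (suc m) + 1) ⟨
        (3 * (2 * suc (suc m) + 1)) ^ k
          ≤⟨ ^-monoˡ-≤ k (≤-trans (m≤m+n _ (4 * m)) (≤-reflexive (lemma₂ m))) ⟩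
        (5 * y) ^ k                        ≡⟨ ^-distribʳ k 5 y ⟩
        5 ^ k * y ^ k                      ∎)
        where
        open ≤-Reasoning
        y = 2 * suc m + 1
        y≢0 : NonZero y
        y≢0 = >-nonZero (≤-trans (s≤s z≤n) (m≤n+m 1 (2 * suc m)))
        lemma₁ : ∀ a x y → a * x * y ≡ x * (a * y)
        lemma₁ = solve-∀
        lemma₂ : ∀ m → 3 * (2 * suc (suc m) + 1) + 4 * m ≡ 5 * (2 * suc m + 1)
        lemma₂ = solve-∀

    module _ {h} (k≡ : k ≡ 2 * suc h) (1≤a : 1 ≤ a) {p} (p-prime : Prime p) (3≤p : 3 ≤ p) where

      private
        K = suc h
        instance
          p≢0 : NonZero p
          p≢0 = prime⇒nonZero p-prime
          a≢0 : NonZero a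
          a≢0 = >-nonZero 1≤a
          k≢0 : NonZero k
          k≢0 = subst NonZero (sym k≡) _

      -- From `3 ^ f ≤ p ^ f ≤ a ≤ (25 / 9) ^ K` and `25 / 9 < 3`; with denominators cleared,
      -- `K ≤ f` would give `27 ^ K ≤ 25 ^ K`.
      valuation-a : ∀ {f a′} → a ≡ p ^ f * a′ → f < K
      valuation-a {f} {a′} a≡ = ≰⇒> λ K≤f → <⇒≱ (^-monoˡ-< K (m≤n⇒m≤o+n 1 (≤-refl {26}))) (begin
        27 ^ K              ≡⟨ ^-*-assoc 3 3 K ⟩
        3 ^ (3 * K)         ≡⟨ cong (3 ^_) (lemma K) ⟩
        3 ^ (K + 2 * K)     ≡⟨ ^-distribˡ-+-* 3 K (2 * K) ⟩
        3 ^ K * 3 ^ (2 * K) ≤⟨ *-monoˡ-≤ (3 ^ (2 * K)) (begin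
          3 ^ K               ≤⟨ ^-monoʳ-≤ 3 K≤f ⟩
          3 ^ f               ≤⟨ ^-monoˡ-≤ f 3≤p ⟩
          p ^ f               ≤⟨ ∣⇒≤ (divides a′ (trans a≡ (*-comm (p ^ f) a′))) ⟩
          a                   ∎) ⟩
        a * 3 ^ (2 * K)     ≡⟨ cong (λ k → a * 3 ^ k) k≡ ⟨
        a * 3 ^ k           ≤⟨ a*3^k≤5^k ⟩
        5 ^ k               ≡⟨ cong (5 ^_) k≡ ⟩
        5 ^ (2 * K)         ≡⟨ ^-*-assoc 5 2 K ⟨
        25 ^ K              ∎)
        where
        open ≤-Reasoning
        lemma : ∀ K → 3 * K ≡ K + 2 * K
        lemma = solve-∀

      -- From `3 ^ s ≤ p ^ s ≤ k = 2 K < 3 ^ K`.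
      valuation-k : ∀ {s l} → k ≡ p ^ s * l → s < K
      valuation-k {s} {l} k≡′ = ≰⇒> λ K≤s → <⇒≱ (1+2n≤3^n K) (begin
        3 ^ K       ≤⟨ ^-monoʳ-≤ 3 K≤s ⟩
        3 ^ s       ≤⟨ ^-monoˡ-≤ s 3≤p ⟩
        p ^ s       ≤⟨ ∣⇒≤ (divides l (trans k≡′ (*-comm (p ^ s) l))) ⟩
        k           ≡⟨ k≡ ⟩
        2 * K       ∎)
        where open ≤-Reasoning

      -- The two strict bounds add up to `suc f + suc s ≤ 2 K = k`, so `n ^ k`, divisible by
      -- `p ^ (suc e * k)`, can spare the `p ^ f` belonging to `a`.
      T-divisible : ∀ {e n′ s l} → n ≡ p ^ suc e * n′ → k ≡ p ^ s * l → p ^ (2 + (s + e)) ∣ T k m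
      T-divisible {e} {n′} {s} {l} n≡ k≡′ with factor-out (nonTrivial⇒n>1 p {{prime⇒nonTrivial p-prime}}) a
      ... | f , a′ , a≡ , p∤a′ = coprime-divisor (coprime-^ p-prime (2 + (s + e)) p∤a′)
        (*-cancelˡ-∣ (p ^ f) {{m^n≢0 p f}} (begin
          p ^ f * p ^ (2 + (s + e))     ≡⟨ ^-distribˡ-+-* p f (2 + (s + e)) ⟨
          p ^ (f + (2 + (s + e)))       ∣⟨ ^-∣ bound ⟩
          p ^ (suc e * k)               ≡⟨ ^-*-assoc p (suc e) k ⟨
          (p ^ suc e) ^ k               ∣⟨ m∣m*n (n′ ^ k) ⟩
          (p ^ suc e) ^ k * n′ ^ k      ≡⟨ ^-distribʳ k (p ^ suc e) n′ ⟨
          (p ^ suc e * n′) ^ k          ≡⟨ cong (_^ k) n≡ ⟨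
          n ^ k                         ≡⟨ solution ⟨
          a * T k m                     ≡⟨ cong (_* T k m) a≡ ⟩
          p ^ f * a′ * T k m            ≡⟨ *-assoc (p ^ f) a′ (T k m) ⟩
          p ^ f * (a′ * T k m)          ∎))
        where
        open ∣-Reasoning
        ^-∣ : ∀ {i j} → i ≤ j → p ^ i ∣ p ^ j
        ^-∣ {i} {j} i≤j = subst (λ j → p ^ i ∣ p ^ j) (m+[n∸m]≡n i≤j)
          (subst (p ^ i ∣_) (sym (^-distribˡ-+-* p i (j ℕ.∸ i))) (m∣m*n (p ^ (j ℕ.∸ i))))
        lemma₁ : ∀ f s e → f + (2 + (s + e)) ≡ suc f + suc s + e
        lemma₁ = solve-∀
        lemma₂ : ∀ K → K + K ≡ 2 * K
        lemma₂ = solve-∀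
        bound : f + (2 + (s + e)) ≤ suc e * k
        bound = ≤-trans (≤-reflexive (lemma₁ f s e)) (+-mono-≤
          (≤-trans (+-mono-≤ (valuation-a a≡) (valuation-k {s} {l} k≡′))
            (≤-reflexive (trans (lemma₂ K) (sym k≡))))
          (m≤m*n e k))

  ∤-^ : ∀ {p} → Prime p → ∀ j {x} → ¬ p ∣ x → ¬ p ∣ x ^ j
  ∤-^ p-prime zero    p∤x p∣1 = ¬prime[1] (subst Prime (∣1⇒≡1 p∣1) p-prime)
  ∤-^ p-prime (suc j) {x} p∤x p∣x^ with euclidsLemma x (x ^ j) p-prime p∣x^
  ... | inj₁ p∣x  = p∤x p∣x
  ... | inj₂ p∣x^ = ∤-^ p-prime j p∤x p∣x^

  even-% : ∀ {q} .{{_ : NonZero q}} k → 2 ∣ q → 2 ∣ k → 2 ∣ k % q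
  even-% {q} k 2∣q 2∣k = %-presˡ-∣ 2∣k 2∣q

  odd⇒2∣pred : ∀ {q} → ¬ 2 ∣ suc q → 2 ∣ q
  odd⇒2∣pred {q} 2∤1+q with q % 2 in q%2 | m%n<n q 2
  ... | 0 | _ = m%n≡0⇒n∣m q 2 q%2
  ... | 1 | _ = contradiction (divides (suc (q / 2))
      (cong suc (trans (m≡m%n+[m/n]*n q 2) (cong (_+ q / 2 * 2) q%2)))) 2∤1+q
  ... | suc (suc _) | s≤s (s≤s ())

  -- As `n` contains exactly `p ^ suc e`, the modulus asks for one factor more: the quotient of
  -- `S r n` by `n` is 0 modulo `p`. In this form irregularity is handed on both to Bernoulli
  -- numbers and to computation.
  record Vanishes (n p r : ℕ) : Set where
    constructor vanishes
    field
      {e n′}  : ℕ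
      n≡      : n ≡ p ^ suc e * n′
      p∤n′    : ¬ p ∣ n′
      vanish  : S r n ≈ ℤ.0ℤ [ (ℤ.+ p) ℤ.^ (2 + e) ]

  module _ {a m h : ℕ} (1≤a : 1 ≤ a) (1<m : 1 < m) (solution : a * T (2 * suc h) m ≡ (2 * m + 1) ^ (2 * suc h))
           {q : ℕ} .{{_ : NonZero q}} (p-prime : Prime (suc q)) (p-odd : ¬ 2 ∣ suc q)
           {e n′ : ℕ} (n≡ : 2 * m + 1 ≡ suc q ^ suc e * n′) (p∤n′ : ¬ suc q ∣ n′)
           {s l : ℕ} (k≡ : 2 * suc h ≡ suc q ^ s * l) (p∤l : ¬ suc q ∣ l) where

    private
      k = 2 * suc h
      p = suc q
      P = ℤ.+ p
      n = 2 * m + 1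
      W = P ℤ.^ (2 + (s + e))
      open OddPrime p-prime p-odd using (p∤2)

      3≤p : 3 ≤ p
      3≤p = ≤∧≢⇒< (nonTrivial⇒n>1 p {{prime⇒nonTrivial p-prime}}) (λ 2≡p → p-odd (subst (2 ∣_) 2≡p ∣-refl))

      T≈0 : ℤ.+ T k m ≈ ℤ.0ℤ [ W ]
      T≈0 = subst (λ N → ℤ.+ T k m ≈ ℤ.0ℤ [ N ]) (pos-^ p (2 + (s + e)))
        (∣⇒≈0 {p ^ (2 + (s + e))} {ℤ.+ T k m}
        (Solution.T-divisible {a} {m} {k} 1<m solution {h} refl 1≤a p-prime 3≤p {e} {n′} {s} {l} n≡ k≡))

      lin : Linear n k W
      lin = subst₂ (λ n k → Linear n k W) (sym n≡) (sym k≡) (linear p-prime p-odd e n′ p∤n′ s l)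

      S≈0 : S k n ≈ ℤ.0ℤ [ W ]
      S≈0 = cancel p-prime (2 + (s + e)) {(ℤ.+ 2) ℤ.^ ℕ.pred k} {S k n}
        (subst (λ x → ¬ p ∣ ℤ.∣ x ∣) (pos-^ 2 (ℕ.pred k)) (∤-^ p-prime (ℕ.pred k) p∤2))
        (≈-trans (≈-sym (T≈2^*S {h} {m} {W} lin)) T≈0)

      S≈0′ : S k (p ^ suc e * n′) ≈ ℤ.0ℤ [ W ]
      S≈0′ = subst (λ n → S k n ≈ ℤ.0ℤ [ W ]) n≡ S≈0

      even-r : 2 ∣ k % q
      even-r = even-% k (odd⇒2∣pred p-odd) (m∣m*n (suc h))

      h≡ : ∃ λ h′ → k % q ≡ 2 * suc h′
      h≡ with even-r
      ... | divides (suc h′) eq = h′ , trans eq (*-comm (suc h′) 2)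
      ... | divides zero eq with k / q in k/q
      ...   | zero = contradiction (trans (m≡m%n+[m/n]*n k q) (cong₂ (λ a b → a + b * q) eq k/q)) λ ()
      ...   | suc b = contradiction
          (weaken-≈ (P ℤ.^ suc s) (P ℤ.^ suc e) (subst (λ N → S k (p ^ suc e * n′) ≈ ℤ.0ℤ [ N ]) W≡ S≈0′))
          (∤-multiple p-prime p-odd e n′ p∤n′ b
            (trans (m≡m%n+[m/n]*n k q) (cong₂ (λ a b → a + b * q) eq k/q)))
        where
        W≡ : W ≡ P ℤ.^ suc s ℤ.* P ℤ.^ suc e
        W≡ = trans (cong (P ℤ.^_) (cong suc (sym (+-suc s e)))) (ℤ.^-distribˡ-+-* P (suc s) (suc e))

      h′ : ℕ
      h′ = proj₁ h≡
      k%q≡ = proj₂ h≡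

      r<q : 2 * suc h′ < q
      r<q = subst (_< q) k%q≡ (m%n<n k q)

      Sr≈0 : S (2 * suc h′) (p ^ suc e * n′) ≈ ℤ.0ℤ [ P ℤ.^ (2 + e) ]
      Sr≈0 = subst (λ r → S r (p ^ suc e * n′) ≈ ℤ.0ℤ [ P ℤ.^ (2 + e) ]) r≡
        (reduce-exponent p-prime p-odd e n′ p∤n′ s l (ℕ.pred k) (2 * h′) (k / q) k≡ p∤l k′≡
          (s≤s (subst (_< q) (sym r≡) r<q)) S≈0′)
        where
        r≡ : suc (suc (2 * h′)) ≡ 2 * suc h′
        r≡ = sym (*-suc 2 h′)
        k′≡ : ℕ.pred k ≡ suc (2 * h′) + k / q * q
        k′≡ = suc-injective (trans (m≡m%n+[m/n]*n k q) (cong (_+ k / q * q) (trans k%q≡ (sym r≡))))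

    irregularity′ : ∃ λ h′ → (2 * suc h) % q ≡ 2 * suc h′ × 2 * suc h′ < q × Vanishes (2 * m + 1)
      (suc q) (2 * suc h′)
    irregularity′ = h′ , k%q≡ , r<q ,
      vanishes {e = e} {n′ = n′} n≡ p∤n′
      (subst (λ n → S (2 * suc h′) n ≈ ℤ.0ℤ [ P ℤ.^ (2 + e) ]) (sym n≡) Sr≈0)

  -- Applied to prime divisors of `a`, and also to a sieving prime that happens to divide `n`.
  irregularity : ∀ {a m h} (let k = 2 * suc h ; n = 2 * m + 1) →
    1 ≤ a → 1 < m → a * T k m ≡ n ^ k →
    ∀ {q} .{{_ : NonZero q}} → Prime (suc q) → ¬ 2 ∣ suc q → suc q ∣ n →
    ∃ λ h′ → k % q ≡ 2 * suc h′ × 2 * suc h′ < q × Vanishes n (suc q) (2 * suc h′)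
  irregularity {a} {m} {h} 1≤a 1<m solution {q} p-prime p-odd p∣n
    with factor-out (s≤s (>-nonZero⁻¹ q)) (2 * m + 1) {{>-nonZero (m≤n+m 1 (2 * m))}}
       | factor-out {suc q} (s≤s (>-nonZero⁻¹ q)) (2 * suc h)
  ... | zero  , n′ , n≡ , p∤n′ | _ = contradiction (subst (suc q ∣_) (trans n≡ (*-identityˡ n′)) p∣n) p∤n′
  ... | suc e , n′ , n≡ , p∤n′ | s , l , k≡ , p∤l =
    irregularity′ {a} {m} {h} 1≤a 1<m solution p-prime p-odd {e} {n′} n≡ p∤n′ {s} {l} k≡ p∤l

-- Bernoulli numbers modulo p

module Bernoulli where

  open import Defs using (B; U)
  open Congruence
  open PowerSums using (S; power-sum-recurrence)
  open PrimeModulus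
  open Irregularity using (Vanishes; vanishes)
  open import Data.Nat as ℕ using (ℕ; zero; suc; s≤s)
  import Data.Nat.Properties as ℕ
  import Data.Nat.Divisibility as ℕ
  open import Data.Nat.Combinatorics using (_C_; nC1≡n; nCk≡nC[n∸k])
  open import Data.Nat.Primality
  open import Data.Nat.Induction using (<-rec)
  open import Data.Integer as ℤ using (ℤ; +_; 0ℤ; 1ℤ)
  import Data.Integer.Properties as ℤ
  import Data.Integer.Tactic.RingSolver as ℤSolver
  open import Data.List using (List; []; _∷_; _++_; length)
  open import Data.List.Properties using (length-++)
  open import Data.Rational as ℚ using (ℚ; 0ℚ; 1ℚ; _/_; _+_; _*_; -_; toℚᵘ; ↥_; ↧_)
  open import Data.Rational.Properties
  open import Data.Rational.Unnormalised as ℚᵘ using (mkℚᵘ; *≡*)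
  import Data.Rational.Unnormalised.Properties as ℚᵘ
  open import Data.Sum using (inj₁; inj₂)
  open import Relation.Nullary
  open import Relation.Binary.PropositionalEquality

  -- The recursion behind B is private to Defs.  The following blocks let
  -- unification name its parts: each placeholder is determined by the equation
  -- after it, where the with-abstraction turns the argument into a variable.
  mutual
    last-snoc : ℕ → List ℚ → ℚ
    last-snoc = _

    last-snoc-spec : ∀ n → last-snoc n [] ≡ B n
    last-snoc-spec n with List.[] {A = ℚ}
    ... | w = refl

  mutual
    last : List ℚ → ℚ
    last = _

    last-spec : ∀ x xs → last (x ∷ xs) ≡ last-snoc 0 (x ∷ xs)
    last-spec x xs with x ∷ xs
    ... | ys = refl

  mutual
    prefix⁺ : ℕ → List ℚ
    prefix⁺ = _

    prefix⁺-spec : ∀ n → last (prefix⁺ n) ≡ B n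
    prefix⁺-spec n with last
    ... | l = refl

  mutual
    prefix : ℕ → List ℚ
    prefix = _

    b : ℕ → ℚ
    b = _

    prefix-spec : ∀ n → prefix n ++ (b n ∷ []) ≡ prefix⁺ n
    prefix-spec n with _++_ {A = ℚ}
    ... | app = refl

  mutual
    next : ℕ → List ℚ → ℚ
    next = _

    next-spec : ∀ n → next n (prefix (suc n)) ≡ b (suc n)
    next-spec n with prefix (suc n)
    ... | bs = refl

  mutual
    weighted : ℕ → List ℚ → ℚ
    weighted = _

    weighted-spec : ∀ n bs → - ((+ 1 / suc (suc n)) * weighted n bs) ≡ next n bs
    weighted-spec n bs with _*_ | -_
    ... | m | ne = refl

  mutual
    weighted₁ : ℕ → List ℚ → List ℚ → ℚ
    weighted₁ = _

    head₁ : ℕ → ℚ → ℚ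
    head₁ = _

    weighted₁-spec : ∀ n x xs → head₁ n x + weighted₁ n (x ∷ xs) xs ≡ weighted n (x ∷ xs)
    weighted₁-spec n x xs with _+_ | x ∷ xs
    ... | p | w = refl

  mutual
    go : ℕ → List ℚ → ℕ → List ℚ → ℚ
    go = _

    head₂ : ℕ → ℕ → ℚ → ℚ
    head₂ = _

    go-spec : ∀ n ys x xs → head₂ n 2 x + go n ys 2 xs ≡ weighted₁ n ys (x ∷ xs)
    go-spec n ys x xs with _+_ | 2
    ... | p | two = refl

  ι : ℤ → ℚ
  ι z = z / 1

  last-++ : ∀ xs x → last (xs ++ (x ∷ [])) ≡ x
  last-++ []           x = refl
  last-++ (_ ∷ [])     x = refl
  last-++ (_ ∷ y ∷ ys) x = last-++ (y ∷ ys) x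

  B≡b : ∀ n → B n ≡ b n
  B≡b n = last-++ (prefix n) (b n)

  length-prefix : ∀ n → length (prefix n) ≡ n
  length-prefix zero    = refl
  length-prefix (suc n) = trans (length-++ (prefix n))
    (trans (ℕ.+-comm (length (prefix n)) 1) (cong suc (length-prefix n)))

  sumℚ : ℕ → (ℕ → ℚ) → ℚ
  sumℚ zero    f = 0ℚ
  sumℚ (suc n) f = sumℚ n f + f n

  -- The list of Bernoulli numbers grows at its end, whereas `go` consumes it from the front; this
  -- reconciles the two.
  go-++ : ∀ n ys j xs x → go n ys j (xs ++ (x ∷ [])) ≡ go n ys j xs + ι
    (+ (suc (suc n) C (j ℕ.+ length xs))) * x
  go-++ n ys j [] x = trans (+-identityʳ (term j))
    (trans (cong term (sym (ℕ.+-identityʳ j))) (sym (+-identityˡ (term (j ℕ.+ 0)))))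
    where
    term : ℕ → ℚ
    term i = ι (+ (suc (suc n) C i)) * x
  go-++ n ys j (y ∷ xs) x = trans (cong (_+_ t) (go-++ n ys (suc j) xs x))
    (trans (sym (+-assoc t (go n ys (suc j) xs) (term (suc j ℕ.+ length xs))))
      (cong (λ i → t + go n ys (suc j) xs + term i) (sym (ℕ.+-suc j (length xs)))))
    where
    t : ℚ
    t = ι (+ (suc (suc n) C j)) * y
    term : ℕ → ℚ
    term i = ι (+ (suc (suc n) C i)) * x

  go-prefix : ∀ n ys m → go n ys 0 (prefix m) ≡ sumℚ m (λ i → ι (+ (suc (suc n) C i)) * B i)
  go-prefix n ys zero    = refl
  go-prefix n ys (suc m) = trans (go-++ n ys 0 (prefix m) (b m))
    (cong₂ _+_ (go-prefix n ys m)
      (cong₂ (λ i x → ι (+ (suc (suc n) C i)) * x) (length-prefix m) (sym (B≡b m))))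

  toℚᵘ-ι : ∀ z → toℚᵘ (ι z) ℚᵘ.≃ mkℚᵘ z 0
  toℚᵘ-ι z = toℚᵘ-fromℚᵘ (mkℚᵘ z 0)

  ι-+ : ∀ x y → ι (x ℤ.+ y) ≡ ι x + ι y
  ι-+ x y = toℚᵘ-injective (begin
    toℚᵘ (ι (x ℤ.+ y))          ≈⟨ toℚᵘ-ι (x ℤ.+ y) ⟩
    mkℚᵘ (x ℤ.+ y) 0            ≈⟨ *≡* (lemma x y) ⟩
    mkℚᵘ x 0 ℚᵘ.+ mkℚᵘ y 0      ≈⟨ ℚᵘ.+-cong (toℚᵘ-ι x) (toℚᵘ-ι y) ⟨
    toℚᵘ (ι x) ℚᵘ.+ toℚᵘ (ι y)  ≈⟨ toℚᵘ-homo-+ (ι x) (ι y) ⟨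
    toℚᵘ (ι x + ι y)            ∎)
    where
    open ℚᵘ.≃-Reasoning
    lemma : ∀ x y → (x ℤ.+ y) ℤ.* 1ℤ ≡ (x ℤ.* 1ℤ ℤ.+ y ℤ.* 1ℤ) ℤ.* 1ℤ
    lemma = ℤSolver.solve-∀

  ι-* : ∀ x y → ι (x ℤ.* y) ≡ ι x * ι y
  ι-* x y = toℚᵘ-injective (begin
    toℚᵘ (ι (x ℤ.* y))          ≈⟨ toℚᵘ-ι (x ℤ.* y) ⟩
    mkℚᵘ x 0 ℚᵘ.* mkℚᵘ y 0      ≈⟨ ℚᵘ.*-cong (toℚᵘ-ι x) (toℚᵘ-ι y) ⟨
    toℚᵘ (ι x) ℚᵘ.* toℚᵘ (ι y)  ≈⟨ toℚᵘ-homo-* (ι x) (ι y) ⟨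
    toℚᵘ (ι x * ι y)            ∎)
    where open ℚᵘ.≃-Reasoning

  ι-neg : ∀ x → ι (ℤ.- x) ≡ - ι x
  ι-neg x = toℚᵘ-injective (begin
    toℚᵘ (ι (ℤ.- x))            ≈⟨ toℚᵘ-ι (ℤ.- x) ⟩
    ℚᵘ.- mkℚᵘ x 0               ≈⟨ ℚᵘ.-‿cong (toℚᵘ-ι x) ⟨
    ℚᵘ.- toℚᵘ (ι x)             ≈⟨ toℚᵘ-homo‿- (ι x) ⟨
    toℚᵘ (- ι x)                ∎)
    where open ℚᵘ.≃-Reasoning

  ι-inverse : ∀ n → ι (+ suc n) * (+ 1 / suc n) ≡ 1ℚ
  ι-inverse n = toℚᵘ-injective (begin
    toℚᵘ (ι (+ suc n) * (+ 1 / suc n))              ≈⟨ toℚᵘ-homo-* (ι (+ suc n)) (+ 1 / suc n) ⟩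
    toℚᵘ (ι (+ suc n)) ℚᵘ.* toℚᵘ (+ 1 / suc n)
      ≈⟨ ℚᵘ.*-cong (toℚᵘ-ι (+ suc n)) (toℚᵘ-fromℚᵘ (mkℚᵘ (+ 1) n)) ⟩
    mkℚᵘ (+ suc n) 0 ℚᵘ.* mkℚᵘ (+ 1) n
      ≈⟨ *≡* (trans (lemma (+ suc n)) (cong (λ z → 1ℤ ℤ.* (+ suc z)) (sym (ℕ.+-identityʳ n)))) ⟩
    toℚᵘ 1ℚ                                         ∎)
    where
    open ℚᵘ.≃-Reasoning
    lemma : ∀ z → z ℤ.* 1ℤ ℤ.* 1ℤ ≡ 1ℤ ℤ.* z
    lemma = ℤSolver.solve-∀

  -- The way back from rationals to integers: equality of unnormalised fractions is cross
  -- multiplication.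
  ι-cross : ∀ a c x → ι a * x ≡ ι c → a ℤ.* ↥ x ≡ c ℤ.* ↧ x
  ι-cross a c x@(ℚ.mkℚ u v _) eq =
    ℚᵘ-cross (ℚᵘ.≃-trans (ℚᵘ.*-cong (ℚᵘ.≃-sym (toℚᵘ-ι a)) (ℚᵘ.≃-refl {mkℚᵘ u v}))
      (ℚᵘ.≃-trans (ℚᵘ.≃-sym (toℚᵘ-homo-* (ι a) x)) (ℚᵘ.≃-trans (toℚᵘ-cong eq) (toℚᵘ-ι c))))
    where
    ℚᵘ-cross : mkℚᵘ a 0 ℚᵘ.* mkℚᵘ u v ℚᵘ.≃ mkℚᵘ c 0 → a ℤ.* u ≡ c ℤ.* + suc v
    ℚᵘ-cross (*≡* e) = trans (sym (ℤ.*-identityʳ (a ℤ.* u)))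
      (trans e (cong (λ z → c ℤ.* (+ suc z)) (ℕ.+-identityʳ v)))

  B-recurrence : ∀ n → ι (+ suc (suc n)) * B (suc n) ≡ - sumℚ (suc n) (λ i → ι (+ (suc (suc n) C i)) * B i)
  B-recurrence n = begin
    ι N * B (suc n)                        ≡⟨ cong (ι N *_) (B≡b (suc n)) ⟩
    ι N * - ((+ 1 / suc (suc n)) * s)      ≡⟨ neg-distribʳ-* (ι N) ((+ 1 / suc (suc n)) * s) ⟨
    - (ι N * ((+ 1 / suc (suc n)) * s))    ≡⟨ cong -_ (*-assoc (ι N) (+ 1 / suc (suc n)) s) ⟨
    - (ι N * (+ 1 / suc (suc n)) * s)      ≡⟨ cong (λ z → - (z * s)) (ι-inverse (suc n)) ⟩
    - (1ℚ * s)                             ≡⟨ cong -_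
      (trans (*-identityˡ s) (go-prefix n (prefix (suc n)) (suc n))) ⟩
    - sumℚ (suc n) (λ i → ι (+ (suc (suc n) C i)) * B i) ∎
    where
    open ≡-Reasoning
    N = + suc (suc n)
    s = go n (prefix (suc n)) 0 (prefix (suc n))

  sumℚ-cong : ∀ n {f g} → (∀ i → f i ≡ g i) → sumℚ n f ≡ sumℚ n g
  sumℚ-cong zero    f≡g = refl
  sumℚ-cong (suc n) f≡g = cong₂ _+_ (sumℚ-cong n f≡g) (f≡g n)

  *-sumℚ : ∀ n c f → c * sumℚ n f ≡ sumℚ n (λ i → c * f i)
  *-sumℚ zero    c f = *-zeroʳ c
  *-sumℚ (suc n) c f = trans (*-distribˡ-+ c (sumℚ n f) (f n)) (cong (_+ c * f n) (*-sumℚ n c f))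

  *-leftComm : ∀ x y z → x * (y * z) ≡ y * (x * z)
  *-leftComm x y z = trans (sym (*-assoc x y z)) (trans (cong (_* z) (*-comm x y)) (*-assoc y x z))

  module _ {p : ℕ} (p-prime : Prime p) (M : ℤ) where

    infix 4 _∼_

    -- Congruence modulo M of a p-integral rational number and an integer.
    record _∼_ (x : ℚ) (z : ℤ) : Set where
      constructor scaled
      field
        d   : ℤ
        p∤d : ¬ p ℕ.∣ ℤ.∣ d ∣
        w   : ℤ
        eq  : ι d * x ≡ ι (d ℤ.* z ℤ.+ w ℤ.* M)

    ∤-* : ∀ {c d} → ¬ p ℕ.∣ ℤ.∣ c ∣ → ¬ p ℕ.∣ ℤ.∣ d ∣ → ¬ p ℕ.∣ ℤ.∣ c ℤ.* d ∣
    ∤-* {c} {d} p∤c p∤d p∣cd with euclidsLemma ℤ.∣ c ∣ ℤ.∣ d ∣ p-prime (subst (p ℕ.∣_) (ℤ.abs-* c d) p∣cd)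
    ... | inj₁ p∣c = p∤c p∣c
    ... | inj₂ p∣d = p∤d p∣d

    ∼-ι : ∀ z → ι z ∼ z
    ∼-ι z = scaled 1ℤ (∤1 p-prime) 0ℤ (trans (*-identityˡ (ι z)) (cong ι (lemma z M)))
      where
      lemma : ∀ z M → z ≡ 1ℤ ℤ.* z ℤ.+ 0ℤ ℤ.* M
      lemma = ℤSolver.solve-∀

    ∼-+ : ∀ {x y u v} → x ∼ u → y ∼ v → x + y ∼ u ℤ.+ v
    ∼-+ {x} {y} {u} {v} (scaled c p∤c s eq₁) (scaled d p∤d t eq₂) =
      scaled (c ℤ.* d) (∤-* {c} {d} p∤c p∤d) (d ℤ.* s ℤ.+ c ℤ.* t) (begin
      ι (c ℤ.* d) * (x + y)                                    ≡⟨ cong (_* (x + y)) (ι-* c d) ⟩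
      ι c * ι d * (x + y)                                      ≡⟨ *-distribˡ-+ (ι c * ι d) x y ⟩
      ι c * ι d * x + ι c * ι d * y
        ≡⟨ cong₂ _+_ (trans (*-assoc (ι c) (ι d) x) (*-leftComm (ι c) (ι d) x)) (*-assoc (ι c) (ι d) y) ⟩
      ι d * (ι c * x) + ι c * (ι d * y)
        ≡⟨ cong₂ (λ a b → ι d * a + ι c * b) eq₁ eq₂ ⟩
      ι d * ι X + ι c * ι Y                                    ≡⟨ cong₂ _+_ (ι-* d X) (ι-* c Y) ⟨
      ι (d ℤ.* X) + ι (c ℤ.* Y)                                ≡⟨ ι-+ (d ℤ.* X) (c ℤ.* Y) ⟨
      ι (d ℤ.* X ℤ.+ c ℤ.* Y)                                  ≡⟨ cong ι (lemma c d u v s t M) ⟩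
      ι (c ℤ.* d ℤ.* (u ℤ.+ v) ℤ.+ (d ℤ.* s ℤ.+ c ℤ.* t) ℤ.* M) ∎)
      where
      open ≡-Reasoning
      X = c ℤ.* u ℤ.+ s ℤ.* M
      Y = d ℤ.* v ℤ.+ t ℤ.* M
      lemma : ∀ c d u v s t M → d ℤ.* (c ℤ.* u ℤ.+ s ℤ.* M) ℤ.+ c ℤ.* (d ℤ.* v ℤ.+ t ℤ.* M)
        ≡ c ℤ.* d ℤ.* (u ℤ.+ v) ℤ.+ (d ℤ.* s ℤ.+ c ℤ.* t) ℤ.* M
      lemma = ℤSolver.solve-∀

    ∼-*ˡ : ∀ c {x u} → x ∼ u → ι c * x ∼ c ℤ.* u
    ∼-*ˡ c {x} {u} (scaled d p∤d w eq) = scaled d p∤d (c ℤ.* w) (begin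
      ι d * (ι c * x)                        ≡⟨ *-leftComm (ι d) (ι c) x ⟩
      ι c * (ι d * x)                        ≡⟨ cong (ι c *_) eq ⟩
      ι c * ι (d ℤ.* u ℤ.+ w ℤ.* M)          ≡⟨ ι-* c (d ℤ.* u ℤ.+ w ℤ.* M) ⟨
      ι (c ℤ.* (d ℤ.* u ℤ.+ w ℤ.* M))        ≡⟨ cong ι (lemma c d u w M) ⟩
      ι (d ℤ.* (c ℤ.* u) ℤ.+ c ℤ.* w ℤ.* M)  ∎)
      where
      open ≡-Reasoning
      lemma : ∀ c d u w M → c ℤ.* (d ℤ.* u ℤ.+ w ℤ.* M) ≡ d ℤ.* (c ℤ.* u) ℤ.+ c ℤ.* w ℤ.* M
      lemma = ℤSolver.solve-∀

    ∼-sum : ∀ n {f g} → (∀ i → i ℕ.< n → f i ∼ g i) → sumℚ n f ∼ sum n g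
    ∼-sum zero    f∼g = ∼-ι 0ℤ
    ∼-sum (suc n) f∼g = ∼-+ (∼-sum n (λ i i<n → f∼g i (ℕ.m<n⇒m<1+n i<n))) (f∼g n (ℕ.n<1+n n))

    ∼-neg : ∀ {x u} → x ∼ u → - x ∼ ℤ.- u
    ∼-neg {x} {u} (scaled d p∤d w eq) = scaled d p∤d (ℤ.- w)
      (trans (sym (neg-distribʳ-* (ι d) x))
        (trans (cong -_ eq) (trans (sym (ι-neg (d ℤ.* u ℤ.+ w ℤ.* M))) (cong ι (lemma d u w M)))))
      where
      lemma : ∀ d u w M → ℤ.- (d ℤ.* u ℤ.+ w ℤ.* M) ≡ d ℤ.* (ℤ.- u) ℤ.+ (ℤ.- w) ℤ.* M
      lemma = ℤSolver.solve-∀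

    ∼-≈ : ∀ {x u v} → x ∼ u → u ≈ v [ M ] → x ∼ v
    ∼-≈ {x} {u} {v} (scaled d p∤d w eq) (by q refl) =
      scaled d p∤d (d ℤ.* q ℤ.+ w) (trans eq (cong ι (lemma d v q w M)))
      where
      lemma : ∀ d v q w M → d ℤ.* (v ℤ.+ q ℤ.* M) ℤ.+ w ℤ.* M ≡ d ℤ.* v ℤ.+ (d ℤ.* q ℤ.+ w) ℤ.* M
      lemma = ℤSolver.solve-∀

    ∼-cancel : ∀ c {x u} → ¬ p ℕ.∣ ℤ.∣ c ∣ → ι c * x ∼ c ℤ.* u → x ∼ u
    ∼-cancel c {x} {u} p∤c (scaled d p∤d w eq) = scaled (d ℤ.* c) (∤-* {d} {c} p∤d p∤c) w
      (trans (cong (_* x) (ι-* d c))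
        (trans (*-assoc (ι d) (ι c) x) (trans eq (cong (λ z → ι (z ℤ.+ w ℤ.* M)) (sym (ℤ.*-assoc d c u))))))

    -- Both sides equal `n` at `i = 0`. For `i ≥ 1` they obey the same recurrence modulo `M`,
    -- because the right-hand side `n ^ suc i` for power sums vanishes there; its last coefficient
    -- `suc i` is prime to `p`.
    bernoulli∼power-sum : ∀ n → (∀ r → (+ n) ℤ.^ suc (suc r) ≈ 0ℤ [ M ]) → ∀ i → suc i ℕ.< p →
      ι (+ n) * B i ∼ S i n
    bernoulli∼power-sum n n²≈0 = <-rec _ step
      where
      step : ∀ i → (∀ {j} → j ℕ.< i → suc j ℕ.< p → ι (+ n) * B j ∼ S j n) → suc i ℕ.< p →
        ι (+ n) * B i ∼ S i n
      step zero    rec _ = subst₂ _∼_ (sym (*-identityʳ (ι (+ n)))) (sym S₀) (∼-ι (+ n))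
        where
        S₀ : S 0 n ≡ + n
        S₀ = trans (sum-const n 1ℤ) (ℤ.*-identityʳ (+ n))
      step (suc r) rec r<p = ∼-cancel c (λ p∣c → ℕ.<⇒≱ r<p (ℕ.∣⇒≤ p∣c))
        (∼-≈ (subst (_∼ ℤ.- lower) (sym b-recurrence)
        (∼-neg (∼-sum (suc r) (λ i i<r →
          ∼-*ˡ (+ (suc (suc r) C i)) (rec i<r (ℕ.<-trans (s≤s i<r) r<p)))))) lower≈)
        where
        c = + suc (suc r)
        lower = sum (suc r) (λ i → + (suc (suc r) C i) ℤ.* S i n)
        b-recurrence : ι c * (ι (+ n) * B (suc r)) ≡ - sumℚ (suc r)
          (λ i → ι (+ (suc (suc r) C i)) * (ι (+ n) * B i))
        b-recurrence = begin
          ι c * (ι (+ n) * B (suc r))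
            ≡⟨ *-leftComm (ι c) (ι (+ n)) (B (suc r)) ⟩
          ι (+ n) * (ι c * B (suc r))
            ≡⟨ cong (ι (+ n) *_) (B-recurrence r) ⟩
          ι (+ n) * - sumℚ (suc r) (λ i → ι (+ (suc (suc r) C i)) * B i)
            ≡⟨ neg-distribʳ-* (ι (+ n)) (sumℚ (suc r) (λ i → ι (+ (suc (suc r) C i)) * B i)) ⟨
          - (ι (+ n) * sumℚ (suc r) (λ i → ι (+ (suc (suc r) C i)) * B i))
            ≡⟨ cong -_ (*-sumℚ (suc r) (ι (+ n)) (λ i → ι (+ (suc (suc r) C i)) * B i)) ⟩
          - sumℚ (suc r) (λ i → ι (+ n) * (ι (+ (suc (suc r) C i)) * B i))
            ≡⟨ cong -_ (sumℚ-cong (suc r) (λ i → *-leftComm (ι (+ n)) (ι (+ (suc (suc r) C i))) (B i))) ⟩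
          - sumℚ (suc r) (λ i → ι (+ (suc (suc r) C i)) * (ι (+ n) * B i))   ∎
          where open ≡-Reasoning
        [2+r]C[1+r]≡2+r : suc (suc r) C suc r ≡ suc (suc r)
        [2+r]C[1+r]≡2+r = trans (nCk≡nC[n∸k] (ℕ.n≤1+n (suc r)))
          (trans (cong (suc (suc r) C_) (ℕ.m+n∸n≡m 1 r)) (nC1≡n (suc (suc r))))
        rearrange : ∀ l t → ℤ.- l ≡ t ℤ.- (l ℤ.+ t)
        rearrange = ℤSolver.solve-∀
        lower≈ : ℤ.- lower ≈ c ℤ.* S (suc r) n [ M ]
        lower≈ = begin
          ℤ.- lower                                          ≡⟨ rearrange lower (c ℤ.* S (suc r) n) ⟩
          c ℤ.* S (suc r) n ℤ.- (lower ℤ.+ c ℤ.* S (suc r) n)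
            ≡⟨ cong (λ z → c ℤ.* S (suc r) n ℤ.- (lower ℤ.+ + z ℤ.* S (suc r) n)) [2+r]C[1+r]≡2+r ⟨
          c ℤ.* S (suc r) n ℤ.- sum (suc (suc r)) (λ i → + (suc (suc r) C i) ℤ.* S i n)
            ≡⟨ cong (λ z → c ℤ.* S (suc r) n ℤ.- z) (power-sum-recurrence (suc r) n) ⟩
          c ℤ.* S (suc r) n ℤ.- (+ n) ℤ.^ suc (suc r)
            ≈⟨ +-congˡ-≈ (c ℤ.* S (suc r) n) (neg-cong-≈ (n²≈0 r)) ⟩
          c ℤ.* S (suc r) n ℤ.+ 0ℤ                           ≡⟨ ℤ.+-identityʳ (c ℤ.* S (suc r) n) ⟩
          c ℤ.* S (suc r) n                                  ∎
          where open ≈-Reasoning M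

  -- Modulo `p ^ (2 + e)` the number `n B r` is congruent to `S r n`, hence to 0. After clearing
  -- denominators the factor `p ^ suc e` of `n` cancels, and the remaining `p` must divide the
  -- numerator.
  Vanishes⇒∣U : ∀ {n p r} → Prime p → suc r ℕ.< p → Vanishes n p r → p ℕ.∣ ℤ.∣ U r ∣
  Vanishes⇒∣U {n} {p} {r} p-prime r<p (vanishes {e} {n′} n≡ p∤n′ S≈0) = ≈0⇒∣ {p} {U r} U≈0
    where
    P = + p
    M = P ℤ.^ (2 ℕ.+ e)
    instance
      p≢0 : ℕ.NonZero p
      p≢0 = prime⇒nonZero p-prime
    n≡ℤ : + n ≡ P ℤ.^ suc e ℤ.* + n′
    n≡ℤ = trans (cong (λ z → + z) n≡)
      (trans (ℤ.pos-* (p ℕ.^ suc e) n′) (cong (ℤ._* + n′) (pos-^ p (suc e))))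
    lemma₁ : ∀ P a n b → P ℤ.* a ℤ.* n ℤ.* (P ℤ.* a ℤ.* n ℤ.* b) ≡ 0ℤ ℤ.+ a ℤ.* n ℤ.* n ℤ.* b ℤ.*
      (P ℤ.* (P ℤ.* a))
    lemma₁ = ℤSolver.solve-∀
    n²≈0 : ∀ i → (+ n) ℤ.^ suc (suc i) ≈ 0ℤ [ M ]
    n²≈0 i = by (P ℤ.^ e ℤ.* + n′ ℤ.* + n′ ℤ.* (+ n) ℤ.^ i)
      (trans (cong (λ z → z ℤ.* (z ℤ.* (+ n) ℤ.^ i)) n≡ℤ) (lemma₁ P (P ℤ.^ e) (+ n′) ((+ n) ℤ.^ i)))
    nB∼0 : _∼_ p-prime M (ι (+ n) * B r) 0ℤ
    nB∼0 = ∼-≈ p-prime M (bernoulli∼power-sum p-prime M n n²≈0 r r<p) S≈0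
    open _∼_ nB∼0
    lemma₂ : ∀ d w M → d ℤ.* 0ℤ ℤ.+ w ℤ.* M ≡ w ℤ.* M
    lemma₂ = ℤSolver.solve-∀
    cross : d ℤ.* + n ℤ.* U r ≡ w ℤ.* M ℤ.* ↧ B r
    cross = ι-cross (d ℤ.* + n) (w ℤ.* M) (B r) (trans (cong (_* B r) (ι-* d (+ n)))
      (trans (*-assoc (ι d) (ι (+ n)) (B r)) (trans eq (cong ι (lemma₂ d w M)))))
    lemma₃ : ∀ d a n u → a ℤ.* (d ℤ.* n ℤ.* u) ≡ d ℤ.* (a ℤ.* n) ℤ.* u
    lemma₃ = ℤSolver.solve-∀
    lemma₄ : ∀ w P a v → w ℤ.* (P ℤ.* a) ℤ.* v ≡ 0ℤ ℤ.+ w ℤ.* v ℤ.* (a ℤ.* P)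
    lemma₄ = ℤSolver.solve-∀
    dn′U≈0 : d ℤ.* + n′ ℤ.* U r ≈ 0ℤ [ P ]
    dn′U≈0 = cancel-modulus (p ℕ.^ suc e) {{ℕ.m^n≢0 p (suc e)}} {d ℤ.* + n′ ℤ.* U r} {P}
      (subst (λ a → a ℤ.* (d ℤ.* + n′ ℤ.* U r) ≈ 0ℤ [ a ℤ.* P ]) (sym (pos-^ p (suc e)))
        (by (w ℤ.* ↧ B r) (trans (lemma₃ d (P ℤ.^ suc e) (+ n′) (U r))
          (trans (cong (λ z → d ℤ.* z ℤ.* U r) (sym n≡ℤ))
            (trans cross (lemma₄ w P (P ℤ.^ suc e) (↧ B r)))))))
    U≈0 : U r ≈ 0ℤ [ P ]
    U≈0 = subst (λ N → U r ≈ 0ℤ [ N ]) (ℤ.*-identityʳ P)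
      (cancel p-prime 1 {d ℤ.* + n′} {U r} (∤-* p-prime M {d} {+ n′} p∤d p∤n′)
      (subst (λ N → d ℤ.* + n′ ℤ.* U r ≈ 0ℤ [ N ]) (sym (ℤ.*-identityʳ P)) dn′U≈0))

-- Excluding a residue class of exponents by an auxiliary prime

module ModularTest where

  open import Defs using (T)
  open Congruence
  open PowerSums
  open PrimeModulus
  open Kummer
  open Irregularity
  open import Data.Bool using (Bool; true; false; not; _∧_; if_then_else_)
  open import Data.Bool.Properties using (∧-conicalˡ; ∧-conicalʳ)
  open import Data.List using (List; []; _∷_)
  open import Data.Nat as ℕ using (ℕ; zero; suc; s≤s; NonZero; _+_; _*_; _^_; _≤_; _<_; _%_; _/_; _≡ᵇ_; _<ᵇ_)
  open import Data.Nat.Properties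
  open import Data.Nat.Divisibility using (_∣_; divides)
  open import Data.Nat.DivMod using (m≡m%n+[m/n]*n; m%n<n)
  open import Data.Nat.Primality
  open import Data.Nat.Tactic.RingSolver using (solve-∀)
  import Data.Integer as ℤ
  import Data.Integer.Properties as ℤ
  import Data.Integer.Tactic.RingSolver as ℤSolver
  open import Data.Product using (_×_; _,_; proj₁; proj₂)
  open import Data.Unit using (tt)
  open import Relation.Nullary
  open import Relation.Binary.PropositionalEquality

  -- Division with remainder, made total so that the divisor may be computed.
  _rem_ _quo_ : ℕ → ℕ → ℕ
  m rem zero  = m
  m rem suc n = m % suc n
  m quo zero  = 0
  m quo suc n = m / suc n

  rem-quo : ∀ m n → m ≡ m rem n + (m quo n) * n
  rem-quo m zero    = sym (+-identityʳ m)
  rem-quo m (suc n) = m≡m%n+[m/n]*n m (suc n)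

  rem-≈ : ∀ m n → ℤ.+ (m rem n) ≈ ℤ.+ m [ ℤ.+ n ]
  rem-≈ m n = ≈-sym (by (ℤ.+ (m quo n))
    (trans (cong (λ z → ℤ.+ z) (rem-quo m n)) (cong (ℤ._+_ (ℤ.+ (m rem n))) (ℤ.pos-* (m quo n) n))))

  rem-< : ∀ m n .{{_ : NonZero n}} → m rem n < n
  rem-< m (suc n) = m%n<n m (suc n)

  rem-cong : ∀ {x y} n .{{_ : NonZero n}} → ℤ.+ x ≈ ℤ.+ y [ ℤ.+ n ] → x rem n ≡ y rem n
  rem-cong {x} {y} n x≈y = residue-unique {n} (rem-< x n) (rem-< y n)
    (≈-trans (rem-≈ x n) (≈-trans x≈y (≈-sym (rem-≈ y n))))

  0-rem : ∀ n .{{_ : NonZero n}} → 0 rem n ≡ 0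
  0-rem (suc n) = refl

  ≡ᵇ-complete : ∀ {m n} → m ≡ n → (m ≡ᵇ n) ≡ true
  ≡ᵇ-complete {zero}  refl = refl
  ≡ᵇ-complete {suc m} refl = ≡ᵇ-complete {m} refl

  ≡ᵇ-sound : ∀ {m n} → (m ≡ᵇ n) ≡ true → m ≡ n
  ≡ᵇ-sound {m} {n} eq = ≡ᵇ⇒≡ m n (subst Data.Bool.T (sym eq) tt)

  not-≡ᵇ : ∀ {m n} → not (m ≡ᵇ n) ≡ true → ¬ m ≡ n
  not-≡ᵇ {m} eq refl = contradiction (trans (sym eq) (cong not (≡ᵇ-complete {m} refl))) λ ()

  binary : ℕ → ℕ → List Bool
  binary zero       t = []
  binary (suc fuel) t = (t rem 2 ≡ᵇ 1) ∷ binary fuel (t quo 2)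

  value : List Bool → ℕ
  value []           = 0
  value (true  ∷ bs) = suc (2 * value bs)
  value (false ∷ bs) = 2 * value bs

  square-step : ℕ → ℕ → Bool → ℕ → ℕ
  square-step N x true  y = (y * y * x) rem N
  square-step N x false y = (y * y) rem N

  power : ℕ → ℕ → List Bool → ℕ
  power N x []       = 1
  power N x (b ∷ bs) = square-step N x b (power N x bs)

  power-≈ : ∀ N x bs → ℤ.+ power N x bs ≈ (ℤ.+ x) ℤ.^ value bs [ ℤ.+ N ]
  power-≈ N x []       = ≈-refl
  power-≈ N x (true ∷ bs) = begin
    ℤ.+ ((y * y * x) rem N)                     ≈⟨ rem-≈ (y * y * x) N ⟩
    ℤ.+ (y * y * x)                             ≡⟨ trans (ℤ.pos-* (y * y) x)
      (cong (ℤ._* ℤ.+ x) (ℤ.pos-* y y)) ⟩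
    ℤ.+ y ℤ.* ℤ.+ y ℤ.* ℤ.+ x                   ≈⟨ *-congʳ-≈ (ℤ.+ x)
      (*-cong-≈ (power-≈ N x bs) (power-≈ N x bs)) ⟩
    X ℤ.^ v ℤ.* X ℤ.^ v ℤ.* X                   ≡⟨ lemma (X ℤ.^ v) X ⟩
    X ℤ.* (X ℤ.^ v ℤ.* (X ℤ.^ v ℤ.* ℤ.1ℤ))
      ≡⟨ cong (ℤ._*_ X) (trans (ℤ.^-*-assoc X v 2) (cong (X ℤ.^_) (*-comm v 2))) ⟩
    X ℤ.^ suc (2 * v)                           ∎
    where
    open ≈-Reasoning (ℤ.+ N)
    X = ℤ.+ x
    y = power N x bs
    v = value bs
    lemma : ∀ a x → a ℤ.* a ℤ.* x ≡ x ℤ.* (a ℤ.* (a ℤ.* ℤ.1ℤ))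
    lemma = ℤSolver.solve-∀
  power-≈ N x (false ∷ bs) = begin
    ℤ.+ ((y * y) rem N)                         ≈⟨ rem-≈ (y * y) N ⟩
    ℤ.+ (y * y)                                 ≡⟨ ℤ.pos-* y y ⟩
    ℤ.+ y ℤ.* ℤ.+ y                             ≈⟨ *-cong-≈ (power-≈ N x bs) (power-≈ N x bs) ⟩
    X ℤ.^ v ℤ.* X ℤ.^ v                         ≡⟨ lemma (X ℤ.^ v) ⟩
    X ℤ.^ v ℤ.* (X ℤ.^ v ℤ.* ℤ.1ℤ)              ≡⟨ trans (ℤ.^-*-assoc X v 2) (cong (X ℤ.^_) (*-comm v 2)) ⟩
    X ℤ.^ (2 * v)                               ∎
    where
    open ≈-Reasoning (ℤ.+ N)
    X = ℤ.+ x
    y = power N x bs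
    v = value bs
    lemma : ∀ a → a ℤ.* a ≡ a ℤ.* (a ℤ.* ℤ.1ℤ)
    lemma = ℤSolver.solve-∀

  module Kill (a q : ℕ) (bs : List Bool) where

    -- One pass over m = 0, …, q - 1 for an exponent t, with T t m accumulated
    -- modulo q².  At 2 m + 1 = q it tests that T t m is nonzero modulo q²,
    -- elsewhere that m does not solve the equation modulo q.
    loop : ℕ → ℕ → ℕ → Bool
    step : ℕ → ℕ → ℕ → ℕ → Bool
    loop zero    m s = s rem q ≡ᵇ 0
    loop (suc f) m s = step f m s (power (q * q) (2 * m + 1) bs)
    step f m s x = (if 2 * m + 1 ≡ᵇ q then not (s rem (q * q) ≡ᵇ 0) else not
      ((a * s) rem q ≡ᵇ x rem q)) ∧ loop f (suc m) (x + s)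

    private
      t : ℕ
      t = value bs

    record Good (m : ℕ) : Set where
      field
        at-q : 2 * m + 1 ≡ q → ¬ ℤ.+ T t m ≈ ℤ.0ℤ [ ℤ.+ (q * q) ]
        off-q : ¬ 2 * m + 1 ≡ q → ¬ ℤ.+ (a * T t m) ≈ ℤ.+ ((2 * m + 1) ^ t) [ ℤ.+ q ]

    module _ .{{_ : NonZero q}} where

      private instance
        q²≢0 : NonZero (q * q)
        q²≢0 = m*n≢0 q q

      weaken-q² : ∀ {x y} → x ≈ y [ ℤ.+ (q * q) ] → x ≈ y [ ℤ.+ q ]
      weaken-q² {x} {y} x≈y = weaken-≈ (ℤ.+ q) (ℤ.+ q) (subst (λ N → x ≈ y [ N ]) (ℤ.pos-* q q) x≈y)

      good : ∀ m s x → ℤ.+ s ≈ ℤ.+ T t m [ ℤ.+ (q * q) ] → ℤ.+ x ≈ ℤ.+ ((2 * m + 1) ^ t) [ ℤ.+ (q * q) ] →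
        (if 2 * m + 1 ≡ᵇ q then not (s rem (q * q) ≡ᵇ 0) else not ((a * s) rem q ≡ᵇ x rem q)) ≡
          true → Good m
      good m s x s≈ x≈ with 2 * m + 1 ≡ᵇ q in n≡ᵇq
      ... | true = λ passed → record
        { at-q  = λ _ T≈0 → not-≡ᵇ passed (trans (rem-cong (q * q) (≈-trans s≈ T≈0)) (0-rem (q * q)))
        ; off-q = λ n≢q → contradiction (≡ᵇ-sound n≡ᵇq) n≢q
        }
      ... | false = λ passed → record
        { at-q  = λ n≡q → contradiction (trans (sym (≡ᵇ-complete n≡q)) n≡ᵇq) λ ()
        ; off-q = λ _ aT≈ → not-≡ᵇ passed
            (rem-cong q (≈-trans (aT s≈) (≈-trans aT≈ (≈-sym (weaken-q² x≈)))))
        }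
        where
        aT : ℤ.+ s ≈ ℤ.+ T t m [ ℤ.+ (q * q) ] → ℤ.+ (a * s) ≈ ℤ.+ (a * T t m) [ ℤ.+ q ]
        aT s≈ = ≈-trans (≈-reflexive (ℤ.pos-* a s))
          (≈-trans (*-congˡ-≈ (ℤ.+ a) (weaken-q² s≈)) (≈-reflexive (sym (ℤ.pos-* a (T t m)))))

      -- Over all `q` steps, the test at the end of the pass says that `T t q` is 0 modulo `q`. This
      -- makes `T t` periodic modulo `q`, so that the tested `m` represent all others.
      loop-sound : ∀ f m s → ℤ.+ s ≈ ℤ.+ T t m [ ℤ.+ (q * q) ] → loop f m s ≡ true →
        (∀ i → i < f → Good (m + i)) × (ℤ.+ T t (m + f) ≈ ℤ.0ℤ [ ℤ.+ q ])
      loop-sound zero m s s≈ passed =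
        (λ _ ()) , subst (λ m → ℤ.+ T t m ≈ ℤ.0ℤ [ ℤ.+ q ]) (sym (+-identityʳ m))
        (≈-trans (weaken-q² (≈-sym s≈))
          (≈-trans (≈-sym (rem-≈ s q)) (≈-reflexive (cong (λ z → ℤ.+ z) (≡ᵇ-sound passed)))))
      loop-sound (suc f) m s s≈ passed = goods ,
        subst (λ m → ℤ.+ T t m ≈ ℤ.0ℤ [ ℤ.+ q ]) (sym (+-suc m f)) (proj₂ rest)
        where
        x = power (q * q) (2 * m + 1) bs
        x≈ : ℤ.+ x ≈ ℤ.+ ((2 * m + 1) ^ t) [ ℤ.+ (q * q) ]
        x≈ = ≈-trans (power-≈ (q * q) (2 * m + 1) bs) (≈-reflexive (sym (pos-^ (2 * m + 1) t)))
        test = if 2 * m + 1 ≡ᵇ q then not (s rem (q * q) ≡ᵇ 0) else not ((a * s) rem q ≡ᵇ x rem q)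
        rest = loop-sound f (suc m) (x + s)
          (≈-trans (+-cong-≈ x≈ s≈) (≈-reflexive (ℤ.+-comm (ℤ.+ ((2 * m + 1) ^ t)) (ℤ.+ T t m))))
          (∧-conicalʳ test (loop f (suc m) (x + s)) passed)
        goods : ∀ i → i < suc f → Good (m + i)
        goods zero    _         = subst Good (sym (+-identityʳ m))
          (good m s x s≈ x≈ (∧-conicalˡ test (loop f (suc m) (x + s)) passed))
        goods (suc i) (s≤s i<f) = subst Good (sym (+-suc m i)) (proj₁ rest i i<f)

  -- Comparing `value (binary 20 t)` with `t` makes the correctness of the binary expansion, and the
  -- sufficiency of 20 bits, part of the test. The class of 0 is refused because periodicity of
  -- powers modulo `q` requires positive exponents.
  kill : ℕ → ℕ → ℕ → Bool
  kill a q t = (0 <ᵇ t) ∧ ((value (binary 20 t) ≡ᵇ t) ∧ Kill.loop a q (binary 20 t) q 0 0)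

  T-congᵏ : ∀ {q} → Prime (suc q) → ∀ t b m → ℤ.+ T (suc t + b * q) m ≈ ℤ.+ T (suc t) m [ ℤ.+ suc q ]
  T-congᵏ p-prime t b zero    = ≈-refl
  T-congᵏ {q} p-prime t b (suc m) = +-cong-≈ (T-congᵏ p-prime t b m)
    (≈-trans (≈-reflexive (pos-^ (2 * m + 1) (suc t + b * q)))
      (≈-trans (^-period p-prime refl t b (ℤ.+ (2 * m + 1)))
        (≈-reflexive (sym (pos-^ (2 * m + 1) (suc t))))))

  2*+1-≈ : ∀ q z m → ℤ.+ (2 * (z * q + m) + 1) ≈ ℤ.+ (2 * m + 1) [ ℤ.+ q ]
  2*+1-≈ q z m = by (ℤ.+ (2 * z))
    (trans (cong (λ n → ℤ.+ n) (lemma q z m)) (cong (ℤ._+_ (ℤ.+ (2 * m + 1))) (ℤ.pos-* (2 * z) q)))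
    where
    lemma : ∀ q z m → 2 * (z * q + m) + 1 ≡ 2 * m + 1 + 2 * z * q
    lemma = solve-∀

  T-+ : ∀ q k z m → ℤ.+ T k (z * q + m) ≈ ℤ.+ T k (z * q) ℤ.+ ℤ.+ T k m [ ℤ.+ q ]
  T-+ q k z zero    = ≈-reflexive
    (trans (cong (λ m → ℤ.+ T k m) (+-identityʳ (z * q))) (sym (ℤ.+-identityʳ (ℤ.+ T k (z * q)))))
  T-+ q k z (suc m) = begin
    ℤ.+ T k (z * q + suc m)                                                    ≡⟨ cong
      (λ m → ℤ.+ T k m) (+-suc (z * q) m) ⟩
    ℤ.+ T k (z * q + m) ℤ.+ ℤ.+ ((2 * (z * q + m) + 1) ^ k)
      ≈⟨ +-cong-≈ (T-+ q k z m) power-≈′ ⟩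
    ℤ.+ T k (z * q) ℤ.+ ℤ.+ T k m ℤ.+ ℤ.+ ((2 * m + 1) ^ k)
      ≡⟨ ℤ.+-assoc (ℤ.+ T k (z * q)) (ℤ.+ T k m) (ℤ.+ ((2 * m + 1) ^ k)) ⟩
    ℤ.+ T k (z * q) ℤ.+ ℤ.+ T k (suc m)                                        ∎
    where
    open ≈-Reasoning (ℤ.+ q)
    power-≈′ : ℤ.+ ((2 * (z * q + m) + 1) ^ k) ≈ ℤ.+ ((2 * m + 1) ^ k) [ ℤ.+ q ]
    power-≈′ = ≈-trans (≈-reflexive (pos-^ (2 * (z * q + m) + 1) k))
      (≈-trans (^-cong-≈ k (2*+1-≈ q z m)) (≈-reflexive (sym (pos-^ (2 * m + 1) k))))

  T-periodic : ∀ q k → ℤ.+ T k q ≈ ℤ.0ℤ [ ℤ.+ q ] → ∀ z → ℤ.+ T k (z * q) ≈ ℤ.0ℤ [ ℤ.+ q ]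
  T-periodic q k Tq≈0 zero    = ≈-refl
  T-periodic q k Tq≈0 (suc z) = begin
    ℤ.+ T k (q + z * q)                  ≡⟨ cong (λ m → ℤ.+ T k m) (+-comm q (z * q)) ⟩
    ℤ.+ T k (z * q + q)                  ≈⟨ T-+ q k z q ⟩
    ℤ.+ T k (z * q) ℤ.+ ℤ.+ T k q        ≈⟨ +-cong-≈ (T-periodic q k Tq≈0 z) Tq≈0 ⟩
    ℤ.0ℤ                                 ∎
    where open ≈-Reasoning (ℤ.+ q)

  Excluded : ℕ → ℕ → Set
  Excluded a k = ∀ m → 1 < m → ¬ a * T k m ≡ (2 * m + 1) ^ k

  -- Replacing `n` by the prime itself and reflecting once more, now with `2 m₀ + 1` equal to that
  -- prime, gives a criterion free of the unknown `n`, which can be evaluated.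
  vanishing-T : ∀ {q} → Prime (suc q) → ¬ 2 ∣ suc q → ∀ {n h m₀} → suc (2 * suc h) < suc q →
    2 * m₀ + 1 ≡ suc q →
    Vanishes n (suc q) (2 * suc h) → ℤ.+ T (2 * suc h) m₀ ≈ ℤ.0ℤ [ ℤ.+ (suc q * suc q) ]
  vanishing-T {q} p-prime p-odd {n} {h} {m₀} r<q m₀≡ (vanishes {e} {n′} n≡ p∤n′ S≈0) = begin
    ℤ.+ T k m₀                        ≈⟨ T≈2^*S {h} {m₀} lin ⟩
    (ℤ.+ 2) ℤ.^ k′ ℤ.* S k (2 * m₀ + 1) ≡⟨ cong (λ n → (ℤ.+ 2) ℤ.^ k′ ℤ.* S k n) m₀≡ ⟩
    (ℤ.+ 2) ℤ.^ k′ ℤ.* S k p          ≈⟨ *-congˡ-≈ ((ℤ.+ 2) ℤ.^ k′) {S k p} {ℤ.0ℤ}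
      (subst (λ N → S k p ≈ ℤ.0ℤ [ N ]) p²≡ Sp≈0) ⟩
    (ℤ.+ 2) ℤ.^ k′ ℤ.* ℤ.0ℤ           ≡⟨ ℤ.*-zeroʳ ((ℤ.+ 2) ℤ.^ k′) ⟩
    ℤ.0ℤ                              ∎
    where
    p = suc q
    P = ℤ.+ p
    k = 2 * suc h
    k′ = ℕ.pred k
    open ≈-Reasoning (ℤ.+ (p * p))
    p²≡ : P ℤ.^ 2 ≡ ℤ.+ (p * p)
    p²≡ = trans (cong (ℤ._*_ P) (ℤ.*-identityʳ P)) (sym (ℤ.pos-* p p))
    Sp≈0 : S k p ≈ ℤ.0ℤ [ P ℤ.^ 2 ]
    Sp≈0 = S-n⇒S-p p-prime p-odd e n′ p∤n′ k r<q (subst (λ n → S k n ≈ ℤ.0ℤ [ P ℤ.^ (2 + e) ]) n≡ S≈0)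
    lin : Linear (2 * m₀ + 1) k (ℤ.+ (p * p))
    lin = subst₂ (λ n W → Linear n k W) (trans (*-identityʳ (p ^ 1)) (trans (*-identityʳ p) (sym m₀≡))) p²≡
      (subst (λ k → Linear (p ^ 1 * 1) k (P ℤ.^ 2)) (*-identityˡ k)
        (linear p-prime p-odd 0 1 (∤1 p-prime) 0 k))

  kill-sound : ∀ {a q} .{{_ : NonZero q}} → 1 ≤ a → Prime (suc q) → ¬ 2 ∣ suc q → ∀ t →
    kill a (suc q) t ≡ true →
    ∀ h → (2 * suc h) % q ≡ t → Excluded a (2 * suc h)
  kill-sound {a} {q} 1≤a p-prime p-odd (suc t) passed h k%q≡t m 1<m solution with 2 * m₀ + 1 ≟ p
    where
    p = suc q
    m₀ = m % p
  ... | no n₀≢p = Kill.Good.off-q (proj₁ sound (m % p) (m%n<n m p)) n₀≢p (begin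
    ℤ.+ (a * T t′ m₀)                ≡⟨ ℤ.pos-* a (T t′ m₀) ⟩
    ℤ.+ a ℤ.* ℤ.+ T t′ m₀            ≈⟨ *-congˡ-≈ (ℤ.+ a) T≈ ⟨
    ℤ.+ a ℤ.* ℤ.+ T k m              ≡⟨ ℤ.pos-* a (T k m) ⟨
    ℤ.+ (a * T k m)                  ≡⟨ cong (λ z → ℤ.+ z) solution ⟩
    ℤ.+ ((2 * m + 1) ^ k)            ≡⟨ pos-^ (2 * m + 1) k ⟩
    (ℤ.+ (2 * m + 1)) ℤ.^ k          ≈⟨ ^-cong-≈ k n≈ ⟩
    (ℤ.+ (2 * m₀ + 1)) ℤ.^ k         ≡⟨ cong ((ℤ.+ (2 * m₀ + 1)) ℤ.^_) k≡ ⟩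
    (ℤ.+ (2 * m₀ + 1)) ℤ.^ (suc t + k / q * q) ≈⟨ ^-period p-prime refl t (k / q) (ℤ.+ (2 * m₀ + 1)) ⟩
    (ℤ.+ (2 * m₀ + 1)) ℤ.^ suc t     ≡⟨ cong ((ℤ.+ (2 * m₀ + 1)) ℤ.^_) t≡ ⟨
    (ℤ.+ (2 * m₀ + 1)) ℤ.^ t′        ≡⟨ pos-^ (2 * m₀ + 1) t′ ⟨
    ℤ.+ ((2 * m₀ + 1) ^ t′)          ∎)
    where
    p = suc q
    m₀ = m % p
    k = 2 * suc h
    t′ = value (binary 20 (suc t))
    open ≈-Reasoning (ℤ.+ p)
    t≡ : t′ ≡ suc t
    t≡ = ≡ᵇ-sound (∧-conicalˡ (t′ ≡ᵇ suc t) _ passed)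
    sound = Kill.loop-sound a p (binary 20 (suc t)) p 0 0 ≈-refl (∧-conicalʳ (t′ ≡ᵇ suc t) _ passed)
    k≡ : k ≡ suc t + k / q * q
    k≡ = trans (m≡m%n+[m/n]*n k q) (cong (_+ k / q * q) k%q≡t)
    m≡ : m ≡ m / p * p + m₀
    m≡ = trans (m≡m%n+[m/n]*n m p) (+-comm m₀ (m / p * p))
    n≈ : ℤ.+ (2 * m + 1) ≈ ℤ.+ (2 * m₀ + 1) [ ℤ.+ p ]
    n≈ = subst (λ m → ℤ.+ (2 * m + 1) ≈ ℤ.+ (2 * m₀ + 1) [ ℤ.+ p ]) (sym m≡) (2*+1-≈ p (m / p) m₀)
    T≈ : ℤ.+ T k m ≈ ℤ.+ T t′ m₀ [ ℤ.+ p ]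
    T≈ = begin
      ℤ.+ T k m                                      ≡⟨ cong (λ k → ℤ.+ T k m) k≡ ⟩
      ℤ.+ T (suc t + k / q * q) m                    ≈⟨ T-congᵏ p-prime t (k / q) m ⟩
      ℤ.+ T (suc t) m                                ≡⟨ cong₂ (λ t m → ℤ.+ T t m) (sym t≡) m≡ ⟩
      ℤ.+ T t′ (m / p * p + m₀)                      ≈⟨ T-+ p t′ (m / p) m₀ ⟩
      ℤ.+ T t′ (m / p * p) ℤ.+ ℤ.+ T t′ m₀
        ≈⟨ +-congʳ-≈ (ℤ.+ T t′ m₀) (T-periodic p t′ (proj₂ sound) (m / p)) ⟩
      ℤ.0ℤ ℤ.+ ℤ.+ T t′ m₀                           ≡⟨ ℤ.+-identityˡ (ℤ.+ T t′ m₀) ⟩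
      ℤ.+ T t′ m₀                                    ∎
  -- Here `p` divides `2 * m + 1`, where the equation modulo `p` says too little. Irregularity of
  -- `p` itself forces `T t m₀` to be 0 modulo `p ^ 2` instead, which the test at `m₀` has ruled
  -- out.
  ... | yes n₀≡p = Kill.Good.at-q (proj₁ sound (m % p) (m%n<n m p)) n₀≡p
    (subst (λ t → ℤ.+ T t m₀ ≈ ℤ.0ℤ [ ℤ.+ (p * p) ])
      (trans (sym (proj₁ (proj₂ irr))) (trans k%q≡t (sym t≡)))
      (vanishing-T p-prime p-odd {m₀ = m₀} (s≤s (proj₁ (proj₂ (proj₂ irr)))) n₀≡p
        (proj₂ (proj₂ (proj₂ irr)))))
    where
    p = suc q
    m₀ = m % p
    t′ = value (binary 20 (suc t))
    t≡ : t′ ≡ suc t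
    t≡ = ≡ᵇ-sound (∧-conicalˡ (t′ ≡ᵇ suc t) _ passed)
    sound = Kill.loop-sound a p (binary 20 (suc t)) p 0 0 ≈-refl (∧-conicalʳ (t′ ≡ᵇ suc t) _ passed)
    lemma : ∀ z p m → 2 * (m + z * p) + 1 ≡ 2 * m + 1 + 2 * z * p
    lemma = solve-∀
    p∣n : p ∣ 2 * m + 1
    p∣n = divides (suc (2 * (m / p)))
      (trans (cong (λ m → 2 * m + 1) (m≡m%n+[m/n]*n m p))
      (trans (lemma (m / p) p m₀) (cong (_+ 2 * (m / p) * p) n₀≡p)))
    irr = irregularity {a} {m} {h} 1≤a 1<m solution p-prime p-odd p∣n

-- Computing the irregular residues of a prime

module BlockSearch where

  open import Defs using (T)
  open Congruence
  open PowerSums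
  open ModularTest
  open import Data.Bool using (Bool; true; false; _∧_; if_then_else_)
  open import Data.Bool.Properties using (∧-conicalˡ; ∧-conicalʳ)
  open import Data.List using (List; []; _∷_; _++_; map; length; replicate; zipWith)
  open import Data.List.Properties using (length-++; length-map; length-replicate; length-zipWith)
  open import Data.List.Membership.Propositional using (_∈_)
  open import Data.List.Membership.Propositional.Properties using (∈-++⁺ˡ; ∈-++⁺ʳ)
  open import Data.List.Relation.Unary.Any using (here; there)
  open import Data.List.Relation.Unary.All using (All; []; _∷_)
  import Data.List.Relation.Unary.All as All
  import Data.List.Relation.Unary.All.Properties as All
  open import Data.Nat as ℕ using (ℕ; zero; suc; z≤n; s≤s; NonZero; >-nonZero; _+_; _*_; _^_; _≤_; _<_; _⊓_; _≡ᵇ_; _<ᵇ_; _≤ᵇ_)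
  open import Data.Nat.Properties
  open import Data.Nat.Tactic.RingSolver using (solve-∀)
  import Data.Integer as ℤ
  import Data.Integer.Properties as ℤ
  open import Data.Product using (_×_; _,_; proj₁; proj₂)
  import Data.Empty
  open import Data.Unit using (tt)
  open import Relation.Nullary
  open import Relation.Binary.PropositionalEquality

  squares : ℕ → ℕ → List ℕ
  squares zero    X = []
  squares (suc d) X = X ∷ squares d (X * X)

  geometric : ℕ → List ℕ → ℕ → ℕ → ℕ
  geometric N []       z V = V
  geometric N (X ∷ Xs) z V = geometric N Xs ((z * z) rem N) (V + V * z * X)

  scan : ℕ → ℕ → ℕ → ℕ → ℕ → List ℕ
  scan N X zero    r V = []
  scan N X (suc f) r V =
    if (V rem X) rem N ≡ᵇ 0 then r ∷ scan N X f (2 + r) (V quo X) else scan N X f (2 + r) (V quo X)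

  rows : ℕ → List ℕ → ℕ → List ℕ
  rows N Xs zero    = []
  rows N Xs (suc m) = geometric N Xs (((2 * m + 1) * (2 * m + 1)) rem N) 1 ∷ rows N Xs m

  raise : ℕ → ℕ → ℕ → ℕ
  raise N zero    z = z
  raise N (suc d) z = raise N d ((z * z) rem N)

  steps : ℕ → ℕ → ℕ → List ℕ
  steps N d zero    = []
  steps N d (suc m) = raise N d (((2 * m + 1) * (2 * m + 1)) rem N) ∷ steps N d m

  dot : List ℕ → List ℕ → ℕ
  dot (w ∷ ws) (r ∷ rs) = w * r + dot ws rs
  dot _        _        = 0

  advance : ℕ → List ℕ → List ℕ → List ℕ
  advance N (w ∷ ws) (s ∷ ss) = (s * w) rem N ∷ advance N ws ss
  advance N _        _        = []

  -- The even r with T r m ≡ 0 modulo N, searched in blocks of len digits.  For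
  -- each odd j < 2 m the row Σ X ^ u (j ^ 2) ^ u, u < len = 2 ^ d, is built by
  -- doubling as the product of 1 + X ^ 2 ^ i (j ^ 2) ^ 2 ^ i, i < d.  Weighting
  -- the rows by (j ^ 2) ^ e and adding them up gives one number whose base-X
  -- digits are congruent to T (2 e) m, T (2 (e + 1)) m, … modulo N.
  blocks : ℕ → ℕ → ℕ → ℕ → ℕ → ℕ → List ℕ → List ℕ → List ℕ → List ℕ
  blocks N X len zero    f r ws rs ss = []
  blocks N X len (suc B) f r ws rs ss =
    scan N X (len ⊓ f) r (dot ws rs) ++ blocks N X len B (f ℕ.∸ len) (2 * len + r) (advance N ws ss) rs ss

  node : ℕ → ℤ.ℤ
  node m = ℤ.+ (2 * m + 1) ℤ.* ℤ.+ (2 * m + 1)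

  -- The bound `w ≤ N` is not strict because the initial weights are 1 and `N` is only assumed
  -- nonzero.
  Powers : ℕ → ℕ → ℕ → List ℕ → Set
  Powers N e zero    []       = Data.Unit.⊤
  Powers N e (suc m) (w ∷ ws) = w ≤ N × (ℤ.+ w ≈ node m ℤ.^ e [ ℤ.+ N ]) × Powers N e m ws
  Powers N e _       _        = Data.Empty.⊥

  eval : ℕ → List ℕ → ℕ
  eval X []       = 0
  eval X (c ∷ cs) = c + X * eval X cs

  Approx : ℕ → (ℕ → ℤ.ℤ) → ℕ → List ℕ → Set
  Approx N F e []       = Data.Unit.⊤
  Approx N F e (c ∷ cs) = (ℤ.+ c ≈ F e [ ℤ.+ N ]) × Approx N F (suc e) cs

  -- The digits exist only in the proof; the computation sees the single number `V`. The bound is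
  -- carried along because digits below `X` can be read back from `V` without carries.
  record Expansion (X N : ℕ) (F : ℕ → ℤ.ℤ) (e len bound V : ℕ) : Set where
    field
      digits  : List ℕ
      value≡  : V ≡ eval X digits
      length≡ : length digits ≡ len
      approx  : Approx N F e digits
      bounded : All (_≤ bound) digits

  eval-++ : ∀ X cs ds → eval X (cs ++ ds) ≡ eval X cs + X ^ length cs * eval X ds
  eval-++ X []       ds = sym (+-identityʳ (eval X ds))
  eval-++ X (c ∷ cs) ds rewrite eval-++ X cs ds = lemma c X (eval X cs) (X ^ length cs) (eval X ds)
    where
    lemma : ∀ c X a b d → c + X * (a + b * d) ≡ c + X * a + X * b * d
    lemma = solve-∀

  eval-map : ∀ X z cs → eval X (map (z *_) cs) ≡ z * eval X cs
  eval-map X z []       = sym (*-zeroʳ z)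
  eval-map X z (c ∷ cs) rewrite eval-map X z cs = lemma X z c (eval X cs)
    where
    lemma : ∀ X z c v → z * c + X * (z * v) ≡ z * (c + X * v)
    lemma = solve-∀

  eval-zipWith : ∀ X cs ds → length cs ≡ length ds → eval X (zipWith _+_ cs ds) ≡ eval X cs + eval X ds
  eval-zipWith X []       []       eq = refl
  eval-zipWith X (c ∷ cs) (d ∷ ds) eq rewrite eval-zipWith X cs ds (suc-injective eq) =
    lemma X c d (eval X cs) (eval X ds)
    where
    lemma : ∀ X c d u v → c + d + X * (u + v) ≡ c + X * u + (d + X * v)
    lemma = solve-∀

  eval-replicate : ∀ X l → eval X (replicate l 0) ≡ 0
  eval-replicate X zero    = refl
  eval-replicate X (suc l) rewrite eval-replicate X l = *-zeroʳ X

  ∈-if : ∀ {x y : ℕ} {xs} b → x ∈ xs → x ∈ (if b then y ∷ xs else xs)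
  ∈-if true  x∈xs = there x∈xs
  ∈-if false x∈xs = x∈xs

  module _ {N : ℕ} where

    rem-node : ∀ m → ℤ.+ (((2 * m + 1) * (2 * m + 1)) rem N) ≈ node m [ ℤ.+ N ]
    rem-node m = ≈-trans (rem-≈ ((2 * m + 1) * (2 * m + 1)) N)
      (≈-reflexive (ℤ.pos-* (2 * m + 1) (2 * m + 1)))

    Approx-++ : ∀ {F} e cs {ds} → Approx N F e cs → Approx N F (length cs + e) ds → Approx N F e (cs ++ ds)
    Approx-++ e []       cs≈ ds≈ = ds≈
    Approx-++ {F} e (c ∷ cs) {ds} (c≈ , cs≈) ds≈ = c≈ ,
      Approx-++ (suc e) cs cs≈ (subst (λ e → Approx N F e ds) (sym (+-suc (length cs) e)) ds≈)

    Approx-map : ∀ {y z l} → ℤ.+ z ≈ y ℤ.^ l [ ℤ.+ N ] → ∀ e cs → Approx N (y ℤ.^_) e cs →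
      Approx N (y ℤ.^_) (l + e) (map (z *_) cs)
    Approx-map z≈ e []       _          = tt
    Approx-map {y} {z} {l} z≈ e (c ∷ cs) (c≈ , cs≈) =
      ≈-trans (≈-reflexive (ℤ.pos-* z c))
        (≈-trans (*-cong-≈ z≈ c≈) (≈-reflexive (sym (ℤ.^-distribˡ-+-* y l e)))) ,
      subst (λ e → Approx N (y ℤ.^_) e (map (z *_) cs)) (+-suc l e)
        (Approx-map {y} {z} {l} z≈ (suc e) cs cs≈)

    Approx-zipWith : ∀ {F G H} → (∀ u → F u ℤ.+ G u ≡ H u) → ∀ e cs ds → Approx N F e cs →
      Approx N G e ds → Approx N H e (zipWith _+_ cs ds)
    Approx-zipWith F+G e []       ds       _          _          = tt
    Approx-zipWith F+G e (c ∷ cs) []       _          _          = tt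
    Approx-zipWith F+G e (c ∷ cs) (d ∷ ds) (c≈ , cs≈) (d≈ , ds≈) =
      ≈-trans (+-cong-≈ c≈ d≈) (≈-reflexive (F+G e)) , Approx-zipWith F+G (suc e) cs ds cs≈ ds≈

    Approx-replicate : ∀ {F} → (∀ u → F u ≡ ℤ.0ℤ) → ∀ e l → Approx N F e (replicate l 0)
    Approx-replicate F≡0 e zero    = tt
    Approx-replicate F≡0 e (suc l) = ≈-reflexive (sym (F≡0 e)) , Approx-replicate F≡0 (suc e) l

    module _ .{{_ : NonZero N}} (X : ℕ) where

      -- Multiplication by `1 + z Y` appends to the `l` digits a copy multiplied by `z`. Only `z` is
      -- reduced modulo `N`; the digit bound grows by a factor `N` with each doubling.
      geometric-expansion : ∀ {y} d Y z V {l b} (E : Expansion X N (y ℤ.^_) 0 l b V) → Y ≡ X ^ l → z < N →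
        ℤ.+ z ≈ y ℤ.^ l [ ℤ.+ N ] →
          Expansion X N (y ℤ.^_) 0 (2 ^ d * l) (b * N ^ d) (geometric N (squares d Y) z V)
      geometric-expansion {y} zero Y z V {l} {b} E Y≡ z<N z≈ =
        subst₂ (λ l b → Expansion X N (y ℤ.^_) 0 l b V) (sym (*-identityˡ l)) (sym (*-identityʳ b)) E
      geometric-expansion {y} (suc d) Y z V {l} {b} E Y≡ z<N z≈ =
        subst₂ (λ l b → Expansion X N (y ℤ.^_) 0 l b
          (geometric N (squares d (Y * Y)) ((z * z) rem N) (V + V * z * Y)))
          (lemma₁ (2 ^ d) l) (*-assoc b N (N ^ d))
          (geometric-expansion d (Y * Y) ((z * z) rem N) (V + V * z * Y) E′
            (trans (cong₂ _*_ Y≡ Y≡) (sym (^-distribˡ-+-* X l l))) (rem-< (z * z) N)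
            (≈-trans (rem-≈ (z * z) N)
              (≈-trans (≈-reflexive (ℤ.pos-* z z))
              (≈-trans (*-cong-≈ z≈ z≈) (≈-reflexive (sym (ℤ.^-distribˡ-+-* y l l)))))))
        where
        open Expansion E
        lemma₁ : ∀ a l → a * (l + l) ≡ 2 * a * l
        lemma₁ = solve-∀
        lemma₂ : ∀ v z Y → v + v * z * Y ≡ v + Y * (z * v)
        lemma₂ = solve-∀
        E′ : Expansion X N (y ℤ.^_) 0 (l + l) (b * N) (V + V * z * Y)
        E′ = record
          { digits  = digits ++ map (z *_) digits
          ; value≡  = trans (lemma₂ V z Y)
              (trans (cong₂ (λ v Y → v + Y * (z * v)) value≡ (trans Y≡ (cong (X ^_) (sym length≡))))
              (trans (cong (λ v → eval X digits + X ^ length digits * v)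
                (sym (eval-map X z digits))) (sym (eval-++ X digits (map (z *_) digits)))))
          ; length≡ = trans (length-++ digits)
              (cong₂ _+_ length≡ (trans (length-map (z *_) digits) length≡))
          ; approx  = Approx-++ 0 digits approx
              (subst (λ k → Approx N (y ℤ.^_) (k + 0) (map (z *_) digits)) (sym length≡)
              (Approx-map {y} {z} {l} z≈ 0 digits approx))
          ; bounded = All.++⁺ (All.map (λ c≤b → ≤-trans c≤b (m≤m*n b N)) bounded)
              (All.map⁺ (All.map (λ c≤b →
                ≤-trans (*-mono-≤ (<⇒≤ z<N) c≤b) (≤-reflexive (*-comm N b))) bounded))
          }

      dot-expansion : ∀ d e m ws → Powers N e m ws →
        Expansion X N (λ u → ℤ.+ T (2 * u) m) e (2 ^ d) (m * (N * N ^ d)) (dot ws (rows N (squares d X) m))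
      dot-expansion d e zero [] _ = record
        { digits  = replicate (2 ^ d) 0
        ; value≡  = sym (eval-replicate X (2 ^ d))
        ; length≡ = length-replicate (2 ^ d)
        ; approx  = Approx-replicate (λ _ → refl) e (2 ^ d)
        ; bounded = All.replicate⁺ (2 ^ d) z≤n
        }
      dot-expansion d e (suc m) (w ∷ ws) (w≤N , w≈ , ws≈) = record
        { digits  = zipWith _+_ (map (w *_) G.digits) E.digits
        ; value≡  = trans (cong₂ _+_ (trans (cong (w *_) G.value≡) (sym (eval-map X w G.digits)))
            E.value≡) (sym (eval-zipWith X (map (w *_) G.digits) E.digits (trans G-length (sym E.length≡))))
        ; length≡ = trans (length-zipWith _+_ (map (w *_) G.digits) E.digits)
            (trans (cong₂ _⊓_ G-length E.length≡) (⊓-idem (2 ^ d)))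
        ; approx  = Approx-zipWith next e (map (w *_) G.digits) E.digits
            (subst (λ k → Approx N (y ℤ.^_) k (map (w *_) G.digits)) (+-identityʳ e)
              (Approx-map {y} {w} {e} w≈ 0 G.digits G.approx)) E.approx
        ; bounded = zip-bounded (map (w *_) G.digits) E.digits
            (All.map⁺ (All.map (λ c≤b →
              *-mono-≤ w≤N (≤-trans c≤b (≤-reflexive (*-identityˡ (N ^ d))))) G.bounded)) E.bounded
        }
        where
        n = 2 * m + 1
        y = node m
        start : Expansion X N (y ℤ.^_) 0 1 1 1
        start = record
          { digits = 1 ∷ [] ; value≡ = sym (cong suc (*-zeroʳ X)) ; length≡ = refl ; approx =
              ≈-refl , tt ; bounded = ≤-refl ∷ [] }
        module E = Expansion (dot-expansion d e m ws ws≈)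
        module G = Expansion (geometric-expansion d X ((n * n) rem N) 1 start (sym (^-identityʳ X)) (rem-< (n * n) N)
          (≈-trans (rem-node m) (≈-reflexive (sym (ℤ.*-identityʳ y)))))
        G-length : length (map (w *_) G.digits) ≡ 2 ^ d
        G-length = trans (length-map (w *_) G.digits) (trans G.length≡ (*-identityʳ (2 ^ d)))
        next : ∀ u → y ℤ.^ u ℤ.+ ℤ.+ T (2 * u) m ≡ ℤ.+ T (2 * u) (suc m)
        next u = trans (ℤ.+-comm (y ℤ.^ u) (ℤ.+ T (2 * u) m)) (cong (ℤ._+_ (ℤ.+ T (2 * u) m))
          (trans (cong (λ z → (ℤ.+ n ℤ.* z) ℤ.^ u) (sym (ℤ.*-identityʳ (ℤ.+ n))))
            (trans (ℤ.^-*-assoc (ℤ.+ n) 2 u) (sym (pos-^ n (2 * u))))))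
        zip-bounded : ∀ cs ds → All (_≤ N * N ^ d) cs → All (_≤ m * (N * N ^ d)) ds →
          All (_≤ suc m * (N * N ^ d)) (zipWith _+_ cs ds)
        zip-bounded []       ds       _          _          = []
        zip-bounded (c ∷ cs) []       _          _          = []
        zip-bounded (c ∷ cs) (d ∷ ds) (c≤ ∷ cs≤) (d≤ ∷ ds≤) = +-mono-≤ c≤ d≤ ∷ zip-bounded cs ds cs≤ ds≤

    module _ .{{_ : NonZero N}} where

      replicate-powers : ∀ m → Powers N 0 m (replicate m 1)
      replicate-powers zero    = tt
      replicate-powers (suc m) = ℕ.>-nonZero⁻¹ N , ≈-refl , replicate-powers m

      raise-power : ∀ {y} d z l → z < N → ℤ.+ z ≈ y ℤ.^ l [ ℤ.+ N ] →
        raise N d z ≤ N × (ℤ.+ raise N d z ≈ y ℤ.^ (2 ^ d * l) [ ℤ.+ N ])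
      raise-power {y} zero    z l z<N z≈ = <⇒≤ z<N ,
        subst (λ l → ℤ.+ z ≈ y ℤ.^ l [ ℤ.+ N ]) (sym (*-identityˡ l)) z≈
      raise-power {y} (suc d) z l z<N z≈ =
        subst (λ l → r ≤ N × (ℤ.+ r ≈ y ℤ.^ l [ ℤ.+ N ])) (lemma (2 ^ d) l)
        (raise-power {y} d ((z * z) rem N) (l + l) (rem-< (z * z) N)
          (≈-trans (rem-≈ (z * z) N)
            (≈-trans (≈-reflexive (ℤ.pos-* z z))
            (≈-trans (*-cong-≈ z≈ z≈) (≈-reflexive (sym (ℤ.^-distribˡ-+-* y l l)))))))
        where
        r = raise N d ((z * z) rem N)
        lemma : ∀ a l → a * (l + l) ≡ 2 * a * l
        lemma = solve-∀

      steps-powers : ∀ d m → Powers N (2 ^ d) m (steps N d m)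
      steps-powers d zero    = tt
      steps-powers d (suc m) = proj₁ raised ,
        subst (λ l → ℤ.+ raise N d ((n * n) rem N) ≈ node m ℤ.^ l [ ℤ.+ N ]) (*-identityʳ (2 ^ d))
        (proj₂ raised) , steps-powers d m
        where
        n = 2 * m + 1
        raised = raise-power {node m} d ((n * n) rem N) 1 (rem-< (n * n) N)
          (≈-trans (rem-node m) (≈-reflexive (sym (ℤ.*-identityʳ (node m)))))

      advance-powers : ∀ e l m ws ss → Powers N e m ws → Powers N l m ss →
        Powers N (l + e) m (advance N ws ss)
      advance-powers e l zero    []       []       _ _ = tt
      advance-powers e l (suc m) (w ∷ ws) (s ∷ ss) (_ , w≈ , ws≈) (_ , s≈ , ss≈) =
        <⇒≤ (rem-< (s * w) N) ,
        ≈-trans (rem-≈ (s * w) N) (≈-trans (≈-reflexive (ℤ.pos-* s w))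
          (≈-trans (*-cong-≈ s≈ w≈) (≈-reflexive (sym (ℤ.^-distribˡ-+-* (node m) l e))))) ,
        advance-powers e l m ws ss ws≈ ss≈

    module _ .{{_ : NonZero N}} {X : ℕ} .{{_ : NonZero X}} where

      digit-rem : ∀ {c} v → c < X → (c + X * v) rem X ≡ c
      digit-rem {c} v c<X = residue-unique {X} (rem-< (c + X * v) X) c<X (≈-trans (rem-≈ (c + X * v) X)
        (by (ℤ.+ v) (trans (cong (λ z → ℤ.+ (c + z)) (*-comm X v)) (cong (ℤ._+_ (ℤ.+ c)) (ℤ.pos-* v X)))))

      digit-quo : ∀ {c} v → c < X → (c + X * v) quo X ≡ v
      digit-quo {c} v c<X = *-cancelʳ-≡ ((c + X * v) quo X) v X (+-cancelˡ-≡ c _ _ (begin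
        c + ((c + X * v) quo X) * X
          ≡⟨ cong (_+ ((c + X * v) quo X) * X) (digit-rem v c<X) ⟨
        (c + X * v) rem X + ((c + X * v) quo X) * X   ≡⟨ rem-quo (c + X * v) X ⟨
        c + X * v                                     ≡⟨ cong (c +_) (*-comm X v) ⟩
        c + v * X                                     ∎))
        where open ≡-Reasoning

      scan-complete : ∀ {F} cs f e r → f ≤ length cs → All (_< X) cs → Approx N F e cs → r ≡ 2 * e →
        ∀ i → i < f → F (i + e) ≈ ℤ.0ℤ [ ℤ.+ N ] → 2 * (i + e) ∈ scan N X f r (eval X cs)
      scan-complete {F} (c ∷ cs) (suc f) e r (s≤s f≤) (c<X ∷ cs<X) (c≈ , cs≈) r≡ zero i<f F≈0
        rewrite digit-rem (eval X cs) c<X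
              | ≡ᵇ-complete (trans (rem-cong {c} {0} N (≈-trans c≈ F≈0)) (0-rem N)) = here (sym r≡)
      scan-complete {F} (c ∷ cs) (suc f) e r (s≤s f≤) (c<X ∷ cs<X) (c≈ , cs≈) r≡ (suc i) (s≤s i<f) F≈0
        rewrite digit-rem (eval X cs) c<X | digit-quo (eval X cs) c<X =
        ∈-if (c rem N ≡ᵇ 0) (subst (λ j → 2 * j ∈ scan N X f (2 + r) (eval X cs)) (+-suc i e)
          (scan-complete {F} cs f (suc e) (2 + r) f≤ cs<X cs≈
            (trans (cong (2 +_) r≡) (sym (*-suc 2 e))) i i<f
            (subst (λ j → F j ≈ ℤ.0ℤ [ ℤ.+ N ]) (sym (+-suc i e)) F≈0)))

      -- Advancing the weights by the power `2 ^ d` shifts the represented exponents by one block,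
      -- while `f` counts the candidates left.
      blocks-complete : ∀ d m B f e ws → m * (N * N ^ d) < X → f ≤ B * 2 ^ d → Powers N e m ws →
        ∀ i → i < f →
        ℤ.+ T (2 * (i + e)) m ≈ ℤ.0ℤ [ ℤ.+ N ] →
        2 * (i + e) ∈ blocks N X (2 ^ d) B f (2 * e) ws (rows N (squares d X) m) (steps N d m)
      blocks-complete d m zero    f e ws bound f≤ ws≈ i i<f T≈0 = contradiction (≤-trans i<f f≤) λ ()
      blocks-complete d m (suc B) f e ws bound f≤ ws≈ i i<f T≈0 = go (i <? len)
        where
        len = 2 ^ d
        rs = rows N (squares d X) m
        ss = steps N d m
        E = dot-expansion X d e m ws ws≈
        go : Dec (i < len) → 2 * (i + e) ∈ blocks N X len (suc B) f (2 * e) ws rs ss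
        go (yes i<len) = ∈-++⁺ˡ (subst (λ V → 2 * (i + e) ∈ scan N X (len ⊓ f) (2 * e) V)
          (sym (Expansion.value≡ E))
          (scan-complete (Expansion.digits E) (len ⊓ f) e (2 * e)
            (≤-trans (m⊓n≤m len f) (≤-reflexive (sym (Expansion.length≡ E))))
            (All.map (λ c≤ → ≤-trans (s≤s c≤) bound) (Expansion.bounded E)) (Expansion.approx E)
              refl i (⊓-glb i<len i<f) T≈0))
        go (no i≮len) = ∈-++⁺ʳ (scan N X (len ⊓ f) (2 * e) (dot ws rs))
          (subst₂ (λ r j → j ∈ blocks N X len B (f ℕ.∸ len) r (advance N ws ss) rs ss)
            (*-distribˡ-+ 2 len e) (cong (2 *_) index)
            (blocks-complete d m B (f ℕ.∸ len) (len + e) (advance N ws ss) bound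
              (≤-trans (∸-monoˡ-≤ len f≤) (≤-reflexive (m+n∸m≡n len (B * len))))
              (advance-powers e len m ws ss ws≈ (steps-powers d m)) (i ℕ.∸ len) (∸-monoˡ-< i<f len≤i)
              (subst (λ j → ℤ.+ T (2 * j) m ≈ ℤ.0ℤ [ ℤ.+ N ]) (sym index) T≈0)))
          where
          len≤i = ≮⇒≥ i≮len
          index : i ℕ.∸ len + (len + e) ≡ i + e
          index = trans (sym (+-assoc (i ℕ.∸ len) len e)) (cong (_+ e) (m∸n+n≡m len≤i))

  -- For p ≤ 1500 the digits are at most m p ^ (2 (d + 1)) with m < 2 ^ 11 and p ^ 2 < 2 ^ 22.
  base : ℕ → ℕ
  base d = 2 ^ (22 * d + 33)

  irregular : ℕ → ℕ → List ℕ
  irregular m d = blocks N (base d) (2 ^ d) 8 m 0 (replicate m 1) (rows N (squares d (base d)) m)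
    (steps N d m)
    where N = (2 * m + 1) * (2 * m + 1)

  -- The two ways in which the block search could miss a residue, tested on the actual numbers:
  -- eight blocks too short for the `m` candidates, or digits so large that they carry.
  adequate : ℕ → ℕ → Bool
  adequate m d = (m ≤ᵇ 8 * 2 ^ d) ∧ (m * (N * N ^ d) <ᵇ base d)
    where N = (2 * m + 1) * (2 * m + 1)

  irregular-complete : ∀ m d → adequate m d ≡ true → ∀ h → suc h < m →
    ℤ.+ T (2 * suc h) m ≈ ℤ.0ℤ [ ℤ.+ ((2 * m + 1) * (2 * m + 1)) ] → 2 * suc h ∈ irregular m d
  irregular-complete m d ok h h<m T≈0 = subst (λ j → 2 * j ∈ irregular m d) (+-identityʳ (suc h))
    (blocks-complete {N} {base d} d m 8 m 0 (replicate m 1) bound m≤ (replicate-powers m) (suc h) h<m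
      (subst (λ j → ℤ.+ T (2 * j) m ≈ ℤ.0ℤ [ ℤ.+ N ]) (sym (+-identityʳ (suc h))) T≈0))
    where
    n = 2 * m + 1
    N = n * n
    instance
      X≢0 : NonZero (base d)
      X≢0 = m^n≢0 2 (22 * d + 33)
      n≢0 : NonZero n
      n≢0 = >-nonZero (m≤n+m 1 (2 * m))
      N≢0 : NonZero N
      N≢0 = m*n≢0 n n
    m≤ : m ≤ 8 * 2 ^ d
    m≤ = ≤ᵇ⇒≤ m (8 * 2 ^ d) (subst Data.Bool.T (sym (∧-conicalˡ (m ≤ᵇ 8 * 2 ^ d) _ ok)) tt)
    bound : m * (N * N ^ d) < base d
    bound = <ᵇ⇒< (m * (N * N ^ d)) (base d) (subst Data.Bool.T (sym (∧-conicalʳ (m ≤ᵇ 8 * 2 ^ d) _ ok)) tt)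

-- Sieving the exponents for small a, and the remaining exclusions

module Sieve where

  open import Defs using (T; RegularPrime)
  open Congruence
  open PowerSums
  open PrimeModulus
  open Bernoulli using (Vanishes⇒∣U)
  open Irregularity
  open ModularTest
  open BlockSearch
  open import Data.Bool using (Bool; true; false; not; _∧_; if_then_else_)
  open import Data.Bool.Properties using (∧-conicalˡ; ∧-conicalʳ; T?)
  open import Data.List using (List; []; _∷_; filter; cartesianProductWith; upTo; null)
  open import Data.List.Membership.Propositional using (_∈_)
  open import Data.List.Membership.Propositional.Properties using (∈-filter⁺; ∈-cartesianProductWith⁺; ∈-upTo⁺)
  open import Data.Nat as ℕ using (ℕ; zero; suc; z≤n; s≤s; NonZero; >-nonZero; n>1⇒nonTrivial; _+_; _*_; _^_; _≤_; _<_; _%_; _/_; _≡ᵇ_; _≤ᵇ_; _<ᵇ_)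
  open import Data.Nat.Properties
  open import Data.Nat.Coprimality using (Coprime)
  open import Data.Nat.Divisibility
  open import Data.Nat.DivMod using (m≡m%n+[m/n]*n; m%n<n; [m+kn]%n≡m%n; %-congˡ)
  open import Data.Nat.Primality
  open import Data.Nat.Tactic.RingSolver using (solve-∀)
  import Data.Integer as ℤ
  import Data.Integer.Properties as ℤ
  import Data.Integer.Tactic.RingSolver as ℤSolver
  open import Data.Product using (_×_; _,_; proj₁; proj₂)
  open import Data.Unit using (tt)
  open import Relation.Nullary
  open import Relation.Binary.PropositionalEquality

  least : ℕ → ℕ → ℕ → ℕ
  least zero    d n = d
  least (suc f) d n = if n rem d ≡ᵇ 0 then d else least f (suc d) n

  least-rough : ∀ f d n → 2 ≤ d → d Rough n → 2 ≤ least f d n × (least f d n Rough n)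
  least-rough zero    d n 2≤d rough = 2≤d , rough
  least-rough (suc f) d n 2≤d rough with n rem d ≡ᵇ 0 in n%d
  ... | true  = 2≤d , rough
  ... | false = least-rough f (suc d) n (m≤n⇒m≤1+n 2≤d) (∤⇒rough-suc d∤n rough)
    where
    instance
      d≢0 : NonZero d
      d≢0 = >-nonZero (≤-trans (s≤s z≤n) 2≤d)
    d∤n : ¬ d ∣ n
    d∤n d∣n = contradiction (trans (sym n%d)
      (≡ᵇ-complete (trans (rem-cong d (∣⇒≈0 {d} {ℤ.+ n} d∣n)) (0-rem d)))) λ ()

  rem≡0⇒∣ : ∀ {m n} → m rem n ≡ 0 → n ∣ m
  rem≡0⇒∣ {m} {n} eq = divides (m quo n) (trans (rem-quo m n) (cong (_+ (m quo n) * n) eq))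

  -- The search keeps `n` free of smaller divisors, and a divisor of a number that rough is prime. A
  -- search that runs out of fuel is covered by the hypothesis, which is tested at each use.
  least-prime : ∀ n → least n 2 n ∣ n → Prime (least n 2 n)
  least-prime n p∣n = rough∧∣⇒prime {{n>1⇒nonTrivial (proj₁ spec)}} (proj₂ spec) p∣n
    where spec = least-rough n 2 n ≤-refl 2-rough

  oddPrime : ℕ → Bool
  oddPrime q = (least q 2 q ≡ᵇ q) ∧ (q rem 2 ≡ᵇ 1)

  oddPrime-sound : ∀ q → oddPrime q ≡ true → Prime q × ¬ 2 ∣ q
  oddPrime-sound q ok = subst Prime least≡ (least-prime q (∣-reflexive least≡)) , λ 2∣q →
    contradiction (trans (sym (≡ᵇ-sound (∧-conicalʳ (least q 2 q ≡ᵇ q) _ ok)))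
      (rem-cong 2 (∣⇒≈0 {2} {ℤ.+ q} 2∣q))) λ ()
    where
    least≡ : least q 2 q ≡ q
    least≡ = ≡ᵇ-sound (∧-conicalˡ (least q 2 q ≡ᵇ q) _ ok)

  lift : ℕ → ℕ → List ℕ → List ℕ
  lift M d L = cartesianProductWith (λ t i → t + i * M) L (upTo d)

  refine : ℕ → ℕ → List ℕ → List ℕ
  refine a q = filter (λ t → T? (not (kill a q (t rem (q ℕ.∸ 1)))))

  -- The residues in L modulo M are the exponents still to be excluded.  An
  -- entry (d , q) passes to the modulus M d, a multiple of q - 1, and discards
  -- the residues excluded by the prime q.
  sieve : ℕ → ℕ → List ℕ → List (ℕ × ℕ) → Bool
  sieve a M L []             = null L
  sieve a M L ((d , q) ∷ qs) =
    oddPrime q ∧ ((0 <ᵇ d) ∧ (((M * d) rem (q ℕ.∸ 1) ≡ᵇ 0) ∧ sieve a (M * d) (refine a q (lift M d L)) qs))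

  kill-or : ∀ {a} → 1 ≤ a → ∀ q → Prime q → ¬ 2 ∣ q → ∀ h t z → 2 * suc h ≡ t + z * (q ℕ.∸ 1) →
    kill a q (t rem (q ℕ.∸ 1)) ≡ true → Excluded a (2 * suc h)
  kill-or 1≤a zero          p-prime p-odd h t z k≡ killed = contradiction p-prime ¬prime[0]
  kill-or 1≤a (suc zero)    p-prime p-odd h t z k≡ killed = contradiction p-prime ¬prime[1]
  kill-or 1≤a (suc (suc q)) p-prime p-odd h t z k≡ killed =
    kill-sound 1≤a p-prime p-odd (t % suc q) killed h (trans (%-congˡ k≡) ([m+kn]%n≡m%n t z (suc q)))

  sieve-sound : ∀ {a} → 1 ≤ a → ∀ M L qs → sieve a M L qs ≡ true →
    ∀ h t z → t ∈ L → 2 * suc h ≡ t + z * M → Excluded a (2 * suc h)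
  sieve-sound 1≤a M []      []             ok h t z () k≡
  sieve-sound 1≤a M (_ ∷ _) []             () h t z t∈L k≡
  sieve-sound {a} 1≤a M L   ((d , q) ∷ qs) ok h t z t∈L k≡ = go (kill a q (t′ rem (q ℕ.∸ 1))) refl
    where
    q-ok = oddPrime-sound q (∧-conicalˡ (oddPrime q) _ ok)
    ok₁ = ∧-conicalʳ (oddPrime q) _ ok
    ok₂ = ∧-conicalʳ (0 <ᵇ d) _ ok₁
    instance
      d≢0 : NonZero d
      d≢0 = >-nonZero (<ᵇ⇒< 0 d (subst Data.Bool.T (sym (∧-conicalˡ (0 <ᵇ d) _ ok₁)) tt))
    q-1∣Md : q ℕ.∸ 1 ∣ M * d
    q-1∣Md = rem≡0⇒∣ (≡ᵇ-sound (∧-conicalˡ ((M * d) rem (q ℕ.∸ 1) ≡ᵇ 0) _ ok₂))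
    rest = ∧-conicalʳ ((M * d) rem (q ℕ.∸ 1) ≡ᵇ 0) _ ok₂
    -- Among the `d` lifts of `t` to the modulus `M * d`, the exponent lies in the one given by `z`
    -- modulo `d`.
    t′ = t + z % d * M
    lemma : ∀ t i M y d → t + (i + y * d) * M ≡ t + i * M + y * (M * d)
    lemma = solve-∀
    k≡′ : 2 * suc h ≡ t′ + z / d * (M * d)
    k≡′ = trans k≡ (trans (cong (λ z → t + z * M) (m≡m%n+[m/n]*n z d)) (lemma t (z % d) M (z / d) d))
    lifted : t′ ∈ lift M d L
    lifted = ∈-cartesianProductWith⁺ (λ t i → t + i * M) t∈L (∈-upTo⁺ (m%n<n z d))
    go : ∀ b → kill a q (t′ rem (q ℕ.∸ 1)) ≡ b → Excluded a (2 * suc h)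
    go true  killed = kill-or 1≤a q (proj₁ q-ok) (proj₂ q-ok) h t′ (z / d * quotient q-1∣Md)
      (trans k≡′ (cong (t′ +_) (trans (cong (z / d *_) (_∣_.equality q-1∣Md))
        (sym (*-assoc (z / d) (quotient q-1∣Md) (q ℕ.∸ 1)))))) killed
    go false alive  = sieve-sound 1≤a (M * d) (refine a q (lift M d L)) qs rest h t′ (z / d)
      (∈-filter⁺ (λ t → T? (not (kill a q (t rem (q ℕ.∸ 1))))) lifted
        (subst (λ b → Data.Bool.T (not b)) (sym alive) tt)) k≡′

  -- The binary logarithm rounded up; ten steps suffice below 1024, and `m ≤ 749` here. Since eight
  -- blocks are searched, `check′` takes 3 less as the logarithm of the block length.
  depth : ℕ → ℕ → ℕ
  depth zero    m = 0
  depth (suc f) m = if m ≤ᵇ 1 then 0 else suc (depth f (suc m quo 2))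

  prime-divides-solution : ∀ {a m k p} → Prime p → p ∣ a → a * T k m ≡ (2 * m + 1) ^ k → p ∣ 2 * m + 1
  prime-divides-solution {a} {m} {k} {p} p-prime p∣a solution with p ∣? 2 * m + 1
  ... | yes p∣n = p∣n
  ... | no p∤n  = contradiction (subst (p ∣_) solution (∣m⇒∣m*n (T k m) p∣a)) (∤-^ p-prime k p∤n)

  -- Sieving data for the odd a ≤ 1500 whose least prime factor p is irregular, starting
  -- from the modulus p - 1; found by a greedy search.
  certificates : List (ℕ × List (ℕ × ℕ))
  certificates =
      (37 , (1 , 13) ∷ [])
    ∷ (59 , (3 , 7) ∷ (2 , 13) ∷ (1 , 349) ∷ [])
    ∷ (67 , (2 , 13) ∷ [])
    ∷ (101 , (3 , 7) ∷ (2 , 41) ∷ (1 , 601) ∷ (2 , 241) ∷ (1 , 401) ∷ [])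
    ∷ (103 , (2 , 5) ∷ (7 , 29) ∷ (1 , 43) ∷ (1 , 239) ∷ (1 , 1429) ∷ [])
    ∷ (131 , (2 , 5) ∷ (2 , 41) ∷ (1 , 521) ∷ [])
    ∷ (149 , (5 , 11) ∷ (3 , 13) ∷ (1 , 61) ∷ [])
    ∷ (157 , (1 , 5) ∷ [])
    ∷ (233 , (1 , 59) ∷ [])
    ∷ (257 , (1 , 17) ∷ [])
    ∷ (263 , (2 , 5) ∷ (15 , 31) ∷ (1 , 61) ∷ (1 , 787) ∷ (1 , 2621) ∷ (1 , 3931) ∷ [])
    ∷ (271 , (1 , 11) ∷ [])
    ∷ (283 , (1 , 7) ∷ [])
    ∷ (293 , (5 , 11) ∷ (2 , 41) ∷ (3 , 61) ∷ (1 , 1753) ∷ [])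
    ∷ (307 , (1 , 103) ∷ [])
    ∷ (311 , (1 , 11) ∷ [])
    ∷ (347 , (2 , 5) ∷ (5 , 11) ∷ (3 , 61) ∷ (1 , 1039) ∷ [])
    ∷ (353 , (1 , 5) ∷ (3 , 13) ∷ (3 , 37) ∷ (1 , 73) ∷ [])
    ∷ (379 , (1 , 43) ∷ (1 , 127) ∷ [])
    ∷ (389 , (4 , 17) ∷ (1 , 1553) ∷ [])
    ∷ (401 , (1 , 5) ∷ [])
    ∷ (409 , (3 , 19) ∷ (1 , 37) ∷ [])
    ∷ (421 , (2 , 41) ∷ (1 , 281) ∷ [])
    ∷ (433 , (1 , 5) ∷ [])
    ∷ (461 , (1 , 47) ∷ [])
    ∷ (463 , (2 , 13) ∷ [])
    ∷ (467 , (2 , 5) ∷ (3 , 7) ∷ (4 , 17) ∷ (3 , 37) ∷ (1 , 73) ∷ (1 , 1399) ∷ (1 , 8389) ∷ [])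
    ∷ (491 , (1 , 11) ∷ [])
    ∷ (523 , (2 , 5) ∷ (1 , 37) ∷ [])
    ∷ (541 , (1 , 5) ∷ [])
    ∷ (547 , (2 , 5) ∷ (1 , 157) ∷ [])
    ∷ (557 , (1 , 5) ∷ [])
    ∷ (577 , (1 , 37) ∷ [])
    ∷ (587 , (2 , 5) ∷ (3 , 13) ∷ (1 , 1759) ∷ [])
    ∷ (593 , (1 , 5) ∷ [])
    ∷ (607 , (2 , 5) ∷ (4 , 17) ∷ (2 , 97) ∷ [])
    ∷ (613 , (1 , 5) ∷ [])
    ∷ (617 , (1 , 5) ∷ (1 , 29) ∷ [])
    ∷ (619 , (1 , 7) ∷ [])
    ∷ (631 , (1 , 7) ∷ (1 , 71) ∷ [])
    ∷ (647 , (2 , 5) ∷ (5 , 11) ∷ (2 , 41) ∷ (1 , 191) ∷ (1 , 137) ∷ [])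
    ∷ (653 , (4 , 17) ∷ (9 , 37) ∷ (1 , 19) ∷ (1 , 73) ∷ (1 , 2609) ∷ (1 , 5869) ∷ (1 , 23473) ∷ [])
    ∷ (659 , (2 , 29) ∷ (4 , 17) ∷ (1 , 113) ∷ (1 , 2633) ∷ [])
    ∷ (673 , (1 , 5) ∷ (1 , 17) ∷ [])
    ∷ (677 , (3 , 13) ∷ (1 , 79) ∷ [])
    ∷ (683 , (2 , 5) ∷ (3 , 67) ∷ (1 , 373) ∷ (1 , 4093) ∷ [])
    ∷ (691 , (1 , 7) ∷ (1 , 31) ∷ [])
    ∷ (727 , (1 , 23) ∷ [])
    ∷ (751 , (1 , 251) ∷ [])
    ∷ (757 , (1 , 5) ∷ [])
    ∷ (761 , (1 , 41) ∷ [])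
    ∷ (773 , (3 , 13) ∷ (4 , 17) ∷ (2 , 97) ∷ (1 , 3089) ∷ [])
    ∷ (797 , (9 , 37) ∷ (1 , 3583) ∷ [])
    ∷ (809 , (5 , 11) ∷ (1 , 41) ∷ [])
    ∷ (811 , (1 , 19) ∷ [])
    ∷ (821 , (1 , 11) ∷ [])
    ∷ (827 , (2 , 5) ∷ (3 , 13) ∷ (1 , 4957) ∷ [])
    ∷ (839 , (14 , 29) ∷ (5 , 11) ∷ (2 , 41) ∷ (1 , 281) ∷ (3 , 61) ∷ (3 , 37) ∷ (1 , 71) ∷ (2 , 241)
            ∷ (1 , 73) ∷ (1 , 181) ∷ (1 , 20113) ∷ [])
    ∷ (877 , (1 , 13) ∷ [])
    ∷ (881 , (1 , 5) ∷ [])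
    ∷ (887 , (2 , 5) ∷ (5 , 11) ∷ (3 , 7) ∷ (1 , 61) ∷ (1 , 2659) ∷ [])
    ∷ (929 , (1 , 17) ∷ [])
    ∷ (953 , (1 , 137) ∷ [])
    ∷ (971 , (2 , 5) ∷ (4 , 17) ∷ (1 , 1553) ∷ [])
    ∷ (1061 , (1 , 5) ∷ [])
    ∷ (1091 , (2 , 5) ∷ (4 , 17) ∷ (1 , 41) ∷ [])
    ∷ (1117 , (1 , 5) ∷ [])
    ∷ (1129 , (1 , 283) ∷ [])
    ∷ (1151 , (1 , 11) ∷ [])
    ∷ (1153 , (1 , 5) ∷ [])
    ∷ (1193 , (1 , 5) ∷ [])
    ∷ (1201 , (1 , 17) ∷ [])
    ∷ (1217 , (1 , 5) ∷ (3 , 13) ∷ (1 , 97) ∷ [])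
    ∷ (1229 , (4 , 17) ∷ (7 , 29) ∷ (1 , 113) ∷ (1 , 8597) ∷ [])
    ∷ (1237 , (1 , 5) ∷ [])
    ∷ (1279 , (1 , 7) ∷ [])
    ∷ (1283 , (2 , 5) ∷ (5 , 11) ∷ (1 , 12821) ∷ [])
    ∷ (1291 , (1 , 7) ∷ [])
    ∷ (1297 , (1 , 5) ∷ (1 , 17) ∷ [])
    ∷ (1301 , (1 , 53) ∷ [])
    ∷ (1307 , (2 , 5) ∷ (4 , 17) ∷ (3 , 7) ∷ (2 , 97) ∷ (1 , 3919) ∷ [])
    ∷ (1319 , (3 , 7) ∷ (2 , 13) ∷ (5 , 31) ∷ (1 , 61) ∷ (2 , 41) ∷ (2 , 17) ∷ (1 , 52721) ∷ [])
    ∷ (1327 , (2 , 13) ∷ [])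
    ∷ (1367 , (2 , 5) ∷ (3 , 13) ∷ (1 , 4099) ∷ [])
    ∷ (1369 , (4 , 17) ∷ (1 , 73) ∷ (2 , 97) ∷ [])
    ∷ (1381 , (1 , 5) ∷ [])
    ∷ (1409 , (1 , 23) ∷ [])
    ∷ (1429 , (1 , 239) ∷ [])
    ∷ (1439 , (5 , 11) ∷ (9 , 19) ∷ (1 , 31) ∷ (2 , 13) ∷ (1 , 37) ∷ (1 , 61) ∷ (2 , 41) ∷ (1 , 181)
            ∷ (1 , 73) ∷ (7 , 29) ∷ (1 , 43) ∷ (1 , 71) ∷ (1 , 421) ∷ (1 , 211) ∷ (1 , 281)
            ∷ (1 , 60397) ∷ [])
    ∷ (1483 , (2 , 13) ∷ [])
    ∷ (1499 , (3 , 7) ∷ (1 , 43) ∷ (5 , 11) ∷ (1 , 31) ∷ (1 , 71) ∷ (1 , 211) ∷ [])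
    ∷ []

  -- With the default `[]` the sieve succeeds only if there is no residue to remove, so an `a`
  -- without a certificate passes only when its least prime factor admits no candidate `r`.
  lookup : List (ℕ × List (ℕ × ℕ)) → ℕ → List (ℕ × ℕ)
  lookup []              a = []
  lookup ((b , qs) ∷ bs) a = if a ≡ᵇ b then qs else lookup bs a

  checkWith : ℕ → ℕ → ℕ → ℕ → Bool
  checkWith a p m d = (2 * m + 1 ≡ᵇ p) ∧
    ((0 <ᵇ m) ∧ ((a rem p ≡ᵇ 0) ∧ (adequate m d ∧ sieve a (2 * m) (irregular m d) (lookup certificates a))))

  check′ : ℕ → ℕ → ℕ → Bool
  check′ a p m = checkWith a p m (depth 10 m ℕ.∸ 3)

  check : ℕ → Bool
  check a = check′ a (least a 2 a) (least a 2 a quo 2)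

  checkWith-sound : ∀ {a} → 1 ≤ a → ∀ p m d → (p ∣ a → Prime p) → checkWith a p m d ≡ true → ∀ h →
    Excluded a (2 * suc h)
  checkWith-sound {a} 1≤a p m d p-prime ok h m′ 1<m′ solution =
    sieve-sound 1≤a (2 * m) (irregular m d) (lookup certificates a) ok₅
      h (2 * suc h′) (k / (2 * m)) member
        (trans (m≡m%n+[m/n]*n k (2 * m)) (cong (_+ k / (2 * m) * (2 * m)) (proj₁ (proj₂ irr)))) m′
        1<m′ solution
    where
    k = 2 * suc h
    ok₂ = ∧-conicalʳ (2 * m + 1 ≡ᵇ p) _ ok
    ok₃ = ∧-conicalʳ (0 <ᵇ m) _ ok₂
    ok₄ = ∧-conicalʳ (a rem p ≡ᵇ 0) _ ok₃
    ok₅ = ∧-conicalʳ (adequate m d) _ ok₄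
    instance
      m≢0 : NonZero m
      m≢0 = >-nonZero (<ᵇ⇒< 0 m (subst Data.Bool.T (sym (∧-conicalˡ (0 <ᵇ m) _ ok₂)) tt))
      2m≢0 : NonZero (2 * m)
      2m≢0 = m*n≢0 2 m
    p≡ : p ≡ suc (2 * m)
    p≡ = trans (sym (≡ᵇ-sound (∧-conicalˡ (2 * m + 1 ≡ᵇ p) _ ok))) (+-comm (2 * m) 1)
    p∣a : p ∣ a
    p∣a = rem≡0⇒∣ (≡ᵇ-sound (∧-conicalˡ (a rem p ≡ᵇ 0) _ ok₃))
    prime′ : Prime (suc (2 * m))
    prime′ = subst Prime p≡ (p-prime p∣a)
    odd′ : ¬ 2 ∣ suc (2 * m)
    odd′ 2∣p = contradiction (∣1⇒≡1 (∣m+n∣m⇒∣n (subst (2 ∣_) (+-comm 1 (2 * m)) 2∣p) (m∣m*n m))) λ ()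
    irr = irregularity {a} {m′} {h} 1≤a 1<m′ solution prime′ odd′
      (subst (_∣ 2 * m′ + 1) p≡ (prime-divides-solution {a} {m′} {k} (p-prime p∣a) p∣a solution))
    h′ = proj₁ irr
    member : 2 * suc h′ ∈ irregular m d
    member = irregular-complete m d (∧-conicalˡ (adequate m d) _ ok₄) h′
      (*-cancelˡ-< 2 (suc h′) m (proj₁ (proj₂ (proj₂ irr))))
      (subst (λ p → ℤ.+ T (2 * suc h′) m ≈ ℤ.0ℤ [ ℤ.+ (p * p) ]) (+-comm 1 (2 * m))
        (vanishing-T prime′ odd′ {m₀ = m} (s≤s (proj₁ (proj₂ (proj₂ irr)))) (+-comm (2 * m) 1)
          (proj₂ (proj₂ (proj₂ irr)))))

  check-sound : ∀ {a} → 1 ≤ a → check a ≡ true → ∀ h → Excluded a (2 * suc h)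
  check-sound {a} 1≤a ok = checkWith-sound 1≤a (least a 2 a) (least a 2 a quo 2)
    (depth 10 (least a 2 a quo 2) ℕ.∸ 3) (least-prime a) ok

  checkFrom : ℕ → ℕ → Bool
  checkFrom zero    a = true
  checkFrom (suc f) a = check a ∧ checkFrom f (2 + a)

  checkFrom-sound : ∀ f a → checkFrom f a ≡ true → ∀ i → i < f → check (2 * i + a) ≡ true
  checkFrom-sound (suc f) a ok zero    _         = ∧-conicalˡ (check a) _ ok
  checkFrom-sound (suc f) a ok (suc i) (s≤s i<f) =
    subst (λ b → check b ≡ true) (lemma i a) (checkFrom-sound f (2 + a) (∧-conicalʳ (check a) _ ok) i i<f)
    where
    lemma : ∀ i a → 2 * i + (2 + a) ≡ 2 * suc i + a
    lemma = solve-∀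

  neg-^-odd : ∀ h x → (ℤ.- x) ℤ.^ suc (2 * h) ≡ ℤ.- (x ℤ.^ suc (2 * h))
  neg-^-odd h x = trans (cong (ℤ._*_ (ℤ.- x)) (neg-^-even h x)) (sym (ℤ.neg-distribˡ-* x (x ℤ.^ (2 * h))))

  -- Reversing the sum sends `2 i + 1` to `2 m - (2 i + 1)`, so for odd exponents the sum is its own
  -- negative modulo `2 m`. Working modulo `2 m` instead of `m` allows the resulting factor 2 to be
  -- cancelled.
  m∣T-odd : ∀ h m → m ∣ T (suc (2 * h)) m
  m∣T-odd h m = ≈0⇒∣ {m} {ℤ.+ T k m} (cancel-modulus 2 {ℤ.+ T k m} {ℤ.+ m} (begin
    ℤ.+ 2 ℤ.* t                                            ≡⟨ lemma₁ t ⟩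
    t ℤ.+ t                                                ≈⟨ +-congˡ-≈ t T≈-T ⟩
    t ℤ.- t                                                ≡⟨ ℤ.+-inverseʳ t ⟩
    ℤ.0ℤ                                                   ∎))
    where
    open ≈-Reasoning (ℤ.+ 2 ℤ.* ℤ.+ m)
    k = suc (2 * h)
    t = ℤ.+ T k m
    lemma₁ : ∀ t → ℤ.+ 2 ℤ.* t ≡ t ℤ.+ t
    lemma₁ = ℤSolver.solve-∀
    lemma₂ : ∀ a i → ℤ.+ 2 ℤ.* a ℤ.+ ℤ.1ℤ ≡ ℤ.- (ℤ.+ 2 ℤ.* i ℤ.+ ℤ.1ℤ) ℤ.+ ℤ.1ℤ ℤ.*
      (ℤ.+ 2 ℤ.* (a ℤ.+ (ℤ.1ℤ ℤ.+ i)))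
    lemma₂ = ℤSolver.solve-∀
    lemma₃ : ∀ x → ℤ.- x ≡ ℤ.- ℤ.1ℤ ℤ.* x
    lemma₃ = ℤSolver.solve-∀
    x : ℕ → ℤ.ℤ
    x i = ℤ.+ (2 * i + 1)
    x≡ : ∀ i → x i ≡ ℤ.+ 2 ℤ.* ℤ.+ i ℤ.+ ℤ.1ℤ
    x≡ i = cong (ℤ._+ ℤ.1ℤ) (ℤ.pos-* 2 i)
    reflected : ∀ i → i < m → x (m ℕ.∸ suc i) ≈ ℤ.- x i [ ℤ.+ 2 ℤ.* ℤ.+ m ]
    reflected i i<m = by ℤ.1ℤ (trans (x≡ (m ℕ.∸ suc i)) (trans (lemma₂ (ℤ.+ (m ℕ.∸ suc i)) (ℤ.+ i))
      (cong₂ (λ y n → ℤ.- y ℤ.+ ℤ.1ℤ ℤ.* (ℤ.+ 2 ℤ.* ℤ.+ n)) (sym (x≡ i)) (m∸n+n≡m i<m))))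
    T≈-T : t ≈ ℤ.- t [ ℤ.+ 2 ℤ.* ℤ.+ m ]
    T≈-T = begin
      t                                           ≡⟨ trans (T-sum k m) (sum-reverse m (λ i → x i ℤ.^ k)) ⟩
      sum m (λ i → x (m ℕ.∸ suc i) ℤ.^ k)         ≈⟨ sum-cong-≈ m (λ i i<m → ^-cong-≈ k (reflected i i<m)) ⟩
      sum m (λ i → (ℤ.- x i) ℤ.^ k)
        ≡⟨ sum-cong m (λ i _ → trans (neg-^-odd h (x i)) (lemma₃ (x i ℤ.^ k))) ⟩
      sum m (λ i → ℤ.- ℤ.1ℤ ℤ.* x i ℤ.^ k)        ≡⟨ sum-*ˡ m (ℤ.- ℤ.1ℤ) (λ i → x i ℤ.^ k) ⟩
      ℤ.- ℤ.1ℤ ℤ.* sum m (λ i → x i ℤ.^ k)        ≡⟨ cong (ℤ._*_ (ℤ.- ℤ.1ℤ)) (T-sum k m) ⟨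
      ℤ.- ℤ.1ℤ ℤ.* t                              ≡⟨ lemma₃ t ⟨
      ℤ.- t                                       ∎

  odd-exponent-excluded : ∀ a h → Excluded a (suc (2 * h))
  odd-exponent-excluded a h m 1<m solution =
    contradiction 1<m (≤⇒≯ (≤-reflexive (powers k (m∣n^k , ∣-refl))))
    where
    k = suc (2 * h)
    n⊥m : Coprime (2 * m + 1) m
    n⊥m (i∣n , i∣m) = ∣1⇒≡1 (∣m+n∣m⇒∣n i∣n (∣n⇒∣m*n 2 i∣m))
    powers : ∀ k → Coprime ((2 * m + 1) ^ k) m
    powers zero    (i∣1 , _) = ∣1⇒≡1 i∣1
    powers (suc k) = coprime-* {2 * m + 1} n⊥m (powers k)
    m∣n^k : m ∣ (2 * m + 1) ^ k
    m∣n^k = subst (m ∣_) solution (∣n⇒∣m*n a (m∣T-odd h m))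

  -- `2 * m + 1` and all its powers are odd.
  even-excluded : ∀ {a} → 2 ∣ a → ∀ k → Excluded a k
  even-excluded {a} 2∣a k m 1<m solution =
    contradiction (∣1⇒≡1 (∣m+n∣m⇒∣n (prime-divides-solution {a} {m} {k} prime[2] 2∣a solution)
    (m∣m*n m))) λ ()

  regular-excluded : ∀ {a p} → 1 ≤ a → RegularPrime p → p ∣ a → ∀ h → Excluded a (2 * suc h)
  regular-excluded {p = zero}        1≤a (p-prime , _) p∣a h = contradiction p-prime ¬prime[0]
  regular-excluded {p = suc zero}    1≤a (p-prime , _) p∣a h = contradiction p-prime ¬prime[1]
  regular-excluded {a} {suc (suc q)} 1≤a (p-prime , p-odd , regular) p∣a h m 1<m solution =
    regular (2 * suc h′) (m∣m*n (suc h′)) r≤ (Vanishes⇒∣U p-prime (s≤s r<q) (proj₂ (proj₂ (proj₂ irr))))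
    where
    irr = irregularity {a} {m} {h} 1≤a 1<m solution p-prime p-odd
      (prime-divides-solution {a} {m} {2 * suc h} p-prime p∣a solution)
    h′ = proj₁ irr
    r<q : 2 * suc h′ < suc q
    r<q = proj₁ (proj₂ (proj₂ irr))
    r≤ : 2 * suc h′ ≤ suc (suc q) ℕ.∸ 3
    -- Both `r` and `p - 1` are even, so `r < p - 1` sharpens to `r ≤ p - 3`, the range in the
    -- definition of regularity.
    r≤ with odd⇒2∣pred p-odd
    ... | divides j 1+q≡ = ∸-monoˡ-≤ 2 (begin
      2 + 2 * suc h′  ≡⟨ *-suc 2 (suc h′) ⟨
      2 * suc (suc h′) ≤⟨ *-monoʳ-≤ 2
        (*-cancelˡ-< 2 (suc h′) j (subst (2 * suc h′ <_) (trans 1+q≡ (*-comm j 2)) r<q)) ⟩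
      2 * j           ≡⟨ trans (*-comm 2 j) (sym 1+q≡) ⟩
      suc q           ∎)
      where open ≤-Reasoning

-- Assembling the cases of the theorem

open import Defs
open import Data.Bool using (true)
open import Data.Nat using (ℕ; zero; suc; z≤n; s≤s; s≤s⁻¹; _*_; _+_; _^_; _≤_; _<_)
open import Data.Nat.Divisibility using (_∣_; m∣m*n)
open import Data.Nat.Properties using (+-comm; *-suc; *-cancelˡ-<; m≤n⇒m≤o+n)
open import Data.Product using (_×_; ∃; _,_)
open import Data.Sum using (_⊎_; inj₁; inj₂)
open import Relation.Binary.PropositionalEquality
open import Relation.Nullary using (¬_; contradiction)
open ModularTest using (Excluded)
open Sieve using (check; checkFrom; check-sound; checkFrom-sound; even-excluded; odd-exponent-excluded; regular-excluded)

-- The 749 odd numbers from 3 to 1499, settled by evaluation.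
all-checked : checkFrom 749 3 ≡ true
all-checked = refl

parity : ∀ n → ∃ λ j → n ≡ 2 * j ⊎ n ≡ suc (2 * j)
parity zero = 0 , inj₁ refl
parity (suc n) with parity n
... | j , inj₁ n≡ = j , inj₂ (cong suc n≡)
... | j , inj₂ n≡ = suc j , inj₁ (trans (cong suc n≡) (sym (*-suc 2 j)))

small-odd-excluded : ∀ i → i < 749 → ∀ h → Excluded (2 * i + 3) (2 * suc h)
small-odd-excluded i i<749 =
  check-sound (m≤n⇒m≤o+n (2 * i) (s≤s z≤n)) (checkFrom-sound 749 3 all-checked i i<749)

small-excluded : ∀ {a} → 2 ≤ a → a ≤ 1500 → ∀ h → Excluded a (2 * suc h)
small-excluded {a} 2≤a a≤1500 h with parity a
... | j     , inj₁ refl = even-excluded (m∣m*n j) (2 * suc h)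
... | zero  , inj₂ refl = contradiction 2≤a λ { (s≤s ()) }
... | suc i , inj₂ refl = subst (λ a → Excluded a (2 * suc h)) a≡ (small-odd-excluded i i<749 h)
  where
  a≡ : 2 * i + 3 ≡ suc (2 * suc i)
  a≡ = trans (+-comm (2 * i) 3) (cong suc (sym (*-suc 2 i)))
  i<749 : i < 749
  i<749 = *-cancelˡ-< 2 i 749 (s≤s⁻¹ (s≤s⁻¹ (subst (_≤ 1500) (cong suc (*-suc 2 i)) a≤1500)))

even-exponent-excluded : ∀ {a} → 1 ≤ a → (2 ∣ a ⊎ ∃ (λ p → RegularPrime p × p ∣ a) ⊎ (2 ≤ a × a ≤ 1500)) →
  ∀ h → Excluded a (2 * suc h)
even-exponent-excluded 1≤a (inj₁ 2∣a) h = even-excluded 2∣a (2 * suc h)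
even-exponent-excluded 1≤a (inj₂ (inj₁ (p , regular , p∣a))) h = regular-excluded 1≤a regular p∣a h
even-exponent-excluded 1≤a (inj₂ (inj₂ (2≤a , a≤1500))) h = small-excluded 2≤a a≤1500 h

theorem1 : (a : ℕ) → 1 ≤ a →
    (2 ∣ a ⊎ ∃ (λ p → RegularPrime p × p ∣ a) ⊎ (2 ≤ a × a ≤ 1500)) →
    (m k : ℕ) → 1 < m → 1 ≤ k → ¬ (a * T k m ≡ (2 * m + 1) ^ k)
theorem1 a 1≤a condition m k 1<m 1≤k with parity k
... | zero  , inj₁ refl = contradiction 1≤k λ ()
... | suc h , inj₁ refl = even-exponent-excluded 1≤a condition h m 1<m
... | h     , inj₂ refl = odd-exponent-excluded a h m 1<m
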